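{- Let $k\in\mathbb{N}$, let $1\le p<\infty$, and let $(\mu_i)_{i\in\mathbb{N}}$ be a sequence of positive real numbers with $\sum_{i=1}^\infty\mu_i^p<\infty$. Let $\overline{V^{\otimes k}}=L^p(\mathbb{N}^k,\mu^k)$ be the associated weighted sequence space with the diagonal action of the infinite symmetric group $S_\infty$ by bounded operators, and let $\mathcal{B}(\overline{V^{\otimes k}})$ be the algebra of bounded linear operators on $\overline{V^{\otimes k}}$. Then the centralizer of $\mathbb{C}S_\infty$ in $\mathcal{B}(\overline{V^{\otimes k}})$, that is, the algebra of all $A\in\mathcal{B}(\overline{V^{\otimes k}})$ with $\sigma A=A\sigma$ for all $\sigma\in S_\infty$, is isomorphic as a $\mathbb{C}$-algebra to the finite-dimensional algebra $U_k$ of uniform block permutations.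
   Context: $\mathbb{N}=\{1,2,\dots\}$. $S_\infty$ is the group of permutations of $\mathbb{N}$ that fix all but finitely many elements. For $\mathbf{i}=(i_1,\dots,i_k)\in\mathbb{N}^k$ put $\mu_{\mathbf{i}}=\prod_{\ell=1}^k\mu_{i_\ell}$ and, for $\sigma\in S_\infty$, $\sigma(\mathbf{i})=(\sigma(i_1),\dots,\sigma(i_k))$. The space is $$\overline{V^{\otimes k}}=L^p(\mathbb{N}^k,\mu^k)=\Bigl\{v=(a_{\mathbf{i}})_{\mathbf{i}\in\mathbb{N}^k}\in\mathbb{C}^{\mathbb{N}^k}\ \Big|\ \|v\|^p=\sum_{\mathbf{i}\in\mathbb{N}^k}|a_{\mathbf{i}}|^p\mu_{\mathbf{i}}^p<\infty\Bigr\},$$ a Banach space which is the completion, for a canonical cross norm, of the $k$-fold algebraic tensor power of $V=L^p(\mathbb{N},\mu)=\{(a_i)_{i\in\mathbb{N}}\in\mathbb{C}^{\mathbb{N}}\mid \sum_i|a_i|^p\mu_i^p<\infty\}$. The action of $\sigma\in S_\infty$ is $\sigma\cdot (a_{\mathbf{i}})_{\mathbf{i}}=(a_{\sigma^{ -1}(\mathbf{i})})_{\mathbf{i}}$; equivalently $\sigma\cdot v_{\mathbf{i}}=v_{\sigma(\mathbf{i})}$, where $v_{\mathbf{i}}$ is the indicator function of $\mathbf{i}$. Each $\sigma$ acts as a bounded operator. Diagrams. Let $[k]=\{1,\dots,k\}$ and $[k']=\{1',\dots,k'\}$, with $[k]\cup[k']$ a set of $2k$ elements. A $k$-diagram is a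 set partition of $[k]\cup[k']$, drawn as a graph (up to having the same connected components, which are the blocks) with top row of vertices $1,\dots,k$ and bottom row $1',\dots,k'$. The concatenation product $d_1*d_2$ of diagrams $d_1,d_2$ is obtained by placing $d_1$ on top of $d_2$, identifying the bottom vertex $\ell'$ of $d_1$ with the top vertex $\ell$ of $d_2$ for each $\ell$, taking connected components, and restricting them to the top vertices of $d_1$ and the bottom vertices of $d_2$. (In the general partition algebra a factor $x^m$ is included, where $m$ is the number of components consisting only of middle vertices; for the diagrams spanning $U_k$ always $m=0$, so no parameter is involved.) $U_k$ is the $\mathbb{C}$-algebra with basis the $k$-diagrams $d$ such that $|B\cap[k]|=|B\cap[k']|$ for every block $B$ of $d$, with multiplication the bilinear extension of the concatenation product $d_1*d_2$ of diagrams; its identity is the diagram $\{\{1,1'\},\dots,\{k,k'\}\}$. -}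

module Defs where

open import Level using (0ℓ) renaming (suc to lsuc)
open import Algebra.Bundles using (CommutativeRing)
open import Algebra.Bundles.Raw using (RawRing)
open import Algebra.Module.Bundles.Raw using (RawLeftModule)
import Algebra.Properties.Ring as RingProperties
import Algebra.Properties.Semiring.Mult as Multiples
import Algebra.Properties.CommutativeSemiring.Exp as NatPowers
import Algebra.Solver.Ring.NaturalCoefficients.Default as SemiringSolver
open import Axiom.ExcludedMiddle using (ExcludedMiddle)
open import Data.Empty using (⊥-elim)
open import Data.Fin.Base using (Fin)
open import Data.List.Base as List using (List; []; _∷_; _++_; length; filter; allFin; cartesianProductWith)
open import Data.List.Membership.Propositional using (_∈_)
open import Data.List.Membership.Propositional.Properties using (∈-map⁺; ∈-++⁺ˡ; ∈-++⁺ʳ; ∈-allFin)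
open import Data.List.Relation.Unary.Any using (here; there)
open import Data.List.Relation.Unary.Unique.Propositional using (Unique)
import Data.List.Relation.Unary.AllPairs as AllPairs
import Data.List.Relation.Unary.Unique.Propositional.Properties as Unique
open import Data.Nat.Base as ℕ using (ℕ; zero; suc)
import Data.Nat.Properties as ℕₚ
open import Data.Product.Base using (∃; ∃₂; _×_; _,_; proj₁; proj₂; map₁)
open import Data.Sum.Base using (_⊎_; inj₁; inj₂; [_,_])
open import Data.Vec.Base as Vec using (Vec; []; _∷_)
import Data.Vec.Properties as Vecₚ
open import Function.Base using (_∘_; id)
open import Function.Bundles using (_↔_; _⇔_; Inverse; Equivalence; mk⇔)
open import Relation.Binary.Bundles using (Poset)
open import Relation.Binary.Core using (Rel)
open import Relation.Binary.Structures using (IsEquivalence; IsTotalOrder)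
import Relation.Binary.Construct.NonStrictToStrict as NonStrictToStrict
import Relation.Binary.Construct.On as On
open import Relation.Binary.Construct.Closure.Equivalence as Closure using (EqClosure)
open import Relation.Binary.Construct.Closure.ReflexiveTransitive using (_◅_)
open import Relation.Binary.Construct.Closure.Symmetric using (bwd)
import Relation.Binary.Reasoning.PartialOrder as PartialOrderReasoning
open import Relation.Binary.PropositionalEquality as ≡ using (_≡_)
open import Relation.Nullary.Decidable.Core using (yes; no; does)
open import Relation.Nullary.Negation.Core using (¬_)
open import Data.Bool.Base using (if_then_else_)

------------------------------------------------------------------------
-- Real numbers

-- The standard library has no real numbers; ℝ is characterised
-- (uniquely up to isomorphism, classically) as a Dedekind-complete
-- ordered field.

record CompleteOrderedField : Set₁ where
  infix 4 _≤_
  field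
    commutativeRing : CommutativeRing 0ℓ 0ℓ

  open CommutativeRing commutativeRing public

  field
    _≤_          : Rel Carrier 0ℓ
    isTotalOrder : IsTotalOrder _≈_ _≤_
    0≉1          : ¬ (0# ≈ 1#)
    inverse      : ∀ x → ¬ (x ≈ 0#) → ∃ λ y → x * y ≈ 1#
    +-monoʳ-≤    : ∀ z {x y} → x ≤ y → z + x ≤ z + y
    *-nonneg     : ∀ {x y} → 0# ≤ x → 0# ≤ y → 0# ≤ x * y

  IsUpperBound : (Carrier → Set) → Carrier → Set
  IsUpperBound P b = ∀ x → P x → x ≤ b

  IsSupremum : (Carrier → Set) → Carrier → Set
  IsSupremum P s = IsUpperBound P s × (∀ b → IsUpperBound P b → s ≤ b)

  field
    complete : (P : Carrier → Set) → ∃ P → ∃ (IsUpperBound P) → ∃ (IsSupremum P)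

  open NonStrictToStrict _≈_ _≤_ public using (_<_)

-- Everything below is classical mathematics over a fixed ℝ.

module Classical (em : ExcludedMiddle 0ℓ) (ℝ : CompleteOrderedField) where

  open CompleteOrderedField ℝ
  open IsTotalOrder isTotalOrder using (total)
    renaming (refl to ≤-refl; reflexive to ≤-reflexive; trans to ≤-trans; antisym to ≤-antisym)
  open NatPowers commutativeSemiring using (_^_; ^-congˡ; ^-homo-*; ^-assocʳ; ^-distrib-*)
  open Multiples semiring using () renaming (_×_ to _·_)
  open RingProperties ring using (-‿distribˡ-*; -‿distribʳ-*; -‿involutive)

  private
    poset : Poset 0ℓ 0ℓ 0ℓ
    poset = record { isPartialOrder = IsTotalOrder.isPartialOrder isTotalOrder }

    module ≤-Reasoning = PartialOrderReasoning poset
    module Solver = SemiringSolver commutativeSemiring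

  ----------------------------------------------------------------------
  -- Ordered field lemmas

  ≤-respˡ : ∀ {x y z} → x ≈ y → x ≤ z → y ≤ z
  ≤-respˡ e h = ≤-trans (≤-reflexive (sym e)) h

  ≤-respʳ : ∀ {x y z} → y ≈ z → x ≤ y → x ≤ z
  ≤-respʳ e h = ≤-trans h (≤-reflexive e)

  +-mono-≤ : ∀ {x y u v} → x ≤ y → u ≤ v → x + u ≤ y + v
  +-mono-≤ {x} {y} {u} {v} h₁ h₂ =
    ≤-trans (+-monoʳ-≤ x h₂) (≤-respˡ (+-comm v x) (≤-respʳ (+-comm v y) (+-monoʳ-≤ v h₁)))

  +-nonneg : ∀ {x y} → 0# ≤ x → 0# ≤ y → 0# ≤ x + y
  +-nonneg h₁ h₂ = ≤-respˡ (+-identityˡ 0#) (+-mono-≤ h₁ h₂)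

  x≤y⇒0≤y-x : ∀ {x y} → x ≤ y → 0# ≤ y - x
  x≤y⇒0≤y-x {x} {y} h =
    ≤-respˡ (-‿inverseˡ x) (≤-respʳ (+-comm (- x) y) (+-monoʳ-≤ (- x) h))

  0≤y-x⇒x≤y : ∀ {x y} → 0# ≤ y - x → x ≤ y
  0≤y-x⇒x≤y {x} {y} h = ≤-respˡ (+-identityʳ x) (≤-respʳ eq (+-monoʳ-≤ x h))
    where
    eq : x + (y - x) ≈ y
    eq = trans (+-comm x (y - x)) (trans (+-assoc y (- x) x)
           (trans (+-congˡ (-‿inverseˡ x)) (+-identityʳ y)))

  *-monoˡ-≤ : ∀ {z x y} → 0# ≤ z → x ≤ y → z * x ≤ z * y
  *-monoˡ-≤ {z} {x} {y} 0≤z h = 0≤y-x⇒x≤y (≤-respʳ eq (*-nonneg 0≤z (x≤y⇒0≤y-x h)))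
    where
    eq : z * (y - x) ≈ z * y - z * x
    eq = trans (distribˡ z y (- x)) (+-congˡ (sym (-‿distribʳ-* z x)))

  *-monoʳ-≤ : ∀ {z x y} → 0# ≤ z → x ≤ y → x * z ≤ y * z
  *-monoʳ-≤ {z} {x} {y} 0≤z h = ≤-respˡ (*-comm z x) (≤-respʳ (*-comm z y) (*-monoˡ-≤ 0≤z h))

  *-mono-≤ : ∀ {x y u v} → 0# ≤ y → 0# ≤ u → x ≤ y → u ≤ v → x * u ≤ y * v
  *-mono-≤ 0≤y 0≤u h₁ h₂ = ≤-trans (*-monoʳ-≤ 0≤u h₁) (*-monoˡ-≤ 0≤y h₂)

  square-nonneg : ∀ x → 0# ≤ x * x
  square-nonneg x with total 0# x
  ... | inj₁ 0≤x = *-nonneg 0≤x 0≤x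
  ... | inj₂ x≤0 = ≤-respʳ eq (*-nonneg 0≤-x 0≤-x)
    where
    0≤-x : 0# ≤ - x
    0≤-x = ≤-respʳ (+-identityˡ (- x)) (x≤y⇒0≤y-x x≤0)
    eq : - x * - x ≈ x * x
    eq = trans (sym (-‿distribˡ-* x (- x)))
           (trans (-‿cong (sym (-‿distribʳ-* x x))) (-‿involutive (x * x)))

  0≤1 : 0# ≤ 1#
  0≤1 = ≤-respʳ (*-identityˡ 1#) (square-nonneg 1#)

  ¬1≤0 : ¬ (1# ≤ 0#)
  ¬1≤0 h = 0≉1 (≤-antisym 0≤1 h)

  0≤1+x : ∀ {x} → 0# ≤ x → 0# ≤ 1# + x
  0≤1+x = +-nonneg 0≤1

  x≤x+y : ∀ x {y} → 0# ≤ y → x ≤ x + y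
  x≤x+y x 0≤y = ≤-respˡ (+-identityʳ x) (+-monoʳ-≤ x 0≤y)

  y≤x+y : ∀ {x} y → 0# ≤ x → y ≤ x + y
  y≤x+y {x} y 0≤x = ≤-respʳ (+-comm y x) (x≤x+y y 0≤x)

  2# : Carrier
  2# = 1# + 1#

  0≤2 : 0# ≤ 2#
  0≤2 = +-nonneg 0≤1 0≤1

  -- With the convention recip 0 = 0.
  recip : Carrier → Carrier
  recip x with em {x ≈ 0#}
  ... | yes _  = 0#
  ... | no x≉0 = proj₁ (inverse x x≉0)

  recip-inverse : ∀ {x} → ¬ (x ≈ 0#) → x * recip x ≈ 1#
  recip-inverse {x} x≉0 with em {x ≈ 0#}
  ... | yes x≈0 = ⊥-elim (x≉0 x≈0)
  ... | no x≉0′ = proj₂ (inverse x x≉0′)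

  1≤x⇒0≤x : ∀ {x} → 1# ≤ x → 0# ≤ x
  1≤x⇒0≤x = ≤-trans 0≤1

  1≤x⇒x≉0 : ∀ {x} → 1# ≤ x → ¬ (x ≈ 0#)
  1≤x⇒x≉0 1≤x x≈0 = ¬1≤0 (≤-respʳ x≈0 1≤x)

  recip-nonneg : ∀ {x} → 0# ≤ x → 0# ≤ recip x
  recip-nonneg {x} 0≤x with em {x ≈ 0#}
  ... | yes _  = ≤-refl
  ... | no x≉0 with total 0# (proj₁ (inverse x x≉0))
  ...   | inj₁ h = h
  ...   | inj₂ h = ⊥-elim (¬1≤0 (≤-respˡ (proj₂ (inverse x x≉0))
                     (≤-respʳ (zeroʳ x) (*-monoˡ-≤ 0≤x h))))

  *-cancelˡ-≤ : ∀ {z x y} → 0# ≤ z → ¬ (z ≈ 0#) → z * x ≤ z * y → x ≤ y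
  *-cancelˡ-≤ {z} {x} {y} 0≤z z≉0 h =
    ≤-respˡ (eq x) (≤-respʳ (eq y) (*-monoˡ-≤ (recip-nonneg 0≤z) h))
    where
    eq : ∀ t → recip z * (z * t) ≈ t
    eq t = trans (sym (*-assoc (recip z) z t))
             (trans (*-congʳ (trans (*-comm (recip z) z) (recip-inverse z≉0))) (*-identityˡ t))

  +-interchange : ∀ a b c d → (a + b) + (c + d) ≈ (a + c) + (b + d)
  +-interchange = solve 4 (λ a b c d → (a :+ b) :+ (c :+ d) := (a :+ c) :+ (b :+ d)) refl
    where open Solver

  ----------------------------------------------------------------------
  -- Natural powers

  ^-nonneg : ∀ {x} n → 0# ≤ x → 0# ≤ x ^ n
  ^-nonneg zero    h = 0≤1
  ^-nonneg (suc n) h = *-nonneg h (^-nonneg n h)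

  ^-monoˡ-≤ : ∀ {x y} n → 0# ≤ x → x ≤ y → x ^ n ≤ y ^ n
  ^-monoˡ-≤ zero    0≤x h = ≤-refl
  ^-monoˡ-≤ (suc n) 0≤x h = *-mono-≤ (≤-trans 0≤x h) (^-nonneg n 0≤x) h (^-monoˡ-≤ n 0≤x h)

  1^n≈1 : ∀ n → 1# ^ n ≈ 1#
  1^n≈1 zero    = refl
  1^n≈1 (suc n) = trans (*-identityˡ (1# ^ n)) (1^n≈1 n)

  1≤x^n : ∀ {x} n → 1# ≤ x → 1# ≤ x ^ n
  1≤x^n n h = ≤-respˡ (1^n≈1 n) (^-monoˡ-≤ n 0≤1 h)

  x^n≤1 : ∀ {x} n → 0# ≤ x → x ≤ 1# → x ^ n ≤ 1#
  x^n≤1 n 0≤x h = ≤-respʳ (1^n≈1 n) (^-monoˡ-≤ n 0≤x h)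

  private
    ^-split : ∀ {m n} x → m ℕ.≤ n → x ^ n ≈ x ^ m * x ^ (n ℕ.∸ m)
    ^-split {m} {n} x m≤n =
      trans (reflexive (≡.cong (x ^_) (≡.sym (ℕₚ.m+[n∸m]≡n m≤n)))) (^-homo-* x m (n ℕ.∸ m))

  ^-monoʳ-≤ : ∀ {x m n} → 1# ≤ x → m ℕ.≤ n → x ^ m ≤ x ^ n
  ^-monoʳ-≤ {x} {m} {n} 1≤x m≤n =
    ≤-respˡ (*-identityʳ (x ^ m)) (≤-respʳ (sym (^-split x m≤n))
      (*-monoˡ-≤ (^-nonneg m (1≤x⇒0≤x 1≤x)) (1≤x^n (n ℕ.∸ m) 1≤x)))

  ^-antiʳ-≤ : ∀ {x m n} → 0# ≤ x → x ≤ 1# → m ℕ.≤ n → x ^ n ≤ x ^ m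
  ^-antiʳ-≤ {x} {m} {n} 0≤x x≤1 m≤n =
    ≤-respʳ (*-identityʳ (x ^ m)) (≤-respˡ (sym (^-split x m≤n))
      (*-monoˡ-≤ (^-nonneg m 0≤x) (x^n≤1 (n ℕ.∸ m) 0≤x x≤1)))

  ^-≉0 : ∀ {x} n → ¬ (x ≈ 0#) → ¬ (x ^ n ≈ 0#)
  ^-≉0 zero    x≉0 e = 0≉1 (sym e)
  ^-≉0 {x} (suc n) x≉0 e = ^-≉0 n x≉0 (trans (sym eq) (trans (*-congˡ e) (zeroʳ (recip x))))
    where
    eq : recip x * (x * x ^ n) ≈ x ^ n
    eq = trans (sym (*-assoc (recip x) x (x ^ n)))
           (trans (*-congʳ (trans (*-comm (recip x) x) (recip-inverse x≉0))) (*-identityˡ (x ^ n)))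

  ^-cancel-≤ : ∀ {x y} n → 0# ≤ x → 0# ≤ y → x ^ suc n ≤ y ^ suc n → x ≤ y
  ^-cancel-≤ {x} {y} n 0≤x 0≤y h with em {x ≈ 0#} | total x y
  ... | yes x≈0 | _        = ≤-respˡ (sym x≈0) 0≤y
  ... | no _    | inj₁ x≤y = x≤y
  ... | no x≉0  | inj₂ y≤x = *-cancelˡ-≤ (^-nonneg n 0≤x) (^-≉0 n x≉0)
    (≤-respˡ (*-comm x (x ^ n)) (≤-respʳ (*-comm y (x ^ n))
      (≤-trans h (*-monoˡ-≤ 0≤y (^-monoˡ-≤ n 0≤y y≤x)))))

  ----------------------------------------------------------------------
  -- Natural numbers as reals

  ι : ℕ → Carrier
  ι n = n · 1#

  ι-nonneg : ∀ n → 0# ≤ ι n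
  ι-nonneg zero    = ≤-refl
  ι-nonneg (suc n) = 0≤1+x (ι-nonneg n)

  ι-mono : ∀ {m n} → m ℕ.≤ n → ι m ≤ ι n
  ι-mono {n = n} ℕ.z≤n   = ι-nonneg n
  ι-mono (ℕ.s≤s h) = +-monoʳ-≤ 1# (ι-mono h)

  ι-+ : ∀ m n → ι (m ℕ.+ n) ≈ ι m + ι n
  ι-+ zero    n = sym (+-identityˡ (ι n))
  ι-+ (suc m) n = trans (+-congˡ (ι-+ m n)) (sym (+-assoc 1# (ι m) (ι n)))

  ι-* : ∀ m n → ι (m ℕ.* n) ≈ ι m * ι n
  ι-* zero    n = sym (zeroˡ (ι n))
  ι-* (suc m) n = trans (ι-+ n (m ℕ.* n))
    (trans (+-cong (sym (*-identityˡ (ι n))) (ι-* m n)) (sym (distribʳ (ι n) 1# (ι m))))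

  private
    ¬1+x≤x : ∀ {x} → ¬ (1# + x ≤ x)
    ¬1+x≤x {x} h = ¬1≤0 (≤-respˡ eq (≤-respʳ (-‿inverseˡ x) (+-monoʳ-≤ (- x) h)))
      where
      eq : - x + (1# + x) ≈ 1#
      eq = trans (+-comm (- x) (1# + x)) (trans (+-assoc 1# x (- x))
             (trans (+-congˡ (-‿inverseʳ x)) (+-identityʳ 1#)))

  ι-cancel-≤ : ∀ {m n} → ι m ≤ ι n → m ℕ.≤ n
  ι-cancel-≤ {m} {n} h with m ℕₚ.≤? n
  ... | yes m≤n = m≤n
  ... | no m≰n  = ⊥-elim (¬1+x≤x (≤-trans (ι-mono (ℕₚ.≰⇒> m≰n)) h))

  archimedean : ∀ x → ∃ λ n → x ≤ ι n
  archimedean x with em {∃ λ n → x ≤ ι n}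
  ... | yes h = h
  ... | no ¬h = ⊥-elim (¬1+x≤x (≤-respˡ (+-comm s 1#) s+1≤s))
    where
    IsNat : Carrier → Set
    IsNat y = ∃ λ n → y ≈ ι n
    bounded : IsUpperBound IsNat x
    bounded y (n , e) with total y x
    ... | inj₁ y≤x = y≤x
    ... | inj₂ x≤y = ⊥-elim (¬h (n , ≤-respʳ e x≤y))
    sup = complete IsNat (0# , 0 , refl) (x , bounded)
    s = proj₁ sup
    s+1≤s : s + 1# ≤ s
    s+1≤s = 0≤y-x⇒x≤y (≤-respʳ eq (x≤y⇒0≤y-x (proj₂ (proj₂ sup) (s - 1#) ub)))
      where
      ub : IsUpperBound IsNat (s - 1#)
      ub y (n , e) = ≤-respˡ eq′ (≤-respʳ (+-comm (- 1#) s)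
        (+-monoʳ-≤ (- 1#) (proj₁ (proj₂ sup) (ι (suc n)) (suc n , refl))))
        where
        eq′ : - 1# + (1# + ι n) ≈ y
        eq′ = trans (sym (+-assoc (- 1#) 1# (ι n))) (trans (+-congʳ (-‿inverseˡ 1#))
                (trans (+-identityˡ (ι n)) (sym e)))
      eq : (s - 1#) - s ≈ s - (s + 1#)
      eq = trans (+-assoc s (- 1#) (- s))
             (+-congˡ (trans (+-comm (- 1#) (- s)) (RingProperties.-‿+-comm ring s 1#)))

  ----------------------------------------------------------------------
  -- Suprema, with value 0 for sets that are empty or unbounded

  ⋁ : (Carrier → Set) → Carrier
  ⋁ P with em {∃ P × ∃ (IsUpperBound P)}
  ... | yes (inhabited , bounded) = proj₁ (complete P inhabited bounded)
  ... | no _                      = 0#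

  ⋁-isSupremum : ∀ {P} → ∃ P → ∃ (IsUpperBound P) → IsSupremum P (⋁ P)
  ⋁-isSupremum {P} inhabited bounded with em {∃ P × ∃ (IsUpperBound P)}
  ... | yes (i , b) = proj₂ (complete P i b)
  ... | no ¬h       = ⊥-elim (¬h (inhabited , bounded))

  ----------------------------------------------------------------------
  -- Real powers x ** q, for x ≥ 0 and q > 0

  -- y ∈ PowerCut x q when y ≤ x ^ r for a rational r = m / (1 + n) such
  -- that x ^ r ≤ x ** q, i.e. r ≤ q if x ≥ 1 and r ≥ q if x ≤ 1.
  PowerCut : Carrier → Carrier → Carrier → Set
  PowerCut x q y = 0# ≤ y × (∃₂ λ m n → y ^ suc n ≤ x ^ m ×
    ((1# ≤ x × ι m ≤ q * ι (suc n)) ⊎ (x ≤ 1# × q * ι (suc n) ≤ ι m)))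

  infixr 8 _**_

  _**_ : Carrier → Carrier → Carrier
  x ** q = ⋁ (PowerCut x q)

  private
    exponent-≤ : ∀ {q N m n} → q ≤ ι N → ι m ≤ q * ι n → m ℕ.≤ N ℕ.* n
    exponent-≤ {q} {N} {m} {n} q≤N h = ι-cancel-≤
      (≤-trans h (≤-respʳ (sym (ι-* N n)) (*-monoʳ-≤ (ι-nonneg n) q≤N)))

    cut-bounded : ∀ x q → 0# ≤ x → ∃ (IsUpperBound (PowerCut x q))
    cut-bounded x q 0≤x = (1# + x) ^ N , bound
      where
      N = proj₁ (archimedean q)
      q≤N = proj₂ (archimedean q)
      1≤1+x : 1# ≤ 1# + x
      1≤1+x = x≤x+y 1# 0≤x
      bound : IsUpperBound (PowerCut x q) ((1# + x) ^ N)
      bound y (0≤y , m , n , h , inj₁ (1≤x , m≤qn)) =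
        ^-cancel-≤ n 0≤y (^-nonneg N (0≤1+x 0≤x))
          (≤-trans h (≤-trans (^-monoˡ-≤ m 0≤x (y≤x+y x 0≤1))
            (≤-respʳ (sym (^-assocʳ (1# + x) N (suc n)))
              (^-monoʳ-≤ 1≤1+x (exponent-≤ {N = N} {m} {suc n} q≤N m≤qn)))))
      bound y (0≤y , m , n , h , inj₂ (x≤1 , _)) =
        ^-cancel-≤ n 0≤y (^-nonneg N (0≤1+x 0≤x))
          (≤-trans h (≤-trans (x^n≤1 m 0≤x x≤1) (1≤x^n (suc n) (1≤x^n N 1≤1+x))))

    small∈cut : ∀ {x q N} → 0# ≤ x → x ≤ 1# → q ≤ ι N → PowerCut x q (x ^ N)
    small∈cut {x} {q} {N} 0≤x x≤1 q≤N =
      ^-nonneg N 0≤x , N , 0 , ≤-reflexive (*-identityʳ (x ^ N)) ,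
      inj₂ (x≤1 , ≤-respˡ (sym (trans (*-congˡ (+-identityʳ 1#)) (*-identityʳ q))) q≤N)

    1∈cut : ∀ {x q} → 0# ≤ q → 1# ≤ x → PowerCut x q 1#
    1∈cut 0≤q 1≤x = 0≤1 , 0 , 0 , ≤-reflexive (*-identityʳ 1#) ,
      inj₁ (1≤x , *-nonneg 0≤q (ι-nonneg 1))

    cut-inhabited : ∀ x q → 0# ≤ x → 0# ≤ q → ∃ (PowerCut x q)
    cut-inhabited x q 0≤x 0≤q with total x 1#
    ... | inj₁ x≤1 = x ^ proj₁ (archimedean q) , small∈cut {N = proj₁ (archimedean q)} 0≤x x≤1 (proj₂ (archimedean q))
    ... | inj₂ 1≤x = 1# , 1∈cut 0≤q 1≤x

  **-isSupremum : ∀ {x q} → 0# ≤ x → 0# ≤ q → IsSupremum (PowerCut x q) (x ** q)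
  **-isSupremum {x} {q} 0≤x 0≤q =
    ⋁-isSupremum (cut-inhabited x q 0≤x 0≤q) (cut-bounded x q 0≤x)

  **-nonneg : ∀ {x q} → 0# ≤ x → 0# ≤ q → 0# ≤ x ** q
  **-nonneg {x} {q} 0≤x 0≤q with cut-inhabited x q 0≤x 0≤q
  ... | y , y∈ = ≤-trans (proj₁ y∈) (proj₁ (**-isSupremum 0≤x 0≤q) y y∈)

  **-mono-≤ : ∀ {x y q} → 0# ≤ q → 0# ≤ x → x ≤ y → x ** q ≤ y ** q
  **-mono-≤ {x} {y} {q} 0≤q 0≤x x≤y = proj₂ (**-isSupremum 0≤x 0≤q) (y ** q) bound
    where
    upper = proj₁ (**-isSupremum (≤-trans 0≤x x≤y) 0≤q)
    bound : IsUpperBound (PowerCut x q) (y ** q)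
    bound t (0≤t , m , n , h , inj₁ (1≤x , r)) =
      upper t (0≤t , m , n , ≤-trans h (^-monoˡ-≤ m 0≤x x≤y) , inj₁ (≤-trans 1≤x x≤y , r))
    bound t (0≤t , m , n , h , inj₂ (x≤1 , r)) with total y 1#
    ... | inj₁ y≤1 = upper t (0≤t , m , n , ≤-trans h (^-monoˡ-≤ m 0≤x x≤y) , inj₂ (y≤1 , r))
    ... | inj₂ 1≤y = ≤-trans
      (^-cancel-≤ n 0≤t 0≤1
        (≤-respʳ (sym (1^n≈1 (suc n))) (≤-trans h (x^n≤1 m 0≤x x≤1))))
      (upper 1# (1∈cut 0≤q 1≤y))

  **-congˡ : ∀ {x y q} → 0# ≤ q → 0# ≤ x → x ≈ y → x ** q ≈ y ** q
  **-congˡ 0≤q 0≤x e = ≤-antisym (**-mono-≤ 0≤q 0≤x (≤-reflexive e))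
    (**-mono-≤ 0≤q (≤-respʳ e 0≤x) (≤-reflexive (sym e)))

  **-dilate : ∀ {q N c} → 0# ≤ q → q ≤ ι N → 1# ≤ c →
              ∀ {x} → 0# ≤ x → (c * x) ** q ≤ c ^ N * x ** q
  **-dilate {q} {N} {c} 0≤q q≤N 1≤c {x} 0≤x =
    proj₂ (**-isSupremum 0≤cx 0≤q) (c ^ N * x ** q) bound
    where
    0≤c = 1≤x⇒0≤x 1≤c
    0≤cx = *-nonneg 0≤c 0≤x
    d = recip c
    0≤d = recip-nonneg 0≤c
    cd≈1 : c * d ≈ 1#
    cd≈1 = recip-inverse (1≤x⇒x≉0 1≤c)
    d≤1 : d ≤ 1#
    d≤1 = ≤-respˡ (*-identityˡ d) (≤-respʳ cd≈1 (*-monoʳ-≤ 0≤d 1≤c))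
    x≤cx : x ≤ c * x
    x≤cx = ≤-respˡ (*-identityˡ x) (*-monoʳ-≤ 0≤x 1≤c)
    upper = proj₁ (**-isSupremum 0≤x 0≤q)

    shrink : ∀ {m M} → m ℕ.≤ M → (c * x) ^ m * d ^ M ≤ x ^ m
    shrink {m} {M} m≤M = ≤-respʳ
      (trans (sym (^-distrib-* (c * x) d m)) (^-congˡ m eq))
      (*-monoˡ-≤ (^-nonneg m 0≤cx) (^-antiʳ-≤ 0≤d d≤1 m≤M))
      where
      eq : c * x * d ≈ x
      eq = trans (*-congʳ (*-comm c x)) (trans (*-assoc x c d)
             (trans (*-congˡ cd≈1) (*-identityʳ x)))

    rescale : ∀ {y m n} → 0# ≤ y → y ^ suc n ≤ (c * x) ^ m → m ℕ.≤ N ℕ.* suc n →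
              (1# ≤ x × ι m ≤ q * ι (suc n)) ⊎ (x ≤ 1# × q * ι (suc n) ≤ ι m) →
              y ≤ c ^ N * x ** q
    rescale {y} {m} {n} 0≤y h m≤M side =
      ≤-respˡ eq (*-monoˡ-≤ (^-nonneg N 0≤c) (upper (y * d ^ N) member))
      where
      member : PowerCut x q (y * d ^ N)
      member = *-nonneg 0≤y (^-nonneg N 0≤d) , m , n ,
        ≤-respˡ (sym (trans (^-distrib-* y (d ^ N) (suc n)) (*-congˡ (^-assocʳ d N (suc n)))))
          (≤-trans (*-monoʳ-≤ (^-nonneg (N ℕ.* suc n) 0≤d) h) (shrink {m} m≤M)) ,
        side
      eq : c ^ N * (y * d ^ N) ≈ y
      eq = trans (*-comm (c ^ N) (y * d ^ N)) (trans (*-assoc y (d ^ N) (c ^ N))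
             (trans (*-congˡ (trans (*-comm (d ^ N) (c ^ N))
               (trans (sym (^-distrib-* c d N)) (trans (^-congˡ N cd≈1) (1^n≈1 N)))))
               (*-identityʳ y)))

    bound : IsUpperBound (PowerCut (c * x) q) (c ^ N * x ** q)
    bound y (0≤y , m , n , h , inj₁ (1≤cx , m≤qn)) with total x 1#
    ... | inj₂ 1≤x = rescale {m = m} 0≤y h (exponent-≤ {N = N} {m} {suc n} q≤N m≤qn) (inj₁ (1≤x , m≤qn))
    ... | inj₁ x≤1 = ≤-trans
      (^-cancel-≤ n 0≤y (^-nonneg N 0≤cx)
        (≤-trans h (≤-respʳ (sym (^-assocʳ (c * x) N (suc n)))
          (^-monoʳ-≤ 1≤cx (exponent-≤ {N = N} {m} {suc n} q≤N m≤qn)))))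
      (≤-respˡ (sym (^-distrib-* c x N))
        (*-monoˡ-≤ (^-nonneg N 0≤c) (upper (x ^ N) (small∈cut {N = N} 0≤x x≤1 q≤N))))
    bound y (0≤y , m , n , h , inj₂ (cx≤1 , qn≤m)) with ℕₚ.≤-total m (N ℕ.* suc n)
    ... | inj₁ m≤M = rescale {m = m} 0≤y h m≤M (inj₂ (≤-trans x≤cx cx≤1 , qn≤m))
    ... | inj₂ M≤m = rescale {m = N ℕ.* suc n} 0≤y (≤-trans h (^-antiʳ-≤ 0≤cx cx≤1 M≤m)) ℕₚ.≤-refl
      (inj₂ (≤-trans x≤cx cx≤1 ,
        ≤-respʳ (sym (ι-* N (suc n))) (*-monoʳ-≤ (ι-nonneg (suc n)) q≤N)))

  PowerBound₁ PowerBound₂ : Carrier → Carrier → Carrier → Set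
  PowerBound₁ q c K = ∀ {x t} → 0# ≤ x → 0# ≤ t → t ≤ c * x → t ** q ≤ K * x ** q
  PowerBound₂ q c K = ∀ {x y t} → 0# ≤ x → 0# ≤ y → 0# ≤ t →
                      t ≤ c * (x + y) → t ** q ≤ K * (x ** q + y ** q)

  **-bound₁ : ∀ q c → 0# ≤ q → 0# ≤ c → ∃ λ K → 0# ≤ K × PowerBound₁ q c K
  **-bound₁ q c 0≤q 0≤c = (1# + c) ^ N , ^-nonneg N (0≤1+x 0≤c) , λ 0≤x 0≤t t≤cx →
    ≤-trans
      (**-mono-≤ 0≤q 0≤t (≤-trans t≤cx (*-monoʳ-≤ 0≤x (y≤x+y c 0≤1))))
      (**-dilate {N = N} 0≤q (proj₂ (archimedean q)) (x≤x+y 1# 0≤c) 0≤x)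
    where
    N = proj₁ (archimedean q)

  **-bound₂ : ∀ q c → 0# ≤ q → 0# ≤ c → ∃ λ K → 0# ≤ K × PowerBound₂ q c K
  **-bound₂ q c 0≤q 0≤c = K , 0≤K , bound
    where
    scaled = **-bound₁ q (c * 2#) 0≤q (*-nonneg 0≤c 0≤2)
    K = proj₁ scaled
    0≤K = proj₁ (proj₂ scaled)

    double : ∀ {x y z} → x ≤ z → y ≤ z → c * (x + y) ≤ c * 2# * z
    double {x} {y} {z} x≤z y≤z = ≤-respʳ eq (*-monoˡ-≤ 0≤c (+-mono-≤ x≤z y≤z))
      where
      eq : c * (z + z) ≈ c * 2# * z
      eq = trans (*-congˡ (trans (sym (+-cong (*-identityˡ z) (*-identityˡ z)))
             (sym (distribʳ z 1# 1#)))) (sym (*-assoc c 2# z))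

    bound : PowerBound₂ q c K
    bound {x} {y} 0≤x 0≤y 0≤t h with total x y
    ... | inj₁ x≤y = ≤-trans
      (proj₂ (proj₂ scaled) 0≤y 0≤t (≤-trans h (double x≤y ≤-refl)))
      (*-monoˡ-≤ 0≤K (y≤x+y (y ** q) (**-nonneg 0≤x 0≤q)))
    ... | inj₂ y≤x = ≤-trans
      (proj₂ (proj₂ scaled) 0≤x 0≤t (≤-trans h (double ≤-refl y≤x)))
      (*-monoˡ-≤ 0≤K (x≤x+y (x ** q) (**-nonneg 0≤y 0≤q)))

  ----------------------------------------------------------------------
  -- Complex numbers

  infixl 6 _+i_

  record ℂ : Set where
    constructor _+i_
    field
      re im : Carrier

  open ℂ public

  infix  4 _≈ᶜ_
  infixl 6 _+ᶜ_
  infixl 7 _*ᶜ_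

  record _≈ᶜ_ (z w : ℂ) : Set where
    constructor _,_
    field
      re-≈ : re z ≈ re w
      im-≈ : im z ≈ im w

  open _≈ᶜ_ public

  0ᶜ 1ᶜ : ℂ
  0ᶜ = 0# +i 0#
  1ᶜ = 1# +i 0#

  _+ᶜ_ _*ᶜ_ : ℂ → ℂ → ℂ
  (a +i b) +ᶜ (c +i d) = (a + c) +i (b + d)
  (a +i b) *ᶜ (c +i d) = (a * c - b * d) +i (a * d + b * c)

  -ᶜ_ : ℂ → ℂ
  -ᶜ (a +i b) = (- a) +i (- b)

  private
    n1 : Carrier
    n1 = - 1#

    neg : ∀ {x y} → x - y ≈ x + n1 * y
    neg {x} {y} = +-congˡ (sym (RingProperties.-1*x≈-x ring y))

    *ᶜ-assoc : ∀ z w u → (z *ᶜ w) *ᶜ u ≈ᶜ z *ᶜ (w *ᶜ u)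
    *ᶜ-assoc (a +i b) (c +i d) (e +i f) =
      trans neg (trans (+-congʳ (*-congʳ neg)) (trans
        (solve 7 (λ a b c d e f n →
          (a :* c :+ n :* (b :* d)) :* e :+ n :* ((a :* d :+ b :* c) :* f) :=
          a :* (c :* e :+ n :* (d :* f)) :+ n :* (b :* (c :* f :+ d :* e))) refl a b c d e f n1)
        (sym (trans neg (+-congʳ (*-congˡ neg)))))) ,
      trans (+-congʳ (*-congʳ neg)) (trans
        (solve 7 (λ a b c d e f n →
          (a :* c :+ n :* (b :* d)) :* f :+ (a :* d :+ b :* c) :* e :=
          a :* (c :* f :+ d :* e) :+ b :* (c :* e :+ n :* (d :* f))) refl a b c d e f n1)
        (+-congˡ (*-congˡ (sym neg))))
      where open Solver

    *ᶜ-comm : ∀ z w → z *ᶜ w ≈ᶜ w *ᶜ z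
    *ᶜ-comm (a +i b) (c +i d) =
      +-cong (*-comm a c) (-‿cong (*-comm b d)) ,
      trans (+-cong (*-comm a d) (*-comm b c)) (+-comm (d * a) (c * b))

    *ᶜ-distribˡ : ∀ z w u → z *ᶜ (w +ᶜ u) ≈ᶜ z *ᶜ w +ᶜ z *ᶜ u
    *ᶜ-distribˡ (a +i b) (c +i d) (e +i f) =
      trans neg (trans
        (solve 7 (λ a b c d e f n →
          a :* (c :+ e) :+ n :* (b :* (d :+ f)) :=
          (a :* c :+ n :* (b :* d)) :+ (a :* e :+ n :* (b :* f))) refl a b c d e f n1)
        (+-cong (sym neg) (sym neg))) ,
      solve 6 (λ a b c d e f →
        a :* (d :+ f) :+ b :* (c :+ e) := (a :* d :+ b :* c) :+ (a :* f :+ b :* e)) refl a b c d e f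
      where open Solver

    *ᶜ-cong : ∀ {z w u v} → z ≈ᶜ w → u ≈ᶜ v → z *ᶜ u ≈ᶜ w *ᶜ v
    *ᶜ-cong (p , q) (r , s) =
      +-cong (*-cong p r) (-‿cong (*-cong q s)) , +-cong (*-cong p s) (*-cong q r)

    ≈ᶜ-trans : ∀ {z w u} → z ≈ᶜ w → w ≈ᶜ u → z ≈ᶜ u
    ≈ᶜ-trans (p , q) (r , s) = trans p r , trans q s

    *ᶜ-identityˡ : ∀ z → 1ᶜ *ᶜ z ≈ᶜ z
    *ᶜ-identityˡ (a +i b) =
      trans neg (solve 3 (λ a b n → con 1 :* a :+ n :* (con 0 :* b) := a) refl a b n1) ,
      solve 2 (λ a b → con 1 :* b :+ con 0 :* a := b) refl a b
      where open Solver

  ℂ-commutativeRing : CommutativeRing 0ℓ 0ℓ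
  ℂ-commutativeRing = record
    { Carrier = ℂ ; _≈_ = _≈ᶜ_ ; _+_ = _+ᶜ_ ; _*_ = _*ᶜ_ ; -_ = -ᶜ_ ; 0# = 0ᶜ ; 1# = 1ᶜ
    ; isCommutativeRing = record
      { isRing = record
        { +-isAbelianGroup = record
          { isGroup = record
            { isMonoid = record
              { isSemigroup = record
                { isMagma = record
                  { isEquivalence = record
                    { refl  = refl , refl
                    ; sym   = λ (p , q) → sym p , sym q
                    ; trans = ≈ᶜ-trans }
                  ; ∙-cong = λ (p , q) (r , s) → +-cong p r , +-cong q s }
                ; assoc = λ z w u → +-assoc (re z) (re w) (re u) , +-assoc (im z) (im w) (im u) }
              ; identity = (λ z → +-identityˡ (re z) , +-identityˡ (im z)) ,
                           (λ z → +-identityʳ (re z) , +-identityʳ (im z)) }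
            ; inverse = (λ z → -‿inverseˡ (re z) , -‿inverseˡ (im z)) ,
                        (λ z → -‿inverseʳ (re z) , -‿inverseʳ (im z))
            ; ⁻¹-cong = λ (p , q) → -‿cong p , -‿cong q }
          ; comm = λ z w → +-comm (re z) (re w) , +-comm (im z) (im w) }
        ; *-cong = *ᶜ-cong
        ; *-assoc = *ᶜ-assoc
        ; *-identity = *ᶜ-identityˡ , λ z → ≈ᶜ-trans (*ᶜ-comm z 1ᶜ) (*ᶜ-identityˡ z)
        ; distrib = *ᶜ-distribˡ ,
                    λ z w u → ≈ᶜ-trans (*ᶜ-comm (w +ᶜ u) z) (≈ᶜ-trans (*ᶜ-distribˡ z w u)
                      (+-cong (re-≈ (*ᶜ-comm z w)) (re-≈ (*ᶜ-comm z u)) ,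
                       +-cong (im-≈ (*ᶜ-comm z w)) (im-≈ (*ᶜ-comm z u)))) }
      ; *-comm = *ᶜ-comm } }

  module ℂᴿ = CommutativeRing ℂ-commutativeRing

  +ᶜ-interchange : ∀ z w u v → (z +ᶜ w) +ᶜ (u +ᶜ v) ≈ᶜ (z +ᶜ u) +ᶜ (w +ᶜ v)
  +ᶜ-interchange z w u v = +-interchange _ _ _ _ , +-interchange _ _ _ _

  *ᶜ-swap : ∀ z w u → z *ᶜ (w *ᶜ u) ≈ᶜ w *ᶜ (z *ᶜ u)
  *ᶜ-swap z w u = ℂᴿ.trans (ℂᴿ.sym (ℂᴿ.*-assoc z w u))
    (ℂᴿ.trans (ℂᴿ.*-congʳ (ℂᴿ.*-comm z w)) (ℂᴿ.*-assoc w z u))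

  normSq : ℂ → Carrier
  normSq (a +i b) = a * a + b * b

  ½ : Carrier
  ½ = recip 2#

  ∣_∣ : ℂ → Carrier
  ∣ z ∣ = normSq z ** ½

  normSq-nonneg : ∀ z → 0# ≤ normSq z
  normSq-nonneg (a +i b) = +-nonneg (square-nonneg a) (square-nonneg b)

  0≤½ : 0# ≤ ½
  0≤½ = recip-nonneg 0≤2

  ∣-∣-nonneg : ∀ z → 0# ≤ ∣ z ∣
  ∣-∣-nonneg z = **-nonneg (normSq-nonneg z) 0≤½

  2*x≈x+x : ∀ x → 2# * x ≈ x + x
  2*x≈x+x x = trans (distribʳ x 1# 1#) (+-cong (*-identityˡ x) (*-identityˡ x))

  private
    cancel : ∀ s t u → (s + n1 * n1 * u) + (t + n1 * t) ≈ s + u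
    cancel s t u = trans (+-cong (+-congˡ nnu≈u) t+nt≈0) (+-identityʳ (s + u))
      where
      nnu≈u : n1 * n1 * u ≈ u
      nnu≈u = trans (*-congʳ (trans (RingProperties.-1*x≈-x ring n1) (-‿involutive 1#)))
                (*-identityˡ u)
      t+nt≈0 : t + n1 * t ≈ 0#
      t+nt≈0 = trans (sym neg) (-‿inverseʳ t)

  normSq-* : ∀ z w → normSq (z *ᶜ w) ≈ normSq z * normSq w
  normSq-* (a +i b) (c +i d) =
    trans (+-congʳ (*-cong neg neg)) (trans
      (solve 5 (λ a b c d n →
        (a :* c :+ n :* (b :* d)) :* (a :* c :+ n :* (b :* d)) :+
        (a :* d :+ b :* c) :* (a :* d :+ b :* c) :=
        ((a :* a :* c :* c :+ a :* a :* d :* d :+ b :* b :* c :* c) :+ n :* n :* (b :* b :* d :* d))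
        :+ ((a :* b :* c :* d :+ a :* b :* c :* d) :+ n :* (a :* b :* c :* d :+ a :* b :* c :* d)))
        refl a b c d n1)
      (trans
        (cancel (a * a * c * c + a * a * d * d + b * b * c * c)
          (a * b * c * d + a * b * c * d) (b * b * d * d))
        (solve 4 (λ a b c d →
          (a :* a :* c :* c :+ a :* a :* d :* d :+ b :* b :* c :* c) :+ b :* b :* d :* d :=
          (a :* a :+ b :* b) :* (c :* c :+ d :* d)) refl a b c d)))
    where open Solver

  normSq-+-≤ : ∀ z w → normSq (z +ᶜ w) ≤ 2# * (normSq z + normSq w)
  normSq-+-≤ (a +i b) (c +i d) =
    ≤-respʳ
      (solve 5 (λ a b c d two →
        two :* (a :* a :+ c :* c) :+ two :* (b :* b :+ d :* d) :=
        two :* ((a :* a :+ b :* b) :+ (c :* c :+ d :* d))) refl a b c d 2#)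
      (+-mono-≤ (square a c) (square b d))
    where
    open Solver
    square : ∀ x y → (x + y) * (x + y) ≤ 2# * (x * x + y * y)
    square x y = ≤-respʳ eq (x≤x+y ((x + y) * (x + y)) (square-nonneg (x + n1 * y)))
      where
      eq : (x + y) * (x + y) + (x + n1 * y) * (x + n1 * y) ≈ 2# * (x * x + y * y)
      eq = trans
        (solve 3 (λ x y n →
          (x :+ y) :* (x :+ y) :+ (x :+ n :* y) :* (x :+ n :* y) :=
          ((x :* x :+ x :* x :+ y :* y) :+ n :* n :* (y :* y))
          :+ ((x :* y :+ x :* y) :+ n :* (x :* y :+ x :* y))) refl x y n1)
        (trans (cancel (x * x + x * x + y * y) (x * y + x * y) (y * y))
          (trans
            (solve 2 (λ x y → (x :* x :+ x :* x :+ y :* y) :+ y :* y :=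
              (x :* x :+ y :* y) :+ (x :* x :+ y :* y)) refl x y)
            (sym (2*x≈x+x (x * x + y * y)))))

  AbsBound₂ : Carrier → Set
  AbsBound₂ K = ∀ z w → ∣ z +ᶜ w ∣ ≤ K * (∣ z ∣ + ∣ w ∣)

  AbsBound₁ : ℂ → Carrier → Set
  AbsBound₁ c K = ∀ z → ∣ c *ᶜ z ∣ ≤ K * ∣ z ∣

  ∣+∣-bound : ∃ λ K → 0# ≤ K × AbsBound₂ K
  ∣+∣-bound = derive (**-bound₂ ½ 2# 0≤½ 0≤2)
    where
    derive : (∃ λ K → 0# ≤ K × PowerBound₂ ½ 2# K) → ∃ λ K → 0# ≤ K × AbsBound₂ K
    derive (K , 0≤K , bound) = K , 0≤K , λ z w →
      bound (normSq-nonneg z) (normSq-nonneg w) (normSq-nonneg (z +ᶜ w)) (normSq-+-≤ z w)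

  ∣*∣-bound : ∀ c → ∃ λ K → 0# ≤ K × AbsBound₁ c K
  ∣*∣-bound c = derive (**-bound₁ ½ (normSq c) 0≤½ (normSq-nonneg c))
    where
    derive : (∃ λ K → 0# ≤ K × PowerBound₁ ½ (normSq c) K) → ∃ λ K → 0# ≤ K × AbsBound₁ c K
    derive (K , 0≤K , bound) = K , 0≤K , λ z →
      bound (normSq-nonneg z) (normSq-nonneg (c *ᶜ z)) (≤-reflexive (normSq-* c z))

  ∣-∣-cong : ∀ {z w} → z ≈ᶜ w → ∣ z ∣ ≈ ∣ w ∣
  ∣-∣-cong {z} (p , q) = **-congˡ 0≤½ (normSq-nonneg z) (+-cong (*-cong p p) (*-cong q q))

  ----------------------------------------------------------------------
  -- Unordered sums of non-negative families

  module _ {I : Set} where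

    Σ[_] : List I → (I → Carrier) → Carrier
    Σ[ F ] f = List.foldr (λ i s → f i + s) 0# F

    Summable : (I → Carrier) → Set
    Summable f = ∃ λ B → ∀ F → Unique F → Σ[ F ] f ≤ B

    Σ∞ : (I → Carrier) → Carrier
    Σ∞ f = ⋁ (λ s → ∃ λ F → Unique F × s ≈ Σ[ F ] f)

    Σ∞-isSupremum : ∀ {f} → Summable f →
                    IsSupremum (λ s → ∃ λ F → Unique F × s ≈ Σ[ F ] f) (Σ∞ f)
    Σ∞-isSupremum (B , bound) = ⋁-isSupremum
      (0# , [] , AllPairs.[] , refl)
      (B , λ s (F , F! , s≈) → ≤-respˡ (sym s≈) (bound F F!))

    Σ≤Σ∞ : ∀ {f} → Summable f → ∀ F → Unique F → Σ[ F ] f ≤ Σ∞ f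
    Σ≤Σ∞ {f} f-sum F F! = proj₁ (Σ∞-isSupremum f-sum) (Σ[ F ] f) (F , F! , refl)

    Σ∞-least : ∀ {f B} → (∀ F → Unique F → Σ[ F ] f ≤ B) → Σ∞ f ≤ B
    Σ∞-least {f} {B} bound = proj₂ (Σ∞-isSupremum (B , bound)) B
      λ s (F , F! , s≈) → ≤-respˡ (sym s≈) (bound F F!)

    Σ∞-nonneg : ∀ {f} → Summable f → 0# ≤ Σ∞ f
    Σ∞-nonneg f-sum = Σ≤Σ∞ f-sum [] AllPairs.[]

    Σ-mono-≤ : ∀ F {f g : I → Carrier} → (∀ i → f i ≤ g i) → Σ[ F ] f ≤ Σ[ F ] g
    Σ-mono-≤ []      h = ≤-refl
    Σ-mono-≤ (i ∷ F) h = +-mono-≤ (h i) (Σ-mono-≤ F h)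

    Σ-*ˡ : ∀ F K (f : I → Carrier) → Σ[ F ] (λ i → K * f i) ≈ K * Σ[ F ] f
    Σ-*ˡ []      K f = sym (zeroʳ K)
    Σ-*ˡ (i ∷ F) K f = trans (+-congˡ (Σ-*ˡ F K f)) (sym (distribˡ K (f i) (Σ[ F ] f)))

    Σ-+ : ∀ F (f g : I → Carrier) → Σ[ F ] (λ i → f i + g i) ≈ Σ[ F ] f + Σ[ F ] g
    Σ-+ []      f g = sym (+-identityˡ 0#)
    Σ-+ (i ∷ F) f g = trans (+-congˡ (Σ-+ F f g))
      (+-interchange (f i) (g i) (Σ[ F ] f) (Σ[ F ] g))

    Σ-dominated₁ : ∀ {f g : I → Carrier} {K} → 0# ≤ K → (∀ i → f i ≤ K * g i) → Summable g →
                   ∀ F → Unique F → Σ[ F ] f ≤ K * Σ∞ g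
    Σ-dominated₁ {f} {g} {K} 0≤K h g-sum F F! =
      ≤-trans (Σ-mono-≤ F h) (≤-respˡ (sym (Σ-*ˡ F K g)) (*-monoˡ-≤ 0≤K (Σ≤Σ∞ g-sum F F!)))

    Σ-dominated₂ : ∀ {f g h : I → Carrier} {K} → 0# ≤ K → (∀ i → f i ≤ K * (g i + h i)) →
                   Summable g → Summable h →
                   ∀ F → Unique F → Σ[ F ] f ≤ K * (Σ∞ g + Σ∞ h)
    Σ-dominated₂ {f} {g} {h} {K} 0≤K f≤ g-sum h-sum F F! =
      ≤-trans (Σ-mono-≤ F f≤)
        (≤-respˡ (sym (trans (Σ-*ˡ F K (λ i → g i + h i)) (*-congˡ (Σ-+ F g h))))
          (*-monoˡ-≤ 0≤K (+-mono-≤ (Σ≤Σ∞ g-sum F F!) (Σ≤Σ∞ h-sum F F!))))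

  ----------------------------------------------------------------------
  -- The infinite symmetric group

  record S∞ : Set where
    field
      permutation : ℕ ↔ ℕ
      support     : List ℕ
      fixes       : ∀ i → ¬ (i ∈ support) → Inverse.to permutation i ≡ i

    open Inverse permutation public using (to; from)

    from∘to : ∀ i → from (to i) ≡ i
    from∘to i = Inverse.inverseʳ permutation ≡.refl

    to∘from : ∀ i → to (from i) ≡ i
    to∘from i = Inverse.inverseˡ permutation ≡.refl

  ----------------------------------------------------------------------
  -- The space Lᵖ(ℕᵏ, μᵏ) and its bounded operators.  The index set
  -- {1, 2, …} is represented by ℕ = {0, 1, …}.

  module LᵖSpace
    (p : Carrier) (1≤p : 1# ≤ p)
    (μ : ℕ → Carrier) (0<μ : ∀ i → 0# < μ i)
    (k : ℕ)
    where

    0≤p : 0# ≤ p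
    0≤p = 1≤x⇒0≤x 1≤p

    0≤1/p : 0# ≤ recip p
    0≤1/p = recip-nonneg 0≤p

    μ̂ : ∀ {n} → Vec ℕ n → Carrier
    μ̂ = Vec.foldr′ _*_ 1# ∘ Vec.map μ

    μ̂-nonneg : ∀ {n} (𝐢 : Vec ℕ n) → 0# ≤ μ̂ 𝐢
    μ̂-nonneg []      = 0≤1
    μ̂-nonneg (i ∷ 𝐢) = *-nonneg (proj₁ (0<μ i)) (μ̂-nonneg 𝐢)

    Sequence : Set
    Sequence = Vec ℕ k → ℂ

    term : Sequence → Vec ℕ k → Carrier
    term a 𝐢 = ∣ a 𝐢 ∣ ** p * μ̂ 𝐢 ** p

    record Lᵖ : Set where
      constructor _∈Lᵖ_
      field
        seq      : Sequence
        summable : Summable (term seq)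

    open Lᵖ public

    infix 4 _≋_
    _≋_ : Lᵖ → Lᵖ → Set
    u ≋ v = ∀ 𝐢 → seq u 𝐢 ≈ᶜ seq v 𝐢

    ‖_‖ : Lᵖ → Carrier
    ‖ v ‖ = Σ∞ (term (seq v)) ** recip p

    ‖-‖-nonneg : ∀ v → 0# ≤ ‖ v ‖
    ‖-‖-nonneg v = **-nonneg (Σ∞-nonneg (summable v)) 0≤1/p

    private
      weight-nonneg : ∀ 𝐢 → 0# ≤ μ̂ {k} 𝐢 ** p
      weight-nonneg 𝐢 = **-nonneg (μ̂-nonneg 𝐢) 0≤p

      distrib-weight : ∀ K x y w → K * (x + y) * w ≈ K * (x * w + y * w)
      distrib-weight K x y w = trans (*-assoc K (x + y) w) (*-congˡ (distribʳ w x y))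

      swap : ∀ x K w → x * (K * w) ≈ K * (x * w)
      swap x K w = trans (sym (*-assoc x K w)) (trans (*-congʳ (*-comm x K)) (*-assoc K x w))

      TermBound₂ : Carrier → Set
      TermBound₂ K = ∀ a b 𝐢 → term (λ 𝐣 → a 𝐣 +ᶜ b 𝐣) 𝐢 ≤ K * (term a 𝐢 + term b 𝐢)

      TermBound₁ : ℂ → Carrier → Set
      TermBound₁ c K = ∀ a 𝐢 → term (λ 𝐣 → c *ᶜ a 𝐣) 𝐢 ≤ K * term a 𝐢

      term-+ : ∃ λ K → 0# ≤ K × TermBound₂ K
      term-+ = derive ∣+∣-bound
        where
        derive : (∃ λ K → 0# ≤ K × AbsBound₂ K) → ∃ λ K → 0# ≤ K × TermBound₂ K
        derive (K₁ , 0≤K₁ , bound₁) = derive′ (**-bound₂ p K₁ 0≤p 0≤K₁)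
          where
          derive′ : (∃ λ K → 0# ≤ K × PowerBound₂ p K₁ K) → ∃ λ K → 0# ≤ K × TermBound₂ K
          derive′ (K , 0≤K , bound) = K , 0≤K , λ a b 𝐢 →
            ≤-respʳ (distrib-weight K (∣ a 𝐢 ∣ ** p) (∣ b 𝐢 ∣ ** p) (μ̂ 𝐢 ** p))
              (*-monoʳ-≤ (weight-nonneg 𝐢)
                (bound (∣-∣-nonneg (a 𝐢)) (∣-∣-nonneg (b 𝐢)) (∣-∣-nonneg (a 𝐢 +ᶜ b 𝐢))
                  (bound₁ (a 𝐢) (b 𝐢))))

      term-* : ∀ c → ∃ λ K → 0# ≤ K × TermBound₁ c K
      term-* c = derive (∣*∣-bound c)
        where
        derive : (∃ λ K → 0# ≤ K × AbsBound₁ c K) → ∃ λ K → 0# ≤ K × TermBound₁ c K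
        derive (K₁ , 0≤K₁ , bound₁) = derive′ (**-bound₁ p K₁ 0≤p 0≤K₁)
          where
          derive′ : (∃ λ K → 0# ≤ K × PowerBound₁ p K₁ K) → ∃ λ K → 0# ≤ K × TermBound₁ c K
          derive′ (K , 0≤K , bound) = K , 0≤K , λ a 𝐢 →
            ≤-respʳ (*-assoc K (∣ a 𝐢 ∣ ** p) (μ̂ 𝐢 ** p))
              (*-monoʳ-≤ (weight-nonneg 𝐢)
                (bound (∣-∣-nonneg (a 𝐢)) (∣-∣-nonneg (c *ᶜ a 𝐢)) (bound₁ (a 𝐢))))

    -- Opaque for type-checking speed only.
    opaque
      +-summable : ∀ {a b} → Summable (term a) → Summable (term b) →
                   Summable (term (λ 𝐢 → a 𝐢 +ᶜ b 𝐢))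
      +-summable {a} {b} sa sb =
        _ , Σ-dominated₂ (proj₁ (proj₂ term-+)) (proj₂ (proj₂ term-+) a b) sa sb

      *-summable : ∀ c {a} → Summable (term a) → Summable (term (λ 𝐢 → c *ᶜ a 𝐢))
      *-summable c {a} sa =
        _ , Σ-dominated₁ (proj₁ (proj₂ (term-* c))) (proj₂ (proj₂ (term-* c)) a) sa

    infixl 6 _+ᴸ_
    infixr 7 _•ᴸ_

    _+ᴸ_ : Lᵖ → Lᵖ → Lᵖ
    (a ∈Lᵖ sa) +ᴸ (b ∈Lᵖ sb) = (λ 𝐢 → a 𝐢 +ᶜ b 𝐢) ∈Lᵖ +-summable sa sb

    _•ᴸ_ : ℂ → Lᵖ → Lᵖ
    c •ᴸ (a ∈Lᵖ sa) = (λ 𝐢 → c *ᶜ a 𝐢) ∈Lᵖ *-summable c sa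

    NormBound₂ : Carrier → Set
    NormBound₂ K = ∀ u v → ‖ u +ᴸ v ‖ ≤ K * (‖ u ‖ + ‖ v ‖)

    NormBound₁ : ℂ → Carrier → Set
    NormBound₁ c K = ∀ v → ‖ c •ᴸ v ‖ ≤ K * ‖ v ‖

    opaque
      ‖+‖-bound : ∃ λ K → 0# ≤ K × NormBound₂ K
      ‖+‖-bound = derive (**-bound₂ (recip p) (proj₁ term-+) 0≤1/p (proj₁ (proj₂ term-+)))
        where
        derive : (∃ λ K → 0# ≤ K × PowerBound₂ (recip p) (proj₁ term-+) K) →
                 ∃ λ K → 0# ≤ K × NormBound₂ K
        derive (K , 0≤K , bound) = K , 0≤K , λ u v →
          bound (Σ∞-nonneg (summable u)) (Σ∞-nonneg (summable v)) (Σ∞-nonneg (summable (u +ᴸ v)))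
            (Σ∞-least (Σ-dominated₂ (proj₁ (proj₂ term-+)) (proj₂ (proj₂ term-+) (seq u) (seq v))
              (summable u) (summable v)))

      ‖•‖-bound : ∀ c → ∃ λ K → 0# ≤ K × NormBound₁ c K
      ‖•‖-bound c = derive (**-bound₁ (recip p) (proj₁ (term-* c)) 0≤1/p (proj₁ (proj₂ (term-* c))))
        where
        derive : (∃ λ K → 0# ≤ K × PowerBound₁ (recip p) (proj₁ (term-* c)) K) →
                 ∃ λ K → 0# ≤ K × NormBound₁ c K
        derive (K , 0≤K , bound) = K , 0≤K , λ v →
          bound (Σ∞-nonneg (summable v)) (Σ∞-nonneg (summable (c •ᴸ v)))
            (Σ∞-least (Σ-dominated₁ (proj₁ (proj₂ (term-* c))) (proj₂ (proj₂ (term-* c)) (seq v))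
              (summable v)))

    -- The action (σ · a) 𝐢 = a (σ⁻¹ 𝐢).

    module _ (σ : S∞) where
      open S∞ σ using (to; from; from∘to; to∘from; support; fixes)

      private
        ratio-on : ∀ F → ∃ λ c → 1# ≤ c × (∀ i → i ∈ F → μ (to i) ≤ c * μ i)
        ratio-on [] = 1# , ≤-refl , λ i ()
        ratio-on (j ∷ F) with ratio-on F
        ... | c , 1≤c , bound = c + r , ≤-trans 1≤c (x≤x+y c 0≤r) , bound′
          where
          0≤μ : ∀ i → 0# ≤ μ i
          0≤μ i = proj₁ (0<μ i)
          r = μ (to j) * recip (μ j)
          0≤r : 0# ≤ r
          0≤r = *-nonneg (0≤μ (to j)) (recip-nonneg (0≤μ j))
          eq : r * μ j ≈ μ (to j)
          eq = trans (*-assoc (μ (to j)) (recip (μ j)) (μ j))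
            (trans (*-congˡ (trans (*-comm (recip (μ j)) (μ j))
              (recip-inverse (λ e → proj₂ (0<μ j) (sym e))))) (*-identityʳ (μ (to j))))
          bound′ : ∀ i → i ∈ j ∷ F → μ (to i) ≤ (c + r) * μ i
          bound′ i (here ≡.refl) = ≤-respˡ eq (*-monoʳ-≤ (0≤μ i) (y≤x+y r (1≤x⇒0≤x 1≤c)))
          bound′ i (there i∈F) = ≤-trans (bound i i∈F) (*-monoʳ-≤ (0≤μ i) (x≤x+y c 0≤r))

        ratio : ∃ λ c → 1# ≤ c × (∀ i → μ (to i) ≤ c * μ i)
        ratio = c , proj₁ (proj₂ (ratio-on support)) , bound′
          where
          c = proj₁ (ratio-on support)
          bound′ : ∀ i → μ (to i) ≤ c * μ i
          bound′ i with em {i ∈ support}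
          ... | yes i∈ = proj₂ (proj₂ (ratio-on support)) i i∈
          ... | no i∉  = ≤-respˡ
            (trans (*-identityˡ (μ i)) (reflexive (≡.cong μ (≡.sym (fixes i i∉)))))
            (*-monoʳ-≤ (proj₁ (0<μ i)) (proj₁ (proj₂ (ratio-on support))))

        μ̂-ratio : ∀ {n} (𝐢 : Vec ℕ n) → μ̂ (Vec.map to 𝐢) ≤ proj₁ ratio ^ n * μ̂ 𝐢
        μ̂-ratio [] = ≤-reflexive (sym (*-identityˡ 1#))
        μ̂-ratio {suc n} (i ∷ 𝐢) = ≤-respʳ
          (solve 4 (λ c m d w → (c :* m) :* (d :* w) := (c :* d) :* (m :* w)) refl
            (proj₁ ratio) (μ i) (proj₁ ratio ^ n) (μ̂ 𝐢))
          (*-mono-≤ (*-nonneg 0≤c (proj₁ (0<μ i))) (μ̂-nonneg (Vec.map to 𝐢))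
            (proj₂ (proj₂ ratio) i) (μ̂-ratio 𝐢))
          where
          open Solver
          0≤c = 1≤x⇒0≤x (proj₁ (proj₂ ratio))

        map-from∘to : ∀ {n} (𝐢 : Vec ℕ n) → Vec.map from (Vec.map to 𝐢) ≡ 𝐢
        map-from∘to 𝐢 = ≡.trans (≡.sym (Vecₚ.map-∘ from to 𝐢))
          (≡.trans (Vecₚ.map-cong from∘to 𝐢) (Vecₚ.map-id 𝐢))

        map-to∘from : ∀ {n} (𝐢 : Vec ℕ n) → Vec.map to (Vec.map from 𝐢) ≡ 𝐢
        map-to∘from 𝐢 = ≡.trans (≡.sym (Vecₚ.map-∘ to from 𝐢))
          (≡.trans (Vecₚ.map-cong to∘from 𝐢) (Vecₚ.map-id 𝐢))

        permute : Sequence → Sequence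
        permute a 𝐢 = a (Vec.map from 𝐢)

        PermuteBound : Carrier → Set
        PermuteBound K = ∀ a 𝐢 → term (permute a) 𝐢 ≤ K * term a (Vec.map from 𝐢)

        term-permute : ∃ λ K → 0# ≤ K × PermuteBound K
        term-permute = derive (**-bound₁ p c 0≤p (^-nonneg k (1≤x⇒0≤x (proj₁ (proj₂ ratio)))))
          where
          c = proj₁ ratio ^ k
          derive : (∃ λ K → 0# ≤ K × PowerBound₁ p c K) → ∃ λ K → 0# ≤ K × PermuteBound K
          derive (K , 0≤K , bound) = K , 0≤K , λ a 𝐢 → ≤-respʳ
            (swap (∣ permute a 𝐢 ∣ ** p) K (μ̂ (Vec.map from 𝐢) ** p))
            (*-monoˡ-≤ (**-nonneg (∣-∣-nonneg (permute a 𝐢)) 0≤p)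
              (bound (μ̂-nonneg (Vec.map from 𝐢)) (μ̂-nonneg 𝐢)
                (≡.subst (λ 𝐣 → μ̂ 𝐣 ≤ c * μ̂ (Vec.map from 𝐢)) (map-to∘from 𝐢)
                  (μ̂-ratio (Vec.map from 𝐢)))))

        Σ-map : ∀ F (f : Vec ℕ k → Carrier) →
                Σ[ F ] (f ∘ Vec.map from) ≈ Σ[ List.map (Vec.map from) F ] f
        Σ-map []      f = refl
        Σ-map (𝐢 ∷ F) f = +-congˡ (Σ-map F f)

        map-from-injective : ∀ {𝐢 𝐣 : Vec ℕ k} → Vec.map from 𝐢 ≡ Vec.map from 𝐣 → 𝐢 ≡ 𝐣
        map-from-injective {𝐢} {𝐣} e =
          ≡.trans (≡.sym (map-to∘from 𝐢)) (≡.trans (≡.cong (Vec.map to) e) (map-to∘from 𝐣))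

        opaque
          permute-summable : ∀ {a} → Summable (term a) → Summable (term (permute a))
          permute-summable {a} (B , bound) = proj₁ term-permute * B , λ F F! →
            ≤-trans (Σ-mono-≤ F (proj₂ (proj₂ term-permute) a))
              (≤-respˡ (sym (trans (Σ-*ˡ F (proj₁ term-permute) (term a ∘ Vec.map from)) (*-congˡ (Σ-map F (term a)))))
                (*-monoˡ-≤ (proj₁ (proj₂ term-permute))
                  (bound (List.map (Vec.map from) F) (Unique.map⁺ map-from-injective F!))))

      act : Lᵖ → Lᵖ
      act (a ∈Lᵖ sa) = (λ 𝐢 → a (Vec.map from 𝐢)) ∈Lᵖ permute-summable sa

    IsBounded : (Lᵖ → Lᵖ) → Set
    IsBounded f = ∃ λ C → 0# ≤ C × (∀ v → ‖ f v ‖ ≤ C * ‖ v ‖)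

    record BoundedOperator : Set where
      field
        apply       : Lᵖ → Lᵖ
        cong        : ∀ {u v} → u ≋ v → apply u ≋ apply v
        additive    : ∀ u v → apply (u +ᴸ v) ≋ apply u +ᴸ apply v
        homogeneous : ∀ c v → apply (c •ᴸ v) ≋ c •ᴸ apply v
        bounded     : IsBounded apply

    open BoundedOperator public

    infixl 6 _+ᴮ_
    infixl 7 _∘ᴮ_
    infixr 7 _•ᴮ_

    _+ᴮ_ : BoundedOperator → BoundedOperator → BoundedOperator
    A +ᴮ B = record
      { apply = λ v → apply A v +ᴸ apply B v
      ; cong = λ u≋v 𝐢 → ℂᴿ.+-cong (cong A u≋v 𝐢) (cong B u≋v 𝐢)
      ; additive = λ u v 𝐢 → ℂᴿ.trans (ℂᴿ.+-cong (additive A u v 𝐢) (additive B u v 𝐢))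
          (+ᶜ-interchange
            (seq (apply A u) 𝐢) (seq (apply A v) 𝐢) (seq (apply B u) 𝐢) (seq (apply B v) 𝐢))
      ; homogeneous = λ c v 𝐢 → ℂᴿ.trans
          (ℂᴿ.+-cong (homogeneous A c v 𝐢) (homogeneous B c v 𝐢)) (ℂᴿ.sym (ℂᴿ.distribˡ c (seq (apply A v) 𝐢) (seq (apply B v) 𝐢)))
      ; bounded = bounded-+ ‖+‖-bound (bounded A) (bounded B)
      }
      where
      bounded-+ : (∃ λ K → 0# ≤ K × NormBound₂ K) → IsBounded (apply A) → IsBounded (apply B) → IsBounded (λ v → apply A v +ᴸ apply B v)
      bounded-+ (K , 0≤K , k-bound) (C , 0≤C , c-bound) (D , 0≤D , d-bound) =
        K * (C + D) , *-nonneg 0≤K (+-nonneg 0≤C 0≤D) , λ v → ≤-trans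
          (k-bound (apply A v) (apply B v))
          (≤-respʳ
            (trans (*-congˡ (sym (distribʳ ‖ v ‖ C D))) (sym (*-assoc K (C + D) ‖ v ‖)))
            (*-monoˡ-≤ 0≤K (+-mono-≤ (c-bound v) (d-bound v))))

    _∘ᴮ_ : BoundedOperator → BoundedOperator → BoundedOperator
    A ∘ᴮ B = record
      { apply = λ v → apply A (apply B v)
      ; cong = λ u≋v → cong A (cong B u≋v)
      ; additive = λ u v 𝐢 → ℂᴿ.trans (cong A (additive B u v) 𝐢)
          (additive A (apply B u) (apply B v) 𝐢)
      ; homogeneous = λ c v 𝐢 → ℂᴿ.trans (cong A (homogeneous B c v) 𝐢)
          (homogeneous A c (apply B v) 𝐢)
      ; bounded = bounded-∘ (bounded A) (bounded B)
      }
      where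
      bounded-∘ : IsBounded (apply A) → IsBounded (apply B) → IsBounded (λ v → apply A (apply B v))
      bounded-∘ (C , 0≤C , c-bound) (D , 0≤D , d-bound) =
        C * D , *-nonneg 0≤C 0≤D , λ v → ≤-trans (c-bound (apply B v))
          (≤-respʳ (sym (*-assoc C D ‖ v ‖)) (*-monoˡ-≤ 0≤C (d-bound v)))

    idᴮ : BoundedOperator
    idᴮ = record
      { apply = id
      ; cong = id
      ; additive = λ u v 𝐢 → ℂᴿ.refl
      ; homogeneous = λ c v 𝐢 → ℂᴿ.refl
      ; bounded = 1# , 0≤1 , λ v → ≤-reflexive (sym (*-identityˡ ‖ v ‖))
      }

    _•ᴮ_ : ℂ → BoundedOperator → BoundedOperator
    c •ᴮ A = record
      { apply = λ v → c •ᴸ apply A v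
      ; cong = λ u≋v 𝐢 → ℂᴿ.*-congˡ (cong A u≋v 𝐢)
      ; additive = λ u v 𝐢 → ℂᴿ.trans (ℂᴿ.*-congˡ (additive A u v 𝐢)) (ℂᴿ.distribˡ c (seq (apply A u) 𝐢) (seq (apply A v) 𝐢))
      ; homogeneous = λ d v 𝐢 → ℂᴿ.trans (ℂᴿ.*-congˡ (homogeneous A d v 𝐢))
          (*ᶜ-swap c d (seq (apply A v) 𝐢))
      ; bounded = bounded-• (‖•‖-bound c) (bounded A)
      }
      where
      bounded-• : (∃ λ K → 0# ≤ K × NormBound₁ c K) → IsBounded (apply A) → IsBounded (λ v → c •ᴸ apply A v)
      bounded-• (K , 0≤K , k-bound) (C , 0≤C , c-bound) =
        K * C , *-nonneg 0≤K 0≤C , λ v → ≤-trans (k-bound (apply A v))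
          (≤-respʳ (sym (*-assoc K C ‖ v ‖)) (*-monoˡ-≤ 0≤K (c-bound v)))

    --------------------------------------------------------------------
    -- The centralizer of S∞ in the algebra of bounded operators

    record Centralizer : Set where
      field
        operator : BoundedOperator
        commutes : ∀ σ v → act σ (apply operator v) ≋ apply operator (act σ v)

    open Centralizer public

    _≈ᶻ_ : Centralizer → Centralizer → Set
    A ≈ᶻ B = ∀ v → apply (operator A) v ≋ apply (operator B) v

    _+ᶻ_ _∘ᶻ_ : Centralizer → Centralizer → Centralizer
    A +ᶻ B = record
      { operator = operator A +ᴮ operator B
      ; commutes = λ σ v 𝐢 → ℂᴿ.+-cong (commutes A σ v 𝐢) (commutes B σ v 𝐢)
      }
    A ∘ᶻ B = record
      { operator = operator A ∘ᴮ operator B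
      ; commutes = λ σ v 𝐢 → ℂᴿ.trans (commutes A σ (apply (operator B) v) 𝐢)
          (cong (operator A) (commutes B σ v) 𝐢)
      }

    _•ᶻ_ : ℂ → Centralizer → Centralizer
    c •ᶻ A = record
      { operator = c •ᴮ operator A
      ; commutes = λ σ v 𝐢 → ℂᴿ.*-congˡ (commutes A σ v 𝐢)
      }

    1ᶻ : Centralizer
    1ᶻ = record { operator = idᴮ ; commutes = λ σ v 𝐢 → ℂᴿ.refl }

    centralizer-ring : RawRing 0ℓ 0ℓ
    centralizer-ring = record
      { Carrier = Centralizer ; _≈_ = _≈ᶻ_
      ; _+_ = _+ᶻ_ ; _*_ = _∘ᶻ_ ; -_ = (-ᶜ 1ᶜ) •ᶻ_ ; 0# = 0ᶜ •ᶻ 1ᶻ ; 1# = 1ᶻ }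

    centralizer-module : RawLeftModule ℂ 0ℓ 0ℓ
    centralizer-module = record
      { Carrierᴹ = Centralizer ; _≈ᴹ_ = _≈ᶻ_
      ; _+ᴹ_ = _+ᶻ_ ; _*ₗ_ = _•ᶻ_ ; 0ᴹ = 0ᶜ •ᶻ 1ᶻ ; -ᴹ_ = (-ᶜ 1ᶜ) •ᶻ_ }

  ----------------------------------------------------------------------
  -- Diagrams.  A set partition of [k] ∪ [k′] is given by the equivalence
  -- relation whose classes are its blocks; inj₁ is the top row [k] and
  -- inj₂ the bottom row [k′].

  Vertex : ℕ → Set
  Vertex k = Fin k ⊎ Fin k

  record Diagram (k : ℕ) : Set₁ where
    infix 4 _∼_
    field
      _∼_             : Rel (Vertex k) 0ℓ
      ∼-isEquivalence : IsEquivalence _∼_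

    open IsEquivalence ∼-isEquivalence public
      renaming (refl to ∼-refl; sym to ∼-sym; trans to ∼-trans)

  infix 4 _≗ᴰ_
  _≗ᴰ_ : ∀ {k} → Diagram k → Diagram k → Set
  d ≗ᴰ e = ∀ x y → Diagram._∼_ d x y ⇔ Diagram._∼_ e x y

  count : ∀ {k} → (Fin k → Set) → ℕ
  count {k} P = length (filter {P = P} (λ _ → em) (allFin k))

  -- The block of x is { y ∣ y ∼ x }.
  IsUniform : ∀ {k} → Diagram k → Set
  IsUniform d = ∀ x → count (λ i → inj₁ i ∼ x) ≡ count (λ i → inj₂ i ∼ x)
    where open Diagram d

  -- Stacking d₁ on d₂: the bottom row of d₁ and the top row of d₂ are both
  -- identified with the middle row.

  data Site (k : ℕ) : Set where
    top mid bot : Fin k → Site k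

  upper lower outer : ∀ {k} → Vertex k → Site k
  upper = [ top , mid ]
  lower = [ mid , bot ]
  outer = [ top , bot ]

  data Joined {k : ℕ} (d₁ d₂ : Diagram k) : Rel (Site k) 0ℓ where
    in-upper : ∀ {x y} → Diagram._∼_ d₁ x y → Joined d₁ d₂ (upper x) (upper y)
    in-lower : ∀ {x y} → Diagram._∼_ d₂ x y → Joined d₁ d₂ (lower x) (lower y)

  infixl 7 _⋆_
  _⋆_ : ∀ {k} → Diagram k → Diagram k → Diagram k
  d₁ ⋆ d₂ = record
    { _∼_             = λ x y → EqClosure (Joined d₁ d₂) (outer x) (outer y)
    ; ∼-isEquivalence = On.isEquivalence outer (Closure.isEquivalence (Joined d₁ d₂))
    }

  identityDiagram : ∀ k → Diagram k
  identityDiagram k = record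
    { _∼_             = λ x y → [ id , id ] x ≡ [ id , id ] y
    ; ∼-isEquivalence = On.isEquivalence [ id , id ] ≡.isEquivalence
    }

  private
    countIn : ∀ {k} → List (Fin k) → (Fin k → Set) → ℕ
    countIn F P = length (filter {P = P} (λ _ → em) F)

    countIn-⇔ : ∀ {k} (F : List (Fin k)) {P Q : Fin k → Set} → (∀ i → P i ⇔ Q i) →
                countIn F P ≡ countIn F Q
    countIn-⇔ []      P⇔Q = ≡.refl
    countIn-⇔ (i ∷ F) {P} {Q} P⇔Q with em {P i} | em {Q i}
    ... | yes _ | yes _ = ≡.cong suc (countIn-⇔ F P⇔Q)
    ... | no _  | no _  = countIn-⇔ F P⇔Q
    ... | yes p | no ¬q = ⊥-elim (¬q (Equivalence.to (P⇔Q i) p))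
    ... | no ¬p | yes q = ⊥-elim (¬p (Equivalence.from (P⇔Q i) q))

    countIn-none : ∀ {k} (F : List (Fin k)) {P : Fin k → Set} → (∀ i → ¬ P i) → countIn F P ≡ 0
    countIn-none []      ¬P = ≡.refl
    countIn-none (i ∷ F) {P} ¬P with em {P i}
    ... | yes p = ⊥-elim (¬P i p)
    ... | no _  = countIn-none F ¬P

    countIn-split : ∀ {k} (F : List (Fin k)) (P Q : Fin k → Set) →
      countIn F P ≡ countIn F (λ i → P i × Q i) ℕ.+ countIn F (λ i → P i × ¬ Q i)
    countIn-split []      P Q = ≡.refl
    countIn-split (i ∷ F) P Q
      with em {P i} | em {Q i} | em {P i × Q i} | em {P i × ¬ Q i}
    ... | yes _ | _     | yes _        | no _          = ≡.cong suc (countIn-split F P Q)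
    ... | yes _ | _     | no _         | yes _         =
      ≡.trans (≡.cong suc (countIn-split F P Q)) (≡.sym (ℕₚ.+-suc _ _))
    ... | no _  | _     | no _         | no _          = countIn-split F P Q
    ... | _     | _     | yes (_ , q)  | yes (_ , ¬q)  = ⊥-elim (¬q q)
    ... | no ¬p | _     | yes (p , _)  | no _          = ⊥-elim (¬p p)
    ... | no ¬p | _     | no _         | yes (p , _)   = ⊥-elim (¬p p)
    ... | yes p | yes q | no ¬pq       | no _          = ⊥-elim (¬pq (p , q))
    ... | yes p | no ¬q | no _         | no ¬p¬q       = ⊥-elim (¬p¬q (p , ¬q))

  -- A union of blocks of a uniform diagram meets both rows in equally
  -- many vertices.
  module _ {k : ℕ} (d : Diagram k) (uniform : IsUniform d) where
    open Diagram d

    private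
      Balanced : (Vertex k → Set) → Set
      Balanced S = count (S ∘ inj₁) ≡ count (S ∘ inj₂)

      Saturated : (Vertex k → Set) → Set
      Saturated S = ∀ x y → x ∼ y → S x → S y

      balanced-⇔ : ∀ S T → (∀ x → S x ⇔ T x) → Balanced S → Balanced T
      balanced-⇔ S T S⇔T b = ≡.trans (≡.sym (countIn-⇔ (allFin k) (S⇔T ∘ inj₁)))
        (≡.trans b (countIn-⇔ (allFin k) (S⇔T ∘ inj₂)))

      balanced-none : ∀ S → (∀ x → ¬ S x) → Balanced S
      balanced-none S ¬S = ≡.trans (countIn-none (allFin k) (¬S ∘ inj₁))
        (≡.sym (countIn-none (allFin k) (¬S ∘ inj₂)))

      balanced-covered : ∀ (L : List (Vertex k)) S → Saturated S →
        (∀ x → S x → ∃ λ y → y ∈ L × x ∼ y) → Balanced S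
      balanced-covered [] S sat cover = balanced-none S λ x Sx → absurd (cover x Sx)
        where
        absurd : ∀ {x} → ¬ (∃ λ y → y ∈ [] × x ∼ y)
        absurd (_ , () , _)
      balanced-covered (z ∷ L) S sat cover =
        ≡.trans (countIn-split (allFin k) (S ∘ inj₁) (λ i → inj₁ i ∼ z))
          (≡.trans (≡.cong₂ ℕ._+_ inside outside)
            (≡.sym (countIn-split (allFin k) (S ∘ inj₂) (λ i → inj₂ i ∼ z))))
        where
        inside : Balanced (λ x → S x × x ∼ z)
        inside with em {S z}
        ... | yes Sz = balanced-⇔ (_∼ z) (λ x → S x × x ∼ z)
          (λ x → mk⇔ (λ x∼z → sat z x (∼-sym x∼z) Sz , x∼z) proj₂) (uniform z)
        ... | no ¬Sz = balanced-none (λ x → S x × x ∼ z) λ x (Sx , x∼z) → ¬Sz (sat x z x∼z Sx)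
        covered : ∀ x → S x × ¬ (x ∼ z) → ∃ λ y → y ∈ L × x ∼ y
        covered x (Sx , x≁z) with cover x Sx
        ... | y , here ≡.refl , x∼z = ⊥-elim (x≁z x∼z)
        ... | y , there y∈L , x∼y   = y , y∈L , x∼y
        outside : Balanced (λ x → S x × ¬ (x ∼ z))
        outside = balanced-covered L (λ x → S x × ¬ (x ∼ z))
          (λ x y x∼y (Sx , x≁z) → sat x y x∼y Sx , λ y∼z → x≁z (∼-trans x∼y y∼z)) covered

    uniform⇒balanced : ∀ (S : Vertex k → Set) → (∀ x y → x ∼ y → S x → S y) →
                       count (S ∘ inj₁) ≡ count (S ∘ inj₂)
    uniform⇒balanced S sat = balanced-covered
      (List.map inj₁ (allFin k) ++ List.map inj₂ (allFin k)) S sat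
      λ x _ → x , every x , ∼-refl
      where
      every : ∀ x → x ∈ List.map inj₁ (allFin k) ++ List.map inj₂ (allFin k)
      every (inj₁ i) = ∈-++⁺ˡ (∈-map⁺ inj₁ (∈-allFin i))
      every (inj₂ i) = ∈-++⁺ʳ (List.map inj₁ (allFin k)) (∈-map⁺ inj₂ (∈-allFin i))

  ⋆-uniform : ∀ {k} (d₁ d₂ : Diagram k) → IsUniform d₁ → IsUniform d₂ → IsUniform (d₁ ⋆ d₂)
  ⋆-uniform d₁ d₂ u₁ u₂ x = ≡.trans
    (uniform⇒balanced d₁ u₁ (λ y → EqClosure (Joined d₁ d₂) (upper y) (outer x))
      λ y z y∼z c → bwd (in-upper y∼z) ◅ c)
    (uniform⇒balanced d₂ u₂ (λ y → EqClosure (Joined d₁ d₂) (lower y) (outer x))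
      λ y z y∼z c → bwd (in-lower y∼z) ◅ c)

  record UniformDiagram (k : ℕ) : Set₁ where
    constructor _,_
    field
      diagram : Diagram k
      uniform : IsUniform diagram

  open UniformDiagram public

  _⋆ᵁ_ : ∀ {k} → UniformDiagram k → UniformDiagram k → UniformDiagram k
  (d₁ , u₁) ⋆ᵁ (d₂ , u₂) = (d₁ ⋆ d₂) , ⋆-uniform d₁ d₂ u₁ u₂

  identityᵁ : ∀ k → UniformDiagram k
  identityᵁ k = identityDiagram k , λ x → ≡.refl

  ----------------------------------------------------------------------
  -- The algebra U k of uniform block permutations: formal linear
  -- combinations of uniform diagrams, identified when all coefficients
  -- agree.

  module UniformBlockPermutations (k : ℕ) where

    U : Set₁
    U = List (ℂ × UniformDiagram k)

    coefficient : U → UniformDiagram k → ℂ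
    coefficient []            d = 0ᶜ
    coefficient ((c , e) ∷ x) d =
      (if does (em {diagram e ≗ᴰ diagram d}) then c else 0ᶜ) +ᶜ coefficient x d

    _≈ᵁ_ : U → U → Set₁
    x ≈ᵁ y = ∀ d → coefficient x d ≈ᶜ coefficient y d

    _•ᵁ_ : ℂ → U → U
    c •ᵁ x = List.map (map₁ (c *ᶜ_)) x

    _*ᵁ_ : U → U → U
    _*ᵁ_ = cartesianProductWith (λ (c , d) (c′ , d′) → c *ᶜ c′ , d ⋆ᵁ d′)

    1ᵁ : U
    1ᵁ = (1ᶜ , identityᵁ k) ∷ []

    U-ring : RawRing (lsuc 0ℓ) (lsuc 0ℓ)
    U-ring = record
      { Carrier = U ; _≈_ = _≈ᵁ_
      ; _+_ = _++_ ; _*_ = _*ᵁ_ ; -_ = (-ᶜ 1ᶜ) •ᵁ_ ; 0# = [] ; 1# = 1ᵁ }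

    U-module : RawLeftModule ℂ (lsuc 0ℓ) (lsuc 0ℓ)
    U-module = record
      { Carrierᴹ = U ; _≈ᴹ_ = _≈ᵁ_
      ; _+ᴹ_ = _++_ ; _*ₗ_ = _•ᵁ_ ; 0ᴹ = [] ; -ᴹ_ = (-ᶜ 1ᶜ) •ᵁ_ }

{-# OPTIONS --safe #-}

-- A uniform diagram d acts by the 0/1 matrix whose entry at (𝐢 , 𝐣) is 1 when 𝐢 on the top row and 𝐣
-- on the bottom row are constant on the blocks of d.  Since every block meets both rows, this is a
-- partial permutation matrix, and uniformity makes 𝐣 a rearrangement of 𝐢, so the weights agree and
-- the matrix is a contraction.  Stacking diagrams multiplies these matrices.
--
-- Conversely the entries of an operator in the centralizer depend only on the kernel of (𝐢 , 𝐣).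
-- Boundedness gives μ̂ 𝐢 ≤ K μ̂ 𝐣 on each orbit with a nonzero entry; sending one value of (𝐢 , 𝐣) to
-- infinity, where μ tends to 0, shows that each value occurs in 𝐢 at least as often as in 𝐣, hence
-- equally often, so only uniform kernels carry nonzero entries.  The entries of a combination of
-- diagrams at a kernel P are the sums of the coefficients over the diagrams finer than P, a system that
-- is triangular with respect to the number of related pairs; and a bounded operator is determined by
-- its entries because finitely supported sequences are dense.
module Submission where

open import Defs
open import Level using (0ℓ)
open import Algebra.Morphism.Structures using (module RingMorphisms)
open import Algebra.Module.Morphism.Structures using (module LeftModuleMorphisms)
import Algebra.Properties.CommutativeSemiring.Exp as NatPowers
import Algebra.Properties.Ring as RingProperties
import Algebra.Solver.Ring.NaturalCoefficients.Default as SemiringSolver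
open import Axiom.ExcludedMiddle using (ExcludedMiddle)
open import Data.Bool.Base using (if_then_else_)
open import Data.Empty using (⊥; ⊥-elim)
open import Data.Fin.Base using (Fin; zero; suc)
open import Data.List.Base as List using (List; []; _∷_; _++_; length; filter; allFin; upTo; applyUpTo; cartesianProduct; cartesianProductWith)
import Data.List.Properties as Listₚ
open import Data.List.Membership.Propositional using (_∈_)
open import Data.List.Membership.Propositional.Properties using (∈-map⁺; ∈-++⁺ˡ; ∈-++⁺ʳ; ∈-allFin; ∈-∃++; ∈-filter⁺; ∈-filter⁻; ∈-length; ∈-upTo⁺; ∈-cartesianProduct⁺; ∈-cartesianProductWith⁺)
open import Data.List.Relation.Binary.Permutation.Propositional as Permutation using (_↭_; ↭-refl; ↭-trans; ↭-prep; ↭-reflexive; prep; swap)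
open import Data.List.Relation.Binary.Permutation.Propositional.Properties using (shift; filter-↭; ↭-length)
import Data.List.Relation.Unary.All as All
import Data.List.Relation.Unary.AllPairs as AllPairs
open import Data.List.Relation.Unary.Any using (here; there)
open import Data.List.Relation.Unary.Unique.Propositional using (Unique)
import Data.List.Relation.Unary.Unique.Propositional.Properties as Unique
open import Data.Nat.Base as ℕ using (ℕ; zero; suc; NonZero)
open import Data.Nat.Properties as ℕₚ using (_≟_)
open import Data.Product.Base using (∃; _×_; _,_; proj₁; proj₂)
open import Data.Sum.Base using (_⊎_; inj₁; inj₂; [_,_]; [_,_]′)
open import Data.Vec.Base as Vec using (Vec; []; _∷_; lookup; tabulate; toList)
import Data.Vec.Properties as Vecₚ
open import Function.Base using (_∘_; id)
open import Function.Bundles using (_⇔_; mk⇔; mk↔ₛ′; Equivalence)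
open import Function.Construct.Composition using (_↔-∘_)
open import Relation.Binary.Bundles using (Poset)
import Relation.Binary.Construct.On as On
open import Relation.Binary.Construct.Closure.Equivalence as Closure using (EqClosure)
open import Relation.Binary.Construct.Closure.ReflexiveTransitive using (ε; _◅_; _◅◅_)
open import Relation.Binary.Construct.Closure.Symmetric using (fwd)
open import Relation.Binary.PropositionalEquality as ≡ using (_≡_; _≢_)
import Relation.Binary.Reasoning.PartialOrder as PartialOrderReasoning
open import Relation.Binary.Structures using (IsTotalOrder)
open import Relation.Nullary.Decidable.Core using (Dec; yes; no; does; toSum)
open import Relation.Nullary.Negation.Core using (¬_)
open import Relation.Unary using (Decidable)

-- Real powers: zeros, growth and cancellation.

module RealPowers (em : ExcludedMiddle 0ℓ) (ℝ : CompleteOrderedField) where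

  open CompleteOrderedField ℝ
  open Classical em ℝ
  open IsTotalOrder isTotalOrder using (total)
    renaming (refl to ≤-refl; reflexive to ≤-reflexive; trans to ≤-trans; antisym to ≤-antisym)
  open NatPowers commutativeSemiring using (_^_; ^-assocʳ; ^-distrib-*)

  poset : Poset 0ℓ 0ℓ 0ℓ
  poset = record { isPartialOrder = IsTotalOrder.isPartialOrder isTotalOrder }

  module ≤-Reasoning = PartialOrderReasoning poset
  module Solver = SemiringSolver commutativeSemiring

  ≤0⇒≈0 : ∀ {x} → 0# ≤ x → x ≤ 0# → x ≈ 0#
  ≤0⇒≈0 0≤x x≤0 = ≤-antisym x≤0 0≤x

  x≤0⇒c*x≤0 : ∀ {c x} → 0# ≤ c → x ≤ 0# → c * x ≤ 0#
  x≤0⇒c*x≤0 {c} 0≤c x≤0 = ≤-respʳ (zeroʳ c) (*-monoˡ-≤ 0≤c x≤0)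

  c*x≤0⇒x≤0 : ∀ {c x} → 0# ≤ c → ¬ (c ≈ 0#) → c * x ≤ 0# → x ≤ 0#
  c*x≤0⇒x≤0 {c} 0≤c c≉0 h = *-cancelˡ-≤ 0≤c c≉0 (≤-respʳ (sym (zeroʳ c)) h)

  x+y≤x⇒y≤0 : ∀ {x y} → x + y ≤ x → y ≤ 0#
  x+y≤x⇒y≤0 {x} {y} h = ≤-respˡ eq (≤-respʳ (-‿inverseˡ x) (+-monoʳ-≤ (- x) h))
    where
    eq : - x + (x + y) ≈ y
    eq = trans (sym (+-assoc (- x) x y)) (trans (+-congʳ (-‿inverseˡ x)) (+-identityˡ y))

  *-≉0 : ∀ {x y} → ¬ (x ≈ 0#) → ¬ (y ≈ 0#) → ¬ (x * y ≈ 0#)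
  *-≉0 {x} {y} x≉0 y≉0 e = y≉0 (trans (sym eq) (trans (*-congˡ e) (zeroʳ (recip x))))
    where
    eq : recip x * (x * y) ≈ y
    eq = trans (sym (*-assoc (recip x) x y))
           (trans (*-congʳ (trans (*-comm (recip x) x) (recip-inverse x≉0))) (*-identityˡ y))

  ^-swap : ∀ x m n → (x ^ m) ^ n ≈ (x ^ n) ^ m
  ^-swap x m n = trans (^-assocʳ x m n)
    (trans (reflexive (≡.cong (x ^_) (ℕₚ.*-comm m n))) (sym (^-assocʳ x n m)))

  -- Reads q ≥ 1 / (1 + n): positivity of q with a witness, so that integral roots of x lie below x ** q.
  _≥1/_ : Carrier → ℕ → Set
  q ≥1/ n = 1# ≤ q * ι (suc n)

  module _ {q n} (0≤q : 0# ≤ q) (q≥ : q ≥1/ n) where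

    private
      M = suc n

      below : ∀ {x y} → 0# ≤ x → PowerCut x q y → y ≤ x ** q
      below {x} {y} 0≤x = proj₁ (**-isSupremum 0≤x 0≤q) y

      root∈cut : ∀ {x y} → 1# ≤ x → 0# ≤ y → y ^ M ≤ x → PowerCut x q y
      root∈cut {x} {y} 1≤x 0≤y h =
        0≤y , 1 , n , ≤-respʳ (sym (*-identityʳ x)) h ,
        inj₁ (1≤x , ≤-respˡ (sym (+-identityʳ 1#)) q≥)

      ¬q≤0 : ¬ (q ≤ 0#)
      ¬q≤0 q≤0 = ¬1≤0 (≤-trans q≥ (≤-respʳ (zeroˡ (ι M)) (*-monoʳ-≤ (ι-nonneg M) q≤0)))

    0**≤0 : ∀ {x} → 0# ≤ x → x ≤ 0# → x ** q ≤ 0#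
    0**≤0 {x} 0≤x x≤0 = proj₂ (**-isSupremum 0≤x 0≤q) 0# bound
      where
      bound : IsUpperBound (PowerCut x q) 0#
      bound y (0≤y , m , n′ , h , inj₁ (1≤x , _)) = ⊥-elim (¬1≤0 (≤-trans 1≤x x≤0))
      -- The exponent 0 would allow the value 1 in the cut; it is admissible only if q ≤ 0, which
      -- `q≥` excludes.
      bound y (0≤y , zero , n′ , h , inj₂ (_ , qn≤0)) = ⊥-elim (¬q≤0
        (≤-trans (≤-respˡ (*-identityʳ q) (*-monoˡ-≤ 0≤q (x≤x+y 1# (ι-nonneg n′)))) qn≤0))
      bound y (0≤y , suc m , n′ , h , inj₂ _) = ^-cancel-≤ n′ 0≤y ≤-refl
        (≤-trans h (≤-respˡ (*-comm (x ^ m) x) (≤-trans (x≤0⇒c*x≤0 (^-nonneg m 0≤x) x≤0)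
          (^-nonneg (suc n′) ≤-refl))))

    -- For x ≤ 1 and an integer N ≥ q the cut contains x ^ N, which is nonzero unless x is zero; for
    -- x ≥ 1 it contains 1.
    **≤0⇒≤0 : ∀ {x} → 0# ≤ x → x ** q ≤ 0# → x ≤ 0#
    **≤0⇒≤0 {x} 0≤x h with total x 1#
    ... | inj₂ 1≤x = ⊥-elim (¬1≤0 (≤-trans
      (below 0≤x (0≤1 , 0 , 0 , ≤-reflexive (*-identityˡ 1#) ,
        inj₁ (1≤x , *-nonneg 0≤q (ι-nonneg 1)))) h))
    ... | inj₁ x≤1 with em {x ≈ 0#}
    ...   | yes x≈0 = ≤-reflexive x≈0
    ...   | no x≉0  = ⊥-elim (^-≉0 N x≉0 (≤0⇒≈0 (^-nonneg N 0≤x) (≤-trans (below 0≤x member) h)))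
      where
      N = proj₁ (archimedean q)
      member : PowerCut x q (x ^ N)
      member = ^-nonneg N 0≤x , N , 0 , ≤-reflexive (*-identityʳ (x ^ N)) ,
        inj₂ (x≤1 , ≤-respˡ (sym (trans (*-congˡ (+-identityʳ 1#)) (*-identityʳ q)))
          (proj₂ (archimedean q)))

    -- As q ≥ 1/M, the factor t ^ M contributes at least t. The power is given only as a supremum,
    -- so each y in the cut of x is multiplied by t and shown to lie in the cut of t ^ M * x:
    -- `scaled` keeps the rational exponent of y, `rooted` replaces it by 1/M.
    **-grow : ∀ {t x} → 1# ≤ t → 0# ≤ x → t * x ** q ≤ (t ^ M * x) ** q
    **-grow {t} {x} 1≤t 0≤x = ≤-respʳ (eq Z) (*-monoˡ-≤ 0≤t (proj₂ (**-isSupremum 0≤x 0≤q) (recip t * Z) bound))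
      where
      open ≤-Reasoning
      0≤t = 1≤x⇒0≤x 1≤t
      0≤tx = *-nonneg (^-nonneg M 0≤t) 0≤x
      x≤tx : x ≤ t ^ M * x
      x≤tx = ≤-respˡ (*-identityˡ x) (*-monoʳ-≤ 0≤x (1≤x^n M 1≤t))
      Z = (t ^ M * x) ** q
      eq : ∀ z → t * (recip t * z) ≈ z
      eq z = trans (sym (*-assoc t (recip t) z))
        (trans (*-congʳ (recip-inverse (1≤x⇒x≉0 1≤t))) (*-identityˡ z))

      scaled : ∀ {y m n′} → 0# ≤ y → y ^ suc n′ ≤ x ^ m → suc n′ ℕ.≤ M ℕ.* m →
               (t * y) ^ suc n′ ≤ (t ^ M * x) ^ m
      scaled {y} {m} {n′} 0≤y h n≤ = begin
        (t * y) ^ suc n′            ≈⟨ ^-distrib-* t y (suc n′) ⟩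
        t ^ suc n′ * y ^ suc n′     ≤⟨ *-mono-≤ (^-nonneg (M ℕ.* m) 0≤t) (^-nonneg (suc n′) 0≤y)
                                         (^-monoʳ-≤ 1≤t n≤) h ⟩
        t ^ (M ℕ.* m) * x ^ m       ≈⟨ *-congʳ (^-assocʳ t M m) ⟨
        (t ^ M) ^ m * x ^ m         ≈⟨ ^-distrib-* (t ^ M) x m ⟨
        (t ^ M * x) ^ m             ∎

      rooted : ∀ {y m n′} → 0# ≤ y → y ^ suc n′ ≤ x ^ m → x ^ (m ℕ.* M) ≤ x ^ suc n′ →
               1# ≤ t ^ M * x → PowerCut (t ^ M * x) q (t * y)
      rooted {y} {m} {n′} 0≤y h x≤ 1≤tx = root∈cut 1≤tx (*-nonneg 0≤t 0≤y) (begin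
        (t * y) ^ M      ≈⟨ ^-distrib-* t y M ⟩
        t ^ M * y ^ M    ≤⟨ *-monoˡ-≤ (^-nonneg M 0≤t) (^-cancel-≤ n′ (^-nonneg M 0≤y) 0≤x (begin
          (y ^ M) ^ suc n′  ≈⟨ ^-swap y M (suc n′) ⟩
          (y ^ suc n′) ^ M  ≤⟨ ^-monoˡ-≤ M (^-nonneg (suc n′) 0≤y) h ⟩
          (x ^ m) ^ M       ≈⟨ ^-assocʳ x m M ⟩
          x ^ (m ℕ.* M)     ≤⟨ x≤ ⟩
          x ^ suc n′        ∎)) ⟩
        t ^ M * x        ∎)

      n≤Mm : ∀ {m n′} → q * ι (suc n′) ≤ ι m → suc n′ ℕ.≤ M ℕ.* m
      n≤Mm {m} {n′} qn≤m = ι-cancel-≤ (begin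
        ι (suc n′)                  ≈⟨ *-identityʳ (ι (suc n′)) ⟨
        ι (suc n′) * 1#             ≤⟨ *-monoˡ-≤ (ι-nonneg (suc n′)) q≥ ⟩
        ι (suc n′) * (q * ι M)      ≈⟨ solve 3 (λ a b c → a :* (b :* c) := c :* (b :* a)) refl (ι (suc n′)) q (ι M) ⟩
        ι M * (q * ι (suc n′))      ≤⟨ *-monoˡ-≤ (ι-nonneg M) qn≤m ⟩
        ι M * ι m                   ≈⟨ ι-* M m ⟨
        ι (M ℕ.* m)                 ∎)
        where open Solver

      member : ∀ y → PowerCut x q y → PowerCut (t ^ M * x) q (t * y)
      member y (0≤y , m , n′ , h , inj₁ (1≤x , m≤qn)) with ℕₚ.≤-total (suc n′) (M ℕ.* m)
      ... | inj₁ n≤ = *-nonneg 0≤t 0≤y , m , n′ , scaled {m = m} {n′} 0≤y h n≤ , inj₁ (≤-trans 1≤x x≤tx , m≤qn)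
      ... | inj₂ ≤n = rooted {m = m} {n′} 0≤y h
        (^-monoʳ-≤ 1≤x (≡.subst (ℕ._≤ suc n′) (ℕₚ.*-comm M m) ≤n)) (≤-trans 1≤x x≤tx)
      member y (0≤y , m , n′ , h , inj₂ (x≤1 , qn≤m)) with total (t ^ M * x) 1#
      ... | inj₁ tx≤1 = *-nonneg 0≤t 0≤y , m , n′ , scaled {m = m} {n′} 0≤y h (n≤Mm {m} {n′} qn≤m) , inj₂ (tx≤1 , qn≤m)
      -- Scaling has carried the base from below 1 to above 1, where admissible exponents are at
      -- most q instead of at least q; 1/M is one.
      ... | inj₂ 1≤tx = rooted {m = m} {n′} 0≤y h (^-antiʳ-≤ 0≤x x≤1 (≡.subst (suc n′ ℕ.≤_) (ℕₚ.*-comm M m) (n≤Mm {m} {n′} qn≤m))) 1≤tx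

      bound : IsUpperBound (PowerCut x q) (recip t * Z)
      bound y y∈ = *-cancelˡ-≤ 0≤t (1≤x⇒x≉0 1≤t)
        (≤-respʳ (sym (eq Z)) (below 0≤tx (member y y∈)))

    -- If K * y ≤ x with K = (1 + C) ^ M, then growth gives (1 + C) * y ** q ≤ x ** q ≤ C * y ** q.
    -- Hence y ** q vanishes, therefore x ** q does, and so does x.
    **-cancel-≤ : ∀ {C} → 0# ≤ C → ∃ λ K → 0# ≤ K ×
      (∀ {x y} → 0# ≤ x → 0# ≤ y → x ** q ≤ C * y ** q → x ≤ K * y)
    **-cancel-≤ {C} 0≤C = K , 0≤K , cancel
      where
      K = (1# + C) ^ M
      0≤K = ^-nonneg M (0≤1+x 0≤C)
      cancel : ∀ {x y} → 0# ≤ x → 0# ≤ y → x ** q ≤ C * y ** q → x ≤ K * y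
      cancel {x} {y} 0≤x 0≤y h with total x (K * y)
      ... | inj₁ x≤Ky = x≤Ky
      ... | inj₂ Ky≤x = ≤-trans
        (**≤0⇒≤0 0≤x (≤-trans h (x≤0⇒c*x≤0 0≤C y**≤0))) (*-nonneg 0≤K 0≤y)
        where
        y**≤0 : y ** q ≤ 0#
        y**≤0 = x+y≤x⇒y≤0 (≤-respˡ eq (≤-trans (**-grow (x≤x+y 1# 0≤C) 0≤y)
          (≤-trans (**-mono-≤ 0≤q (*-nonneg 0≤K 0≤y) Ky≤x) h)))
          where
          eq : (1# + C) * y ** q ≈ C * y ** q + y ** q
          eq = solve 2 (λ c z → (con 1 :+ c) :* z := c :* z :+ z) refl C (y ** q)
            where open Solver

  ½≥ : ½ ≥1/ 1
  ½≥ = ≤-reflexive (sym (trans (*-comm ½ (ι 2)) (trans (*-congʳ (+-congˡ (+-identityʳ 1#)))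
    (recip-inverse (1≤x⇒x≉0 (x≤x+y 1# 0≤1))))))

  ∣0∣≤0 : ∀ {z} → z ≈ᶜ 0ᶜ → ∣ z ∣ ≤ 0#
  ∣0∣≤0 {z} z≈0 = ≤-respˡ (∣-∣-cong (ℂᴿ.sym z≈0)) (0**≤0 {½} {1} 0≤½ ½≥ (normSq-nonneg 0ᶜ)
    (≤-reflexive (trans (+-cong (zeroˡ 0#) (zeroˡ 0#)) (+-identityˡ 0#))))

  x*x≤0⇒x≈0 : ∀ {x} → x * x ≤ 0# → x ≈ 0#
  x*x≤0⇒x≈0 {x} h with em {x ≈ 0#}
  ... | yes e = e
  ... | no ¬e = ⊥-elim (*-≉0 ¬e ¬e (≤0⇒≈0 (square-nonneg x) h))

  ∣z∣≤0⇒z≈0 : ∀ {z} → ∣ z ∣ ≤ 0# → z ≈ᶜ 0ᶜ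
  ∣z∣≤0⇒z≈0 {a +i b} h =
    x*x≤0⇒x≈0 (≤-trans (x≤x+y (a * a) (square-nonneg b)) sq≤0) ,
    x*x≤0⇒x≈0 (≤-trans (y≤x+y (b * b) (square-nonneg a)) sq≤0)
    where
    sq≤0 : a * a + b * b ≤ 0#
    sq≤0 = **≤0⇒≤0 {½} {1} 0≤½ ½≥ (normSq-nonneg (a +i b)) h

-- Multiplicities in lists and sizes of filters.

occurrences : ℕ → List ℕ → ℕ
occurrences n xs = length (filter (_≟ n) xs)

occurrences-∷ : ∀ n x xs → occurrences n (x ∷ xs) ≡ occurrences n (x ∷ []) ℕ.+ occurrences n xs
occurrences-∷ n x xs = ≡.trans (≡.cong length (Listₚ.filter-++ (_≟ n) (x ∷ []) xs))
  (Listₚ.length-++ (filter (_≟ n) (x ∷ [])))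

occurrences-↭ : ∀ n {xs ys} → xs ↭ ys → occurrences n xs ≡ occurrences n ys
occurrences-↭ n p = ↭-length (filter-↭ (_≟ n) p)

0<length⇒∈ : ∀ {A : Set} (xs : List A) → 0 ℕ.< length xs → ∃ (_∈ xs)
0<length⇒∈ (x ∷ xs) _ = x , here ≡.refl

0<occurrences⇒∈ : ∀ n xs → 0 ℕ.< occurrences n xs → n ∈ xs
0<occurrences⇒∈ n xs h with 0<length⇒∈ (filter (_≟ n) xs) h
... | m , m∈ with ∈-filter⁻ (_≟ n) {xs = xs} m∈
...   | m∈xs , ≡.refl = m∈xs

-- Each element of `ys` is located in `xs` and split off there; `zs` is what remains at the end.
occurrences-≤⇒↭++ : ∀ xs ys → (∀ n → occurrences n ys ℕ.≤ occurrences n xs) →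
                    ∃ λ zs → xs ↭ ys ++ zs
occurrences-≤⇒↭++ xs []       h = xs , ↭-refl
occurrences-≤⇒↭++ xs (y ∷ ys) h
  with ∈-∃++ (0<occurrences⇒∈ y xs (ℕₚ.≤-trans (∈-length (∈-filter⁺ (_≟ y) {xs = y ∷ ys} (here ≡.refl) ≡.refl)) (h y)))
... | as , bs , ≡.refl = zs , ↭-trans (shift y as bs) (↭-prep y as++bs↭)
  where
  smaller : ∀ n → occurrences n ys ℕ.≤ occurrences n (as ++ bs)
  smaller n = ℕₚ.+-cancelˡ-≤ (occurrences n (y ∷ [])) _ _
    (≡.subst₂ ℕ._≤_ (occurrences-∷ n y ys)
      (≡.trans (occurrences-↭ n (shift y as bs)) (occurrences-∷ n y (as ++ bs))) (h n))
  rest = occurrences-≤⇒↭++ (as ++ bs) ys smaller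
  zs = proj₁ rest
  as++bs↭ = proj₂ rest

-- Equal lengths force the surplus `zs` to be empty, so domination of multiplicities in one
-- direction already yields a permutation.
occurrences-≤⇒↭ : ∀ xs ys → length xs ≡ length ys →
                  (∀ n → occurrences n ys ℕ.≤ occurrences n xs) → xs ↭ ys
occurrences-≤⇒↭ xs ys ∣xs∣≡∣ys∣ h with occurrences-≤⇒↭++ xs ys h
... | [] , p     = ↭-trans p (↭-reflexive (Listₚ.++-identityʳ ys))
... | z ∷ zs , p = ⊥-elim (ℕₚ.m≢1+m+n (length ys) {length zs}
  (≡.trans (≡.sym ∣xs∣≡∣ys∣) (≡.trans (↭-length p)
    (≡.trans (Listₚ.length-++ ys) (ℕₚ.+-suc (length ys) (length zs))))))

length-filter-mono : ∀ {a} {A : Set a} {P Q : A → Set} (P? : Decidable P) (Q? : Decidable Q) →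
  (∀ x → P x → Q x) → ∀ xs → length (filter P? xs) ℕ.≤ length (filter Q? xs)
length-filter-mono P? Q? P⊆Q []       = ℕ.z≤n
length-filter-mono P? Q? P⊆Q (x ∷ xs) with P? x | Q? x
... | yes p | yes q = ℕ.s≤s (length-filter-mono P? Q? P⊆Q xs)
... | yes p | no ¬q = ⊥-elim (¬q (P⊆Q x p))
... | no ¬p | yes q = ℕₚ.m≤n⇒m≤1+n (length-filter-mono P? Q? P⊆Q xs)
... | no ¬p | no ¬q = length-filter-mono P? Q? P⊆Q xs

-- The finite-set principle that an inclusion without growth in size is an equality; it is what
-- makes `rank` strictly monotone.
length-filter-reflects : ∀ {a} {A : Set a} {P Q : A → Set} (P? : Decidable P) (Q? : Decidable Q) →
  (∀ x → P x → Q x) → ∀ xs → length (filter Q? xs) ℕ.≤ length (filter P? xs) →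
  ∀ x → x ∈ xs → Q x → P x
length-filter-reflects P? Q? P⊆Q (x ∷ xs) h y y∈ q with P? x | Q? x
... | yes p | no ¬q = ⊥-elim (¬q (P⊆Q x p))
... | no ¬p | yes _ = ⊥-elim (ℕₚ.<-irrefl ≡.refl
  (ℕₚ.<-≤-trans h (length-filter-mono P? Q? P⊆Q xs)))
... | yes p | yes _ = both y∈
  where
  both : y ∈ x ∷ xs → _
  both (here ≡.refl) = p
  both (there y∈xs)  = length-filter-reflects P? Q? P⊆Q xs (ℕ.s≤s⁻¹ h) y y∈xs q
... | no ¬p | no ¬q = both y∈
  where
  both : y ∈ x ∷ xs → _
  both (here ≡.refl) = ⊥-elim (¬q q)
  both (there y∈xs)  = length-filter-reflects P? Q? P⊆Q xs h y y∈xs q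

-- Tuples and transpositions.

lookup-ext : ∀ {A : Set} {n} {xs ys : Vec A n} → (∀ l → lookup xs l ≡ lookup ys l) → xs ≡ ys
lookup-ext {xs = xs} {ys} h = ≡.trans (≡.sym (Vecₚ.tabulate∘lookup xs))
  (≡.trans (Vecₚ.tabulate-cong h) (Vecₚ.tabulate∘lookup ys))

map-inverse : ∀ {n} {f g : ℕ → ℕ} → (∀ i → f (g i) ≡ i) → (𝐢 : Vec ℕ n) → Vec.map f (Vec.map g 𝐢) ≡ 𝐢
map-inverse {f = f} {g} inv 𝐢 = ≡.trans (≡.sym (Vecₚ.map-∘ f g 𝐢))
  (≡.trans (Vecₚ.map-cong inv 𝐢) (Vecₚ.map-id 𝐢))

vecsOver : ∀ {A : Set} → List A → ∀ n → List (Vec A n)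
vecsOver xs zero    = [] ∷ []
vecsOver xs (suc n) = cartesianProductWith _∷_ xs (vecsOver xs n)

∈-vecsOver : ∀ {A : Set} (xs : List A) {n} (v : Vec A n) → (∀ l → lookup v l ∈ xs) → v ∈ vecsOver xs n
∈-vecsOver xs []      h = here ≡.refl
∈-vecsOver xs (x ∷ v) h = ∈-cartesianProductWith⁺ _∷_ (h zero) (∈-vecsOver xs v (h ∘ suc))

transpose : ℕ → ℕ → ℕ → ℕ
transpose a b x with x ≟ a | x ≟ b
... | yes _ | _     = b
... | no _  | yes _ = a
... | no _  | no _  = x

transpose-left : ∀ a b → transpose a b a ≡ b
transpose-left a b with a ≟ a | a ≟ b
... | yes _  | _ = ≡.refl
... | no a≢a | _ = ⊥-elim (a≢a ≡.refl)

transpose-right : ∀ a b → transpose a b b ≡ a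
transpose-right a b with b ≟ a | b ≟ b
... | yes b≡a | _      = b≡a
... | no _    | yes _  = ≡.refl
... | no _    | no b≢b = ⊥-elim (b≢b ≡.refl)

transpose-other : ∀ {a b x} → x ≢ a → x ≢ b → transpose a b x ≡ x
transpose-other {a} {b} {x} x≢a x≢b with x ≟ a | x ≟ b
... | yes x≡a | _       = ⊥-elim (x≢a x≡a)
... | no _    | yes x≡b = ⊥-elim (x≢b x≡b)
... | no _    | no _    = ≡.refl

transpose-involutive : ∀ a b x → transpose a b (transpose a b x) ≡ x
transpose-involutive a b x with x ≟ a | x ≟ b
... | yes ≡.refl | _          = transpose-right a b
... | no _       | yes ≡.refl = transpose-left a b
... | no x≢a     | no x≢b     = transpose-other x≢a x≢b

-- Finitely supported permutations, diagrams and kernels of labellings.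

module Combinatorics (em : ExcludedMiddle 0ℓ) (ℝ : CompleteOrderedField) where

  open Classical em ℝ

  transposition : ℕ → ℕ → S∞
  transposition a b = record
    { permutation = mk↔ₛ′ (transpose a b) (transpose a b) (transpose-involutive a b) (transpose-involutive a b)
    ; support     = a ∷ b ∷ []
    ; fixes       = λ i i∉ → transpose-other (λ e → i∉ (here e)) (λ e → i∉ (there (here e)))
    }

  infixr 9 _∘ˢ_
  _∘ˢ_ : S∞ → S∞ → S∞
  τ ∘ˢ σ = record
    { permutation = S∞.permutation τ ↔-∘ S∞.permutation σ
    ; support     = S∞.support σ ++ S∞.support τ
    ; fixes       = λ i i∉ → ≡.trans
        (≡.cong (S∞.to τ) (S∞.fixes σ i (i∉ ∘ ∈-++⁺ˡ)))
        (S∞.fixes τ i (i∉ ∘ ∈-++⁺ʳ (S∞.support σ)))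
    }

  to-injective : ∀ σ {a b} → S∞.to σ a ≡ S∞.to σ b → a ≡ b
  to-injective σ {a} {b} e = ≡.trans (≡.sym (S∞.from∘to σ a))
    (≡.trans (≡.cong (S∞.from σ) e) (S∞.from∘to σ b))

  -- Values are matched one at a time: the σ found for `L` is followed by the transposition that
  -- takes the current image of `f x` to `g x`. An earlier match at y is touched only if `g y` is
  -- one of these two values, and then x and y agree under both f and g, so the match persists.
  equal-kernels⇒conjugate : ∀ {X : Set} (f g : X → ℕ) → (∀ x y → (f x ≡ f y) ⇔ (g x ≡ g y)) →
    ∀ L → ∃ λ σ → ∀ x → x ∈ L → S∞.to σ (f x) ≡ g x
  equal-kernels⇒conjugate f g same []      = transposition 0 0 , λ x ()
  equal-kernels⇒conjugate f g same (x ∷ L) with equal-kernels⇒conjugate f g same L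
  ... | σ , agrees = transposition a b ∘ˢ σ , agrees′
    where
    a = S∞.to σ (f x)
    b = g x
    agrees′ : ∀ y → y ∈ x ∷ L → transpose a b (S∞.to σ (f y)) ≡ g y
    agrees′ y (here ≡.refl) = transpose-left a b
    agrees′ y (there y∈L) with g y ≟ a | g y ≟ b
    ... | yes gy≡a | _ = ≡.trans (≡.cong (transpose a b) fy≡a)
      (≡.trans (transpose-left a b) (≡.sym (Equivalence.to (same y x) (to-injective σ fy≡a))))
      where
      fy≡a : S∞.to σ (f y) ≡ a
      fy≡a = ≡.trans (agrees y y∈L) gy≡a
    ... | no _ | yes gy≡b = ≡.trans (≡.cong (transpose a b) (≡.trans (agrees y y∈L) gy≡b))
      (≡.trans (transpose-right a b)
        (≡.trans (≡.cong (S∞.to σ) (≡.sym (Equivalence.from (same y x) gy≡b))) (agrees y y∈L)))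
    ... | no gy≢a | no gy≢b = ≡.trans (≡.cong (transpose a b) (agrees y y∈L)) (transpose-other gy≢a gy≢b)

  vertices : ∀ k → List (Vertex k)
  vertices k = List.map inj₁ (allFin k) ++ List.map inj₂ (allFin k)

  ∈-vertices : ∀ {k} (x : Vertex k) → x ∈ vertices k
  ∈-vertices (inj₁ i) = ∈-++⁺ˡ (∈-map⁺ inj₁ (∈-allFin i))
  ∈-vertices {k} (inj₂ i) = ∈-++⁺ʳ (List.map inj₁ (allFin k)) (∈-map⁺ inj₂ (∈-allFin i))

  count-∃ : ∀ {k} {P Q : Fin k → Set} l → P l → count P ≡ count Q → ∃ Q
  count-∃ {k} {P} {Q} l Pl e with 0<length⇒∈ (filter {P = Q} (λ _ → em) (allFin k))
    (≡.subst (0 ℕ.<_) e (∈-length (∈-filter⁺ {P = P} (λ _ → em) (∈-allFin l) Pl)))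
  ... | m , m∈ = m , proj₂ (∈-filter⁻ {P = Q} (λ _ → em) {xs = allFin k} m∈)

  count-occurrences : ∀ {k} (w : Vec ℕ k) n → count (λ l → lookup w l ≡ n) ≡ occurrences n (toList w)
  count-occurrences {k} w n = along id w λ _ → ≡.refl
    where
    -- The induction needs an arbitrary reindexing g, since `allFin k` is `tabulate id` and its tail
    -- is a tabulation of `suc`.
    along : ∀ {m} (g : Fin m → Fin k) (v : Vec ℕ m) → (∀ l → lookup w (g l) ≡ lookup v l) →
      length (filter {P = λ l → lookup w l ≡ n} (λ _ → em) (List.tabulate g)) ≡ occurrences n (toList v)
    along g [] same = ≡.refl
    along g (x ∷ v) same with em {lookup w (g zero) ≡ n} | x ≟ n
    ... | yes _ | yes q  = ≡.trans (≡.cong suc (along (g ∘ suc) v (same ∘ suc)))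
      (≡.sym (≡.cong length (Listₚ.filter-accept (_≟ n) q)))
    ... | no _  | no ¬q  = ≡.trans (along (g ∘ suc) v (same ∘ suc))
      (≡.sym (≡.cong length (Listₚ.filter-reject (_≟ n) ¬q)))
    ... | yes p | no ¬q  = ⊥-elim (¬q (≡.trans (≡.sym (same zero)) p))
    ... | no ¬p | yes q  = ⊥-elim (¬p (≡.trans (same zero) q))

  infix 4 _⊑_
  _⊑_ : ∀ {k} → Diagram k → Diagram k → Set
  d ⊑ e = ∀ x y → Diagram._∼_ d x y → Diagram._∼_ e x y

  ⊑-trans : ∀ {k} {d e f : Diagram k} → d ⊑ e → e ⊑ f → d ⊑ f
  ⊑-trans d⊑e e⊑f x y = e⊑f x y ∘ d⊑e x y

  ⊑-antisym : ∀ {k} {d e : Diagram k} → d ⊑ e → e ⊑ d → d ≗ᴰ e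
  ⊑-antisym d⊑e e⊑d x y = mk⇔ (d⊑e x y) (e⊑d x y)

  ≗⇒⊑ : ∀ {k} {d e : Diagram k} → d ≗ᴰ e → d ⊑ e
  ≗⇒⊑ d≗e x y = Equivalence.to (d≗e x y)

  ≗⇒⊒ : ∀ {k} {d e : Diagram k} → d ≗ᴰ e → e ⊑ d
  ≗⇒⊒ d≗e x y = Equivalence.from (d≗e x y)

  -- A measure of coarseness that grows strictly along `_⊑_`; both triangular inductions, for
  -- injectivity and for surjectivity, run along it.
  rank : ∀ {k} → Diagram k → ℕ
  rank {k} d = length (filter {P = λ (x , y) → Diagram._∼_ d x y} (λ _ → em)
    (cartesianProduct (vertices k) (vertices k)))

  rank-mono : ∀ {k} {d e : Diagram k} → d ⊑ e → rank d ℕ.≤ rank e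
  rank-mono {k} d⊑e = length-filter-mono (λ _ → em) (λ _ → em) (λ (x , y) → d⊑e x y)
    (cartesianProduct (vertices k) (vertices k))

  rank-reflects : ∀ {k} {d e : Diagram k} → d ⊑ e → rank e ℕ.≤ rank d → e ⊑ d
  rank-reflects {k} d⊑e h x y = length-filter-reflects (λ _ → em) (λ _ → em) (λ (x , y) → d⊑e x y)
    (cartesianProduct (vertices k) (vertices k)) h (x , y) (∈-cartesianProduct⁺ (∈-vertices x) (∈-vertices y))

  maxRank : ℕ → ℕ
  maxRank k = length (cartesianProduct (vertices k) (vertices k))

  rank≤maxRank : ∀ {k} (d : Diagram k) → rank d ℕ.≤ maxRank k
  rank≤maxRank {k} d = Listₚ.length-filter (λ _ → em) (cartesianProduct (vertices k) (vertices k))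

  label : ∀ {k} → Vec ℕ k → Vec ℕ k → Vertex k → ℕ
  label 𝐢 𝐣 = [ lookup 𝐢 , lookup 𝐣 ]

  -- By `equal-kernels⇒conjugate` this is a complete invariant of the pair (𝐢 , 𝐣) under the
  -- diagonal action of `S∞`.
  kernel : ∀ {k} → Vec ℕ k → Vec ℕ k → Diagram k
  kernel 𝐢 𝐣 = record
    { _∼_             = λ x y → label 𝐢 𝐣 x ≡ label 𝐢 𝐣 y
    ; ∼-isEquivalence = On.isEquivalence (label 𝐢 𝐣) ≡.isEquivalence
    }

  label-map : ∀ {k} (f : ℕ → ℕ) (𝐢 𝐣 : Vec ℕ k) x →
              label (Vec.map f 𝐢) (Vec.map f 𝐣) x ≡ f (label 𝐢 𝐣 x)
  label-map f 𝐢 𝐣 (inj₁ l) = Vecₚ.lookup-map l f 𝐢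
  label-map f 𝐢 𝐣 (inj₂ l) = Vecₚ.lookup-map l f 𝐣

  -- A record rather than a synonym, so that 𝐢 and 𝐣 can be inferred.
  record Labels {k : ℕ} (d : Diagram k) (𝐢 𝐣 : Vec ℕ k) : Set where
    constructor labels
    field
      constant : d ⊑ kernel 𝐢 𝐣

  open Labels public

  Labels-map : ∀ {k} {d : Diagram k} (f : ℕ → ℕ) {𝐢 𝐣} → Labels d 𝐢 𝐣 →
               Labels d (Vec.map f 𝐢) (Vec.map f 𝐣)
  Labels-map f {𝐢} {𝐣} (labels h) = labels λ x y x∼y → ≡.trans (label-map f 𝐢 𝐣 x)
    (≡.trans (≡.cong f (h x y x∼y)) (≡.sym (label-map f 𝐢 𝐣 y)))

  module _ {k : ℕ} (d : Diagram k) where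
    open Diagram d

    private
      firstIn : List (Vertex k) → Vertex k → ℕ
      firstIn []      x = 0
      firstIn (y ∷ L) x with em {y ∼ x}
      ... | yes _ = 0
      ... | no _  = suc (firstIn L x)

      firstIn-≤ : ∀ L x → firstIn L x ℕ.≤ length L
      firstIn-≤ []      x = ℕ.z≤n
      firstIn-≤ (y ∷ L) x with em {y ∼ x}
      ... | yes _ = ℕ.z≤n
      ... | no _  = ℕ.s≤s (firstIn-≤ L x)

      firstIn-cong : ∀ L {x y} → x ∼ y → firstIn L x ≡ firstIn L y
      firstIn-cong []      x∼y = ≡.refl
      firstIn-cong (z ∷ L) {x} {y} x∼y with em {z ∼ x} | em {z ∼ y}
      ... | yes _   | yes _   = ≡.refl
      ... | no _    | no _    = ≡.cong suc (firstIn-cong L x∼y)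
      ... | yes z∼x | no z≁y  = ⊥-elim (z≁y (∼-trans z∼x x∼y))
      ... | no z≁x  | yes z∼y = ⊥-elim (z≁x (∼-trans z∼y (∼-sym x∼y)))

      firstIn-reflects : ∀ L {x y} → x ∈ L → firstIn L x ≡ firstIn L y → x ∼ y
      firstIn-reflects (z ∷ L) {x} {y} x∈ e with em {z ∼ x} | em {z ∼ y}
      ... | yes z∼x | yes z∼y = ∼-trans (∼-sym z∼x) z∼y
      firstIn-reflects (z ∷ L) {x} {y} (here ≡.refl) e | no z≁x | _ = ⊥-elim (z≁x ∼-refl)
      firstIn-reflects (z ∷ L) {x} {y} (there x∈) e | no _ | no _ =
        firstIn-reflects L x∈ (ℕₚ.suc-injective e)

    -- Each vertex is labelled by the position of the first vertex of its block. The kernel of this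
    -- labelling is `d`, and the labels are bounded in terms of k alone.
    canonical-top canonical-bottom : Vec ℕ k
    canonical-top    = tabulate (firstIn (vertices k) ∘ inj₁)
    canonical-bottom = tabulate (firstIn (vertices k) ∘ inj₂)

    private
      label-canonical : ∀ x → label canonical-top canonical-bottom x ≡ firstIn (vertices k) x
      label-canonical (inj₁ l) = Vecₚ.lookup∘tabulate (firstIn (vertices k) ∘ inj₁) l
      label-canonical (inj₂ l) = Vecₚ.lookup∘tabulate (firstIn (vertices k) ∘ inj₂) l

    kernel-canonical : kernel canonical-top canonical-bottom ≗ᴰ d
    kernel-canonical x y = mk⇔
      (λ e → firstIn-reflects (vertices k) (∈-vertices x)
        (≡.trans (≡.sym (label-canonical x)) (≡.trans e (label-canonical y))))
      (λ x∼y → ≡.trans (label-canonical x)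
        (≡.trans (firstIn-cong (vertices k) x∼y) (≡.sym (label-canonical y))))

    private
      range : List ℕ
      range = upTo (suc (length (vertices k)))

      label∈range : ∀ x → label canonical-top canonical-bottom x ∈ range
      label∈range x = ∈-upTo⁺ (ℕ.s≤s (≡.subst (ℕ._≤ length (vertices k))
        (≡.sym (label-canonical x)) (firstIn-≤ (vertices k) x)))

    canonical∈ : (canonical-top , canonical-bottom) ∈
      cartesianProduct (vecsOver range k) (vecsOver range k)
    canonical∈ = ∈-cartesianProduct⁺ (∈-vecsOver range canonical-top (label∈range ∘ inj₁))
      (∈-vecsOver range canonical-bottom (label∈range ∘ inj₂))

  -- A finite list that meets every kernel class, by `canonical∈` and `kernel-canonical`;
  -- prescribing entries thereby becomes a finite problem.
  canonicalPairs : ∀ k → List (Vec ℕ k × Vec ℕ k)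
  canonicalPairs k = cartesianProduct (vecsOver range k) (vecsOver range k)
    where range = upTo (suc (length (vertices k)))

  -- A block of `e` is a union of blocks of `d`, and such unions are balanced.
  uniform-⊑ : ∀ {k} {d e : Diagram k} → IsUniform d → d ⊑ e → IsUniform e
  uniform-⊑ {d = d} {e} u d⊑e x = uniform⇒balanced d u (λ y → y e.∼ x)
    λ y z y∼z y∼x → e.∼-trans (e.∼-sym (d⊑e y z y∼z)) y∼x
    where module e = Diagram e

  -- The block of a vertex with label n meets each row once per occurrence of n in it.
  kernel-uniform : ∀ {k} {𝐢 𝐣 : Vec ℕ k} → toList 𝐢 ↭ toList 𝐣 → IsUniform (kernel 𝐢 𝐣)
  kernel-uniform {𝐢 = 𝐢} {𝐣} p x = ≡.trans (count-occurrences 𝐢 (label 𝐢 𝐣 x))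
    (≡.trans (occurrences-↭ (label 𝐢 𝐣 x) p) (≡.sym (count-occurrences 𝐣 (label 𝐢 𝐣 x))))

  module _ {k : ℕ} {d : Diagram k} (uniform-d : IsUniform d) where
    open Diagram d

    -- The vertices that carry the label n form a union of blocks, so n occurs equally often in both
    -- rows.
    uniform⇒↭ : ∀ {𝐢 𝐣} → Labels d 𝐢 𝐣 → toList 𝐢 ↭ toList 𝐣
    uniform⇒↭ {𝐢} {𝐣} (labels h) = occurrences-≤⇒↭ (toList 𝐢) (toList 𝐣)
      (≡.trans (Vecₚ.length-toList 𝐢) (≡.sym (Vecₚ.length-toList 𝐣)))
      λ n → ℕₚ.≤-reflexive (≡.trans (≡.sym (count-occurrences 𝐣 n))
        (≡.trans (≡.sym (uniform⇒balanced d uniform-d (λ x → label 𝐢 𝐣 x ≡ n)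
          λ x y x∼y e → ≡.trans (≡.sym (h x y x∼y)) e)) (count-occurrences 𝐢 n)))

    -- The block of a bottom vertex has a positive number of bottom vertices, hence by uniformity a
    -- positive number of top vertices.
    above : ∀ l → ∃ λ m → inj₁ m ∼ inj₂ l
    above l = count-∃ l ∼-refl (≡.sym (uniform-d (inj₂ l)))

    below : ∀ l → ∃ λ m → inj₂ m ∼ inj₁ l
    below l = count-∃ l ∼-refl (uniform-d (inj₁ l))

    -- Every bottom vertex shares its label with a top vertex of its block, so the matrix of `d` has
    -- at most one 1 in each row. `top-unique` is the same for columns.
    bottom-unique : ∀ {𝐢 𝐣 𝐣′} → Labels d 𝐢 𝐣 → Labels d 𝐢 𝐣′ → 𝐣 ≡ 𝐣′
    bottom-unique (labels h) (labels h′) = lookup-ext λ l →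
      ≡.trans (≡.sym (h _ _ (proj₂ (above l)))) (h′ _ _ (proj₂ (above l)))

    top-unique : ∀ {𝐢 𝐢′ 𝐣} → Labels d 𝐢 𝐣 → Labels d 𝐢′ 𝐣 → 𝐢 ≡ 𝐢′
    top-unique (labels h) (labels h′) = lookup-ext λ l →
      ≡.trans (≡.sym (h _ _ (proj₂ (below l)))) (h′ _ _ (proj₂ (below l)))

-- Labellings of stacked diagrams.

module DiagramOperators (em : ExcludedMiddle 0ℓ) (ℝ : CompleteOrderedField) where

  open CompleteOrderedField ℝ
  open Classical em ℝ
  open IsTotalOrder isTotalOrder using ()
    renaming (refl to ≤-refl; reflexive to ≤-reflexive; trans to ≤-trans)
  open RealPowers em ℝ
  open Combinatorics em ℝ

  -- The three rows glue to one labelling of all sites; it is constant along single joins, hence on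
  -- the equivalence classes they generate.
  ⋆-Labels⁺ : ∀ {k} {d e : Diagram k} {𝐢 𝐦 𝐣} → Labels d 𝐢 𝐦 → Labels e 𝐦 𝐣 → Labels (d ⋆ e) 𝐢 𝐣
  ⋆-Labels⁺ {k} {d} {e} {𝐢} {𝐦} {𝐣} (labels hd) (labels he) = labels λ x y c →
    ≡.trans (≡.sym (siteLabel-outer x))
      (≡.trans (Closure.gfold ≡.isEquivalence siteLabel joined c) (siteLabel-outer y))
    where
    siteLabel : Site k → ℕ
    siteLabel (top l) = lookup 𝐢 l
    siteLabel (mid l) = lookup 𝐦 l
    siteLabel (bot l) = lookup 𝐣 l
    siteLabel-outer : ∀ x → siteLabel (outer x) ≡ label 𝐢 𝐣 x
    siteLabel-outer (inj₁ l) = ≡.refl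
    siteLabel-outer (inj₂ l) = ≡.refl
    siteLabel-upper : ∀ x → siteLabel (upper x) ≡ label 𝐢 𝐦 x
    siteLabel-upper (inj₁ l) = ≡.refl
    siteLabel-upper (inj₂ l) = ≡.refl
    siteLabel-lower : ∀ x → siteLabel (lower x) ≡ label 𝐦 𝐣 x
    siteLabel-lower (inj₁ l) = ≡.refl
    siteLabel-lower (inj₂ l) = ≡.refl
    joined : ∀ {s t} → Joined d e s t → siteLabel s ≡ siteLabel t
    joined (in-upper {x} {y} x∼y) = ≡.trans (siteLabel-upper x) (≡.trans (hd x y x∼y) (≡.sym (siteLabel-upper y)))
    joined (in-lower {x} {y} x∼y) = ≡.trans (siteLabel-lower x) (≡.trans (he x y x∼y) (≡.sym (siteLabel-lower y)))

  -- Uniformity of `d` joins each middle vertex to the top row, and 𝐦 copies the label found there.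
  -- As every site is then connected to an outer vertex, constancy on the blocks of `d ⋆ e` passes
  -- to the blocks of `d` and of `e`.
  ⋆-Labels⁻ : ∀ {k} {d e : Diagram k} {𝐢 𝐣} → IsUniform d → Labels (d ⋆ e) 𝐢 𝐣 →
              ∃ λ 𝐦 → Labels d 𝐢 𝐦 × Labels e 𝐦 𝐣
  ⋆-Labels⁻ {k} {d} {e} {𝐢} {𝐣} u (labels h) = 𝐦 , labels d⊑ , labels e⊑
    where
    open Diagram d using () renaming (_∼_ to _∼ᵈ_; ∼-refl to ∼ᵈ-refl; ∼-sym to ∼ᵈ-sym; ∼-trans to ∼ᵈ-trans)
    up : Fin k → Fin k
    up l = proj₁ (above {d = d} u l)
    up∼ : ∀ l → inj₁ (up l) ∼ᵈ inj₂ l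
    up∼ l = proj₂ (above {d = d} u l)
    𝐦 : Vec ℕ k
    𝐦 = tabulate (lookup 𝐢 ∘ up)

    topmost : Vertex k → Fin k
    topmost (inj₁ l) = l
    topmost (inj₂ l) = up l
    topmost∼ : ∀ x → inj₁ (topmost x) ∼ᵈ x
    topmost∼ (inj₁ l) = ∼ᵈ-refl
    topmost∼ (inj₂ l) = up∼ l
    label-topmost : ∀ x → label 𝐢 𝐦 x ≡ lookup 𝐢 (topmost x)
    label-topmost (inj₁ l) = ≡.refl
    label-topmost (inj₂ l) = Vecₚ.lookup∘tabulate (lookup 𝐢 ∘ up) l
    d⊑ : d ⊑ kernel 𝐢 𝐦
    d⊑ x y x∼y = ≡.trans (label-topmost x) (≡.trans
      (h (inj₁ (topmost x)) (inj₁ (topmost y))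
        (fwd (in-upper {x = inj₁ (topmost x)} {y = inj₁ (topmost y)}
          (∼ᵈ-trans (topmost∼ x) (∼ᵈ-trans x∼y (∼ᵈ-sym (topmost∼ y))))) ◅ ε))
      (≡.sym (label-topmost y)))

    outermost : Vertex k → Vertex k
    outermost (inj₁ l) = inj₁ (up l)
    outermost (inj₂ l) = inj₂ l
    outermost∼ : ∀ x → EqClosure (Joined d e) (outer (outermost x)) (lower x)
    outermost∼ (inj₁ l) = fwd (in-upper (up∼ l)) ◅ ε
    outermost∼ (inj₂ l) = ε
    label-outermost : ∀ x → label 𝐦 𝐣 x ≡ label 𝐢 𝐣 (outermost x)
    label-outermost (inj₁ l) = Vecₚ.lookup∘tabulate (lookup 𝐢 ∘ up) l
    label-outermost (inj₂ l) = ≡.refl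
    e⊑ : e ⊑ kernel 𝐦 𝐣
    e⊑ x y x∼y = ≡.trans (label-outermost x) (≡.trans
      (h (outermost x) (outermost y)
        (outermost∼ x ◅◅ fwd (in-lower x∼y) ◅ Closure.symmetric (Joined d e) (outermost∼ y)))
      (≡.sym (label-outermost y)))

  -- Linear extension to formal combinations.

  module LinearCombinations (k : ℕ) where
    open UniformBlockPermutations k

    -- The linear extension of F to formal combinations. Coefficients, matrix entries and the values
    -- of `φ u` all take this form.
    weigh : (UniformDiagram k → ℂ) → U → ℂ
    weigh F []            = 0ᶜ
    weigh F ((c , d) ∷ u) = c *ᶜ F d +ᶜ weigh F u

    weigh-cong : ∀ {F G} → (∀ d → F d ≈ᶜ G d) → ∀ u → weigh F u ≈ᶜ weigh G u
    weigh-cong F≈G []            = ℂᴿ.refl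
    weigh-cong F≈G ((c , d) ∷ u) = ℂᴿ.+-cong (ℂᴿ.*-congˡ (F≈G d)) (weigh-cong F≈G u)

    weigh-0 : ∀ {F} → (∀ d → F d ≈ᶜ 0ᶜ) → ∀ u → weigh F u ≈ᶜ 0ᶜ
    weigh-0 F≈0 []            = ℂᴿ.refl
    weigh-0 F≈0 ((c , d) ∷ u) = ℂᴿ.trans
      (ℂᴿ.+-cong (ℂᴿ.trans (ℂᴿ.*-congˡ (F≈0 d)) (ℂᴿ.zeroʳ c)) (weigh-0 F≈0 u)) (ℂᴿ.+-identityˡ 0ᶜ)

    weigh-+ : ∀ F G u → weigh (λ d → F d +ᶜ G d) u ≈ᶜ weigh F u +ᶜ weigh G u
    weigh-+ F G []            = ℂᴿ.sym (ℂᴿ.+-identityˡ 0ᶜ)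
    weigh-+ F G ((c , d) ∷ u) = ℂᴿ.trans
      (ℂᴿ.+-cong (ℂᴿ.distribˡ c (F d) (G d)) (weigh-+ F G u))
      (+ᶜ-interchange (c *ᶜ F d) (c *ᶜ G d) (weigh F u) (weigh G u))

    weigh-*ˡ : ∀ b F u → weigh (λ d → b *ᶜ F d) u ≈ᶜ b *ᶜ weigh F u
    weigh-*ˡ b F []            = ℂᴿ.sym (ℂᴿ.zeroʳ b)
    weigh-*ˡ b F ((c , d) ∷ u) = ℂᴿ.trans
      (ℂᴿ.+-cong (*ᶜ-swap c b (F d)) (weigh-*ˡ b F u)) (ℂᴿ.sym (ℂᴿ.distribˡ b (c *ᶜ F d) (weigh F u)))

    weigh-++ : ∀ F u v → weigh F (u ++ v) ≈ᶜ weigh F u +ᶜ weigh F v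
    weigh-++ F []            v = ℂᴿ.sym (ℂᴿ.+-identityˡ (weigh F v))
    weigh-++ F ((c , d) ∷ u) v = ℂᴿ.trans (ℂᴿ.+-congˡ (weigh-++ F u v))
      (ℂᴿ.sym (ℂᴿ.+-assoc (c *ᶜ F d) (weigh F u) (weigh F v)))

    weigh-•ᵁ : ∀ F b u → weigh F (b •ᵁ u) ≈ᶜ b *ᶜ weigh F u
    weigh-•ᵁ F b []            = ℂᴿ.sym (ℂᴿ.zeroʳ b)
    weigh-•ᵁ F b ((c , d) ∷ u) = ℂᴿ.trans
      (ℂᴿ.+-cong (ℂᴿ.*-assoc b c (F d)) (weigh-•ᵁ F b u)) (ℂᴿ.sym (ℂᴿ.distribˡ b (c *ᶜ F d) (weigh F u)))

    weigh-*ᵁ : ∀ F u v → weigh F (u *ᵁ v) ≈ᶜ weigh (λ d → weigh (λ e → F (d ⋆ᵁ e)) v) u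
    weigh-*ᵁ F []            v = ℂᴿ.refl
    weigh-*ᵁ F ((c , d) ∷ u) v = ℂᴿ.trans
      (weigh-++ F (List.map (λ (c′ , e) → c *ᶜ c′ , d ⋆ᵁ e) v) (u *ᵁ v))
      (ℂᴿ.+-cong (row v) (weigh-*ᵁ F u v))
      where
      row : ∀ v → weigh F (List.map (λ (c′ , e) → c *ᶜ c′ , d ⋆ᵁ e) v) ≈ᶜ c *ᶜ weigh (λ e → F (d ⋆ᵁ e)) v
      row []             = ℂᴿ.sym (ℂᴿ.zeroʳ c)
      row ((c′ , e) ∷ v) = ℂᴿ.trans
        (ℂᴿ.+-cong (ℂᴿ.*-assoc c c′ (F (d ⋆ᵁ e))) (row v))
        (ℂᴿ.sym (ℂᴿ.distribˡ c (c′ *ᶜ F (d ⋆ᵁ e)) (weigh (λ e → F (d ⋆ᵁ e)) v)))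

  -- The action of diagrams on the sequence space.

  module Representation
    (p : Carrier) (1≤p : 1# ≤ p)
    (μ : ℕ → Carrier) (0<μ : ∀ i → 0# < μ i)
    (k : ℕ)
    where

    open LᵖSpace p 1≤p μ 0<μ k
    open UniformBlockPermutations k
    open LinearCombinations k

    p≥ : p ≥1/ 0
    p≥ = ≤-respʳ (sym (trans (*-congˡ (+-identityʳ 1#)) (*-identityʳ p))) 1≤p

    μ̂-↭ : ∀ {m n} (𝐢 : Vec ℕ m) (𝐣 : Vec ℕ n) → toList 𝐢 ↭ toList 𝐣 → μ̂ 𝐢 ≈ μ̂ 𝐣
    μ̂-↭ 𝐢 𝐣 𝐢↭𝐣 = trans (μ̂-toList 𝐢) (trans (product-↭ 𝐢↭𝐣) (sym (μ̂-toList 𝐣)))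
      where
      product : List ℕ → Carrier
      product = List.foldr (λ i x → μ i * x) 1#
      μ̂-toList : ∀ {n} (𝐢 : Vec ℕ n) → μ̂ 𝐢 ≈ product (toList 𝐢)
      μ̂-toList []      = refl
      μ̂-toList (i ∷ 𝐢) = *-congˡ (μ̂-toList 𝐢)
      product-↭ : ∀ {xs ys} → xs ↭ ys → product xs ≈ product ys
      product-↭ Permutation.refl        = refl
      product-↭ (prep x q)              = *-congˡ (product-↭ q)
      product-↭ (swap x y q)            = trans (*-congˡ (*-congˡ (product-↭ q)))
        (trans (sym (*-assoc (μ x) (μ y) _)) (trans (*-congʳ (*-comm (μ x) (μ y))) (*-assoc (μ y) (μ x) _)))
      product-↭ (Permutation.trans q r) = trans (product-↭ q) (product-↭ r)

    weight-nonneg : ∀ 𝐢 → 0# ≤ μ̂ {k} 𝐢 ** p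
    weight-nonneg 𝐢 = **-nonneg (μ̂-nonneg 𝐢) 0≤p

    ∣∣**p-nonneg : ∀ z → 0# ≤ ∣ z ∣ ** p
    ∣∣**p-nonneg z = **-nonneg (∣-∣-nonneg z) 0≤p

    term-nonneg : ∀ a 𝐢 → 0# ≤ term a 𝐢
    term-nonneg a 𝐢 = *-nonneg (∣∣**p-nonneg (a 𝐢)) (weight-nonneg 𝐢)

    ∣∣**p-cong : ∀ {z w} → z ≈ᶜ w → ∣ z ∣ ** p ≈ ∣ w ∣ ** p
    ∣∣**p-cong {z} z≈w = **-congˡ 0≤p (∣-∣-nonneg z) (∣-∣-cong z≈w)

    term-0 : ∀ {a 𝐢} → a 𝐢 ≈ᶜ 0ᶜ → term a 𝐢 ≤ 0#
    term-0 {a} {𝐢} a≈0 = ≤-respˡ (*-comm _ _) (x≤0⇒c*x≤0 (weight-nonneg 𝐢)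
      (0**≤0 {p} {0} 0≤p p≥ (∣-∣-nonneg (a 𝐢)) (∣0∣≤0 a≈0)))

    module _ (d : UniformDiagram k) where

      Target : Vec ℕ k → Vec ℕ k → Set
      Target = Labels (diagram d)

      private
        select : ∀ 𝐢 → Sequence → Dec (∃ (Target 𝐢)) → ℂ
        select 𝐢 a (yes (𝐣 , _)) = a 𝐣
        select 𝐢 a (no _)        = 0ᶜ

      -- The 0/1 matrix of `d` applied to `a`: by `bottom-unique` row 𝐢 has at most one nonzero
      -- entry, so a single value of `a`, or 0, replaces the sum.
      transport : Sequence → Sequence
      transport a 𝐢 = select 𝐢 a (em {∃ (Target 𝐢)})

      target : ∀ 𝐢 → ∃ (Target 𝐢) ⊎ ¬ ∃ (Target 𝐢)
      target 𝐢 = toSum em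

      transport-hit : ∀ a {𝐢 𝐣} → Target 𝐢 𝐣 → transport a 𝐢 ≡ a 𝐣
      transport-hit a {𝐢} t with em {∃ (Target 𝐢)}
      ... | yes (𝐣 , t′) = ≡.cong a (bottom-unique (uniform d) t′ t)
      ... | no ¬t        = ⊥-elim (¬t (_ , t))

      transport-miss : ∀ a {𝐢} → ¬ ∃ (Target 𝐢) → transport a 𝐢 ≡ 0ᶜ
      transport-miss a {𝐢} ¬t with em {∃ (Target 𝐢)}
      ... | yes t = ⊥-elim (¬t t)
      ... | no _  = ≡.refl

      transport-cong : ∀ {a b} → (∀ 𝐣 → a 𝐣 ≈ᶜ b 𝐣) → ∀ 𝐢 → transport a 𝐢 ≈ᶜ transport b 𝐢
      transport-cong a≈b 𝐢 with em {∃ (Target 𝐢)}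
      ... | yes (𝐣 , _) = a≈b 𝐣
      ... | no _        = ℂᴿ.refl

      private
        -- G lists the targets of those members of F that have one. They are distinct by
        -- `top-unique`, for which the sources are carried along; rows without a target contribute
        -- 0, and a hit keeps its term because the weights of 𝐢 and of its target agree.
        Σ-transport : ∀ a F → Unique F → ∃ λ G → Unique G ×
          (∀ 𝐣 → 𝐣 ∈ G → ∃ λ 𝐢 → 𝐢 ∈ F × Target 𝐢 𝐣) × Σ[ F ] (term (transport a)) ≤ Σ[ G ] (term a)
        Σ-transport a [] _ = [] , AllPairs.[] , (λ 𝐣 ()) , ≤-refl
        Σ-transport a (𝐢 ∷ F) (𝐢∉F AllPairs.∷ F!) with Σ-transport a F F! | target 𝐢
        ... | G , G! , source , bound | inj₂ ¬t = G , G! , source′ ,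
          ≤-respʳ (+-identityˡ _) (+-mono-≤ (term-0 {transport a} {𝐢} (ℂᴿ.reflexive (transport-miss a ¬t))) bound)
          where
          source′ : ∀ 𝐣 → 𝐣 ∈ G → ∃ λ 𝐡 → 𝐡 ∈ 𝐢 ∷ F × Target 𝐡 𝐣
          source′ 𝐣 𝐣∈ with source 𝐣 𝐣∈
          ... | 𝐡 , 𝐡∈ , t = 𝐡 , there 𝐡∈ , t
        ... | G , G! , source , bound | inj₁ (𝐣₀ , t₀) = 𝐣₀ ∷ G , All.tabulate fresh AllPairs.∷ G! , source′ ,
          +-mono-≤ (≤-reflexive (*-cong
            (∣∣**p-cong (ℂᴿ.reflexive (transport-hit a t₀)))
            (**-congˡ 0≤p (μ̂-nonneg 𝐢) (μ̂-↭ 𝐢 𝐣₀ (uniform⇒↭ (uniform d) t₀))))) bound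
          where
          fresh : ∀ {𝐣} → 𝐣 ∈ G → 𝐣₀ ≢ 𝐣
          fresh {𝐣} 𝐣∈ ≡.refl with source 𝐣 𝐣∈
          ... | 𝐡 , 𝐡∈ , t = All.lookup 𝐢∉F 𝐡∈ (top-unique (uniform d) t₀ t)
          source′ : ∀ 𝐣 → 𝐣 ∈ 𝐣₀ ∷ G → ∃ λ 𝐡 → 𝐡 ∈ 𝐢 ∷ F × Target 𝐡 𝐣
          source′ 𝐣 (here ≡.refl) = 𝐢 , here ≡.refl , t₀
          source′ 𝐣 (there 𝐣∈) with source 𝐣 𝐣∈
          ... | 𝐡 , 𝐡∈ , t = 𝐡 , there 𝐡∈ , t

      Σ-transport-≤ : ∀ {a} → Summable (term a) → ∀ F → Unique F → Σ[ F ] (term (transport a)) ≤ Σ∞ (term a)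
      Σ-transport-≤ {a} sa F F! with Σ-transport a F F!
      ... | G , G! , _ , bound = ≤-trans bound (Σ≤Σ∞ sa G G!)

      opaque
        transport-summable : ∀ {a} → Summable (term a) → Summable (term (transport a))
        transport-summable sa = _ , Σ-transport-≤ sa

      transportᴮ : BoundedOperator
      transportᴮ = record
        { apply       = λ v → transport (seq v) ∈Lᵖ transport-summable (summable v)
        ; cong        = transport-cong
        ; additive    = λ u v 𝐢 → additive′ (seq u) (seq v) 𝐢
        ; homogeneous = λ c v 𝐢 → homogeneous′ c (seq v) 𝐢
        ; bounded     = 1# , 0≤1 , λ v → ≤-respʳ (sym (*-identityˡ ‖ v ‖))
            (**-mono-≤ 0≤1/p (Σ∞-nonneg (transport-summable (summable v)))
              (Σ∞-least (Σ-transport-≤ (summable v))))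
        }
        where
        additive′ : ∀ a b 𝐢 → transport (λ 𝐣 → a 𝐣 +ᶜ b 𝐣) 𝐢 ≈ᶜ transport a 𝐢 +ᶜ transport b 𝐢
        additive′ a b 𝐢 with em {∃ (Target 𝐢)}
        ... | yes _ = ℂᴿ.refl
        ... | no _  = ℂᴿ.sym (ℂᴿ.+-identityˡ 0ᶜ)
        homogeneous′ : ∀ c a 𝐢 → transport (λ 𝐣 → c *ᶜ a 𝐣) 𝐢 ≈ᶜ c *ᶜ transport a 𝐢
        homogeneous′ c a 𝐢 with em {∃ (Target 𝐢)}
        ... | yes _ = ℂᴿ.refl
        ... | no _  = ℂᴿ.sym (ℂᴿ.zeroʳ c)

      -- Applying one map to all labels keeps them constant on blocks, so the permutation takes
      -- targets to targets; its inverse gives the converse.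
      transportᶻ : Centralizer
      transportᶻ = record { operator = transportᴮ ; commutes = λ σ v → commutes′ σ (seq v) }
        where
        commutes′ : ∀ σ a 𝐢 → transport a (Vec.map (S∞.from σ) 𝐢) ≈ᶜ
                    transport (λ 𝐣 → a (Vec.map (S∞.from σ) 𝐣)) 𝐢
        commutes′ σ a 𝐢 with em {∃ (Target 𝐢)}
        ... | yes (𝐣 , t) = ℂᴿ.reflexive (transport-hit a (Labels-map (S∞.from σ) t))
        ... | no ¬t       = ℂᴿ.reflexive (transport-miss a λ (𝐣 , t) →
          ¬t (Vec.map (S∞.to σ) 𝐣 , ≡.subst (λ 𝐡 → Target 𝐡 (Vec.map (S∞.to σ) 𝐣)) (map-inverse (S∞.to∘from σ) 𝐢)
            (Labels-map (S∞.to σ) t)))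

    transport-⋆ : ∀ d e a 𝐢 → transport (d ⋆ᵁ e) a 𝐢 ≈ᶜ transport d (transport e a) 𝐢
    transport-⋆ d e a 𝐢 with em {∃ (Target d 𝐢)}
    ... | no ¬t = ℂᴿ.reflexive (transport-miss (d ⋆ᵁ e) a λ (𝐣 , t) →
      ¬t (_ , proj₁ (proj₂ (⋆-Labels⁻ (uniform d) t))))
    ... | yes (𝐦 , t) with em {∃ (Target e 𝐦)}
    ...   | yes (𝐣 , t′) = ℂᴿ.reflexive (transport-hit (d ⋆ᵁ e) a
      (⋆-Labels⁺ t t′))
    ...   | no ¬t′ = ℂᴿ.reflexive (transport-miss (d ⋆ᵁ e) a missing)
      where
      missing : ¬ ∃ (Target (d ⋆ᵁ e) 𝐢)
      missing (𝐣 , t″) with ⋆-Labels⁻ (uniform d) t″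
      -- The middle tuple is determined by 𝐢 and `d`, so it is the 𝐦 already known to have no target
      -- under `e`.
      ... | 𝐦′ , tᵈ , tᵉ with bottom-unique (uniform d) t tᵈ
      ...   | ≡.refl = ¬t′ (𝐣 , tᵉ)

    transport-identity : ∀ a 𝐢 → transport (identityᵁ k) a 𝐢 ≡ a 𝐢
    transport-identity a 𝐢 = transport-hit (identityᵁ k) a (labels diagonal)
      where
      diagonal : identityDiagram k ⊑ kernel 𝐢 𝐢
      diagonal (inj₁ l) (inj₁ m) = ≡.cong (lookup 𝐢)
      diagonal (inj₁ l) (inj₂ m) = ≡.cong (lookup 𝐢)
      diagonal (inj₂ l) (inj₁ m) = ≡.cong (lookup 𝐢)
      diagonal (inj₂ l) (inj₂ m) = ≡.cong (lookup 𝐢)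

    transport-≗ : ∀ d e → diagram d ≗ᴰ diagram e → ∀ a 𝐢 → transport d a 𝐢 ≡ transport e a 𝐢
    transport-≗ d e d≗e a 𝐢 with em {∃ (Target e 𝐢)}
    ... | yes (𝐣 , t) = transport-hit d a (labels λ x y → constant t x y ∘ ≗⇒⊑ {d = diagram d} {diagram e} d≗e x y)
    ... | no ¬t       = transport-miss d a λ (𝐣 , t) →
      ¬t (𝐣 , (labels λ x y → constant t x y ∘ ≗⇒⊒ {d = diagram d} {diagram e} d≗e x y))

    φ : U → Centralizer
    φ []            = 0ᶜ •ᶻ 1ᶻ
    φ ((c , d) ∷ u) = (c •ᶻ transportᶻ d) +ᶻ φ u

    φ-apply : ∀ u v 𝐢 → seq (apply (operator (φ u)) v) 𝐢 ≈ᶜ weigh (λ d → transport d (seq v) 𝐢) u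
    φ-apply []            v 𝐢 = ℂᴿ.zeroˡ (seq v 𝐢)
    φ-apply ((c , d) ∷ u) v 𝐢 = ℂᴿ.+-congˡ (φ-apply u v 𝐢)

    φ-+ : ∀ u v → φ (u ++ v) ≈ᶻ (φ u +ᶻ φ v)
    φ-+ u v x 𝐢 = ℂᴿ.trans (φ-apply (u ++ v) x 𝐢)
      (ℂᴿ.trans (weigh-++ (λ d → transport d (seq x) 𝐢) u v)
        (ℂᴿ.sym (ℂᴿ.+-cong (φ-apply u x 𝐢) (φ-apply v x 𝐢))))

    φ-• : ∀ c u → φ (c •ᵁ u) ≈ᶻ (c •ᶻ φ u)
    φ-• c u x 𝐢 = ℂᴿ.trans (φ-apply (c •ᵁ u) x 𝐢)
      (ℂᴿ.trans (weigh-•ᵁ (λ d → transport d (seq x) 𝐢) c u)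
        (ℂᴿ.*-congˡ (ℂᴿ.sym (φ-apply u x 𝐢))))

    φ-1 : φ 1ᵁ ≈ᶻ 1ᶻ
    φ-1 x 𝐢 = ℂᴿ.trans (ℂᴿ.+-cong
        (ℂᴿ.trans (ℂᴿ.*-identityˡ _) (ℂᴿ.reflexive (transport-identity (seq x) 𝐢))) (ℂᴿ.zeroˡ (seq x 𝐢)))
      (ℂᴿ.+-identityʳ (seq x 𝐢))

    φ-* : ∀ u v → φ (u *ᵁ v) ≈ᶻ (φ u ∘ᶻ φ v)
    φ-* u v x 𝐢 = ℂᴿ.trans (φ-apply (u *ᵁ v) x 𝐢)
      (ℂᴿ.trans (weigh-*ᵁ (λ d → transport d (seq x) 𝐢) u v)
        (ℂᴿ.trans (weigh-cong pointwise u) (ℂᴿ.sym (φ-apply u (apply (operator (φ v)) x) 𝐢))))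
      where
      -- `transport d` at 𝐢 is evaluation at a target or 0, hence it passes through the finite sum
      -- over `v`.
      distribute : ∀ d 𝐢 → transport d (λ 𝐣 → weigh (λ e → transport e (seq x) 𝐣) v) 𝐢 ≈ᶜ
                   weigh (λ e → transport d (transport e (seq x)) 𝐢) v
      distribute d 𝐢 with em {∃ (Target d 𝐢)}
      ... | yes _ = ℂᴿ.refl
      ... | no _  = ℂᴿ.sym (weigh-0 (λ e → ℂᴿ.refl) v)
      pointwise : ∀ d → weigh (λ e → transport (d ⋆ᵁ e) (seq x) 𝐢) v ≈ᶜ
                  transport d (seq (apply (operator (φ v)) x)) 𝐢
      pointwise d = ℂᴿ.trans (weigh-cong (λ e → transport-⋆ d e (seq x) 𝐢) v)
        (ℂᴿ.trans (ℂᴿ.sym (distribute d 𝐢))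
          (transport-cong d (λ 𝐣 → ℂᴿ.sym (φ-apply v x 𝐣)) 𝐢))

-- Coefficients and matrix entries of combinations of diagrams.

module DiagramAlgebra (em : ExcludedMiddle 0ℓ) (ℝ : CompleteOrderedField) (k : ℕ) where

  open Classical em ℝ
  open Combinatorics em ℝ
  open DiagramOperators em ℝ
  open LinearCombinations k
  open UniformBlockPermutations k

  χ : Set → ℂ
  χ P = if does (em {P}) then 1ᶜ else 0ᶜ

  χ-true : ∀ {P} → P → χ P ≡ 1ᶜ
  χ-true {P} p with em {P}
  ... | yes _ = ≡.refl
  ... | no ¬p = ⊥-elim (¬p p)

  χ-false : ∀ {P} → ¬ P → χ P ≡ 0ᶜ
  χ-false {P} ¬p with em {P}
  ... | yes p = ⊥-elim (¬p p)
  ... | no _  = ≡.refl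

  χ-cong : ∀ {P Q} → (P → Q) → (Q → P) → χ P ≡ χ Q
  χ-cong {P} {Q} f g with em {Q}
  ... | yes q = χ-true (g q)
  ... | no ¬q = χ-false (¬q ∘ f)

  ≗-refl : (d : Diagram k) → d ≗ᴰ d
  ≗-refl d x y = mk⇔ id id

  ≗-sym : {d e : Diagram k} → d ≗ᴰ e → e ≗ᴰ d
  ≗-sym {d} {e} d≗e = ⊑-antisym {d = e} {d} (≗⇒⊒ {d = d} {e} d≗e) (≗⇒⊑ {d = d} {e} d≗e)

  ≗-trans : {d e f : Diagram k} → d ≗ᴰ e → e ≗ᴰ f → d ≗ᴰ f
  ≗-trans {d} {e} {f} d≗e e≗f = ⊑-antisym {d = d} {f}
    (⊑-trans {d = d} {e} {f} (≗⇒⊑ {d = d} {e} d≗e) (≗⇒⊑ {d = e} {f} e≗f))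
    (⊑-trans {d = f} {e} {d} (≗⇒⊒ {d = e} {f} e≗f) (≗⇒⊒ {d = d} {e} d≗e))

  rank-≗ : {d e : Diagram k} → d ≗ᴰ e → rank d ≡ rank e
  rank-≗ {d} {e} d≗e = ℕₚ.≤-antisym (rank-mono {d = d} {e} (≗⇒⊑ {d = d} {e} d≗e))
    (rank-mono {d = e} {d} (≗⇒⊒ {d = d} {e} d≗e))

  coefficient-weigh : ∀ u d → coefficient u d ≈ᶜ weigh (λ e → χ (diagram e ≗ᴰ diagram d)) u
  coefficient-weigh []            d = ℂᴿ.refl
  coefficient-weigh ((c , e) ∷ u) d = ℂᴿ.+-cong head (coefficient-weigh u d)
    where
    head : (if does (em {diagram e ≗ᴰ diagram d}) then c else 0ᶜ) ≈ᶜ c *ᶜ χ (diagram e ≗ᴰ diagram d)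
    head with em {diagram e ≗ᴰ diagram d}
    ... | yes _ = ℂᴿ.sym (ℂᴿ.*-identityʳ c)
    ... | no _  = ℂᴿ.sym (ℂᴿ.zeroʳ c)

  -- One set partition has many representing relations; only functions that ignore the choice are
  -- compatible with `_≈ᵁ_`.
  Invariant : (UniformDiagram k → ℂ) → Set₁
  Invariant F = ∀ d e → diagram d ≗ᴰ diagram e → F d ≈ᶜ F e

  module _ {F : UniformDiagram k → ℂ} (F-invariant : Invariant F) where

    private
      Occurs : List (UniformDiagram k) → UniformDiagram k → Set
      Occurs []      e = ⊥
      Occurs (d ∷ D) e = diagram e ≗ᴰ diagram d ⊎ Occurs D e

      Occurs-≗ : ∀ D d e → diagram d ≗ᴰ diagram e → Occurs D d → Occurs D e
      Occurs-≗ (f ∷ D) d e d≗e (inj₁ d≗f) = inj₁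
        (≗-trans {diagram e} {diagram d} {diagram f} (≗-sym {diagram d} {diagram e} d≗e) d≗f)
      Occurs-≗ (f ∷ D) d e d≗e (inj₂ occ) = inj₂ (Occurs-≗ D d e d≗e occ)

      restricted : List (UniformDiagram k) → UniformDiagram k → ℂ
      restricted D e = χ (Occurs D e) *ᶜ F e

      0*+ : ∀ {x y z} → x ≈ᶜ 0ᶜ → z ≈ᶜ y → x +ᶜ z ≈ᶜ y
      0*+ x≈0 z≈y = ℂᴿ.trans (ℂᴿ.+-cong x≈0 z≈y) (ℂᴿ.+-identityˡ _)

      -- Diagrams of D are peeled off one by one. One that occurs again later changes nothing; a new
      -- `d` contributes `F d` times the total coefficient at `d`, which vanishes.
      weigh-restricted : ∀ u → (∀ d → F d *ᶜ coefficient u d ≈ᶜ 0ᶜ) → ∀ D → weigh (restricted D) u ≈ᶜ 0ᶜ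
      weigh-restricted u vanish []      = weigh-0
        (λ e → ℂᴿ.trans (ℂᴿ.*-congʳ (ℂᴿ.reflexive (χ-false {⊥} id))) (ℂᴿ.zeroˡ (F e))) u
      weigh-restricted u vanish (d ∷ D) with em {Occurs D d}
      ... | yes occ = ℂᴿ.trans
        (weigh-cong (λ e → ℂᴿ.*-congʳ (ℂᴿ.reflexive (χ-cong
          (λ { (inj₁ e≗d) → Occurs-≗ D d e (≗-sym {diagram e} {diagram d} e≗d) occ ; (inj₂ o) → o }) inj₂))) u)
        (weigh-restricted u vanish D)
      ... | no ¬occ = ℂᴿ.trans (weigh-cong split u)
        (ℂᴿ.trans (weigh-+ (λ e → F d *ᶜ χ (diagram e ≗ᴰ diagram d)) (restricted D) u)
          (ℂᴿ.trans (ℂᴿ.+-cong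
              (ℂᴿ.trans (weigh-*ˡ (F d) (λ e → χ (diagram e ≗ᴰ diagram d)) u)
                (ℂᴿ.trans (ℂᴿ.*-congˡ (ℂᴿ.sym (coefficient-weigh u d))) (vanish d)))
              (weigh-restricted u vanish D))
            (ℂᴿ.+-identityˡ 0ᶜ)))
        where
        split : ∀ e → restricted (d ∷ D) e ≈ᶜ F d *ᶜ χ (diagram e ≗ᴰ diagram d) +ᶜ restricted D e
        split e with em {diagram e ≗ᴰ diagram d}
        ... | yes e≗d = ℂᴿ.sym (ℂᴿ.trans
          (ℂᴿ.+-cong
            (ℂᴿ.trans (ℂᴿ.*-identityʳ (F d)) (F-invariant d e (≗-sym {diagram e} {diagram d} e≗d)))
            (ℂᴿ.trans (ℂᴿ.*-congʳ (ℂᴿ.reflexive (χ-false (¬occ ∘ Occurs-≗ D e d e≗d)))) (ℂᴿ.zeroˡ (F e))))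
          (ℂᴿ.trans (ℂᴿ.+-identityʳ (F e)) (ℂᴿ.sym (ℂᴿ.trans
            (ℂᴿ.*-congʳ (ℂᴿ.reflexive (χ-true {Occurs (d ∷ D) e} (inj₁ e≗d)))) (ℂᴿ.*-identityˡ (F e))))))
        ... | no e≇d = ℂᴿ.sym (0*+ (ℂᴿ.zeroʳ (F d)) (ℂᴿ.*-congʳ (ℂᴿ.reflexive (χ-cong
          inj₂ (λ { (inj₁ e≗d) → ⊥-elim (e≇d e≗d) ; (inj₂ o) → o })))))

      weigh-occurring : ∀ u D → (∀ e → Occurs (List.map proj₂ u) e → Occurs D e) →
                        weigh F u ≈ᶜ weigh (restricted D) u
      weigh-occurring []            D incl = ℂᴿ.refl
      weigh-occurring ((c , d) ∷ u) D incl = ℂᴿ.+-cong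
        (ℂᴿ.*-congˡ (ℂᴿ.sym (ℂᴿ.trans
          (ℂᴿ.*-congʳ (ℂᴿ.reflexive (χ-true (incl d (inj₁ (≗-refl (diagram d))))))) (ℂᴿ.*-identityˡ (F d)))))
        (weigh-occurring u D (λ e → incl e ∘ inj₂))

    -- The terms of `u` are grouped by set partition. The hypothesis concerns the product, so
    -- coefficients have to vanish only where F does not; the induction on rank relies on this.
    weigh-vanishes : ∀ u → (∀ d → F d *ᶜ coefficient u d ≈ᶜ 0ᶜ) → weigh F u ≈ᶜ 0ᶜ
    weigh-vanishes u vanish = ℂᴿ.trans (weigh-occurring u (List.map proj₂ u) (λ e → id))
      (weigh-restricted u vanish (List.map proj₂ u))

  _⊖_ : U → U → U
  u ⊖ v = u ++ ((-ᶜ 1ᶜ) •ᵁ v)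

  weigh-⊖ : ∀ F u v → weigh F (u ⊖ v) ≈ᶜ weigh F u +ᶜ (-ᶜ weigh F v)
  weigh-⊖ F u v = ℂᴿ.trans (weigh-++ F u ((-ᶜ 1ᶜ) •ᵁ v)) (ℂᴿ.+-congˡ
    (ℂᴿ.trans (weigh-•ᵁ F (-ᶜ 1ᶜ) v) (RingProperties.-1*x≈-x ℂᴿ.ring (weigh F v))))

  weigh-⊖⇒≈ : ∀ F u v → weigh F (u ⊖ v) ≈ᶜ 0ᶜ → weigh F u ≈ᶜ weigh F v
  weigh-⊖⇒≈ F u v h = RingProperties.x∙y⁻¹≈ε⇒x≈y ℂᴿ.ring (weigh F u) (weigh F v)
    (ℂᴿ.trans (ℂᴿ.sym (weigh-⊖ F u v)) h)

  ≈⇒weigh-⊖ : ∀ F u v → weigh F u ≈ᶜ weigh F v → weigh F (u ⊖ v) ≈ᶜ 0ᶜ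
  ≈⇒weigh-⊖ F u v h = ℂᴿ.trans (weigh-⊖ F u v)
    (ℂᴿ.trans (ℂᴿ.+-congʳ h) (ℂᴿ.-‿inverseʳ (weigh F v)))

  weigh-≈ᵁ : ∀ {F} → Invariant F → ∀ u v → u ≈ᵁ v → weigh F u ≈ᶜ weigh F v
  weigh-≈ᵁ {F} F-inv u v u≈v = weigh-⊖⇒≈ F u v (weigh-vanishes F-inv (u ⊖ v) λ d →
    ℂᴿ.trans (ℂᴿ.*-congˡ (ℂᴿ.trans (coefficient-weigh (u ⊖ v) d)
      (≈⇒weigh-⊖ (λ e → χ (diagram e ≗ᴰ diagram d)) u v
        (ℂᴿ.trans (ℂᴿ.sym (coefficient-weigh u d)) (ℂᴿ.trans (u≈v d) (coefficient-weigh v d))))))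
      (ℂᴿ.zeroʳ (F d)))

  -- The matrix entry of `φ u` in purely combinatorial form, as `φ-entry` confirms: it adds up the
  -- coefficients at the diagrams finer than `kernel 𝐢 𝐣`.
  entry : U → Vec ℕ k → Vec ℕ k → ℂ
  entry u 𝐢 𝐣 = weigh (λ d → χ (Labels (diagram d) 𝐢 𝐣)) u

  Labels-kernel : ∀ {d : Diagram k} {𝐢 𝐣 𝐱 𝐲} → kernel 𝐢 𝐣 ⊑ kernel 𝐱 𝐲 → Labels d 𝐢 𝐣 → Labels d 𝐱 𝐲
  Labels-kernel h (labels t) = labels λ x y → h x y ∘ t x y

  entry-kernel : ∀ u {𝐢 𝐣 𝐱 𝐲} → kernel 𝐢 𝐣 ≗ᴰ kernel 𝐱 𝐲 → entry u 𝐢 𝐣 ≈ᶜ entry u 𝐱 𝐲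
  entry-kernel u {𝐢} {𝐣} {𝐱} {𝐲} h = weigh-cong (λ d → ℂᴿ.reflexive (χ-cong
    (Labels-kernel {𝐢 = 𝐢} {𝐣} {𝐱} {𝐲} (≗⇒⊑ {d = kernel 𝐢 𝐣} {kernel 𝐱 𝐲} h))
    (Labels-kernel {𝐢 = 𝐱} {𝐲} {𝐢} {𝐣} (≗⇒⊒ {d = kernel 𝐢 𝐣} {kernel 𝐱 𝐲} h)))) u

  -- A uniform diagram constant on (𝐢 , 𝐣) refines the kernel and would make it uniform by
  -- `uniform-⊑`.
  entry-nonuniform : ∀ u {𝐢 𝐣} → ¬ IsUniform (kernel 𝐢 𝐣) → entry u 𝐢 𝐣 ≈ᶜ 0ᶜ
  entry-nonuniform u {𝐢} {𝐣} ¬unif = weigh-0 (λ d → ℂᴿ.reflexive (χ-false λ t →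
    ¬unif (uniform-⊑ {d = diagram d} {kernel 𝐢 𝐣} (uniform d) (constant t)))) u

  -- The coefficient at d is the entry at the canonical labelling of d minus
  -- the coefficients at strictly finer diagrams, which have smaller rank.
  zero-entries⇒zero-coefficients : ∀ u → (∀ 𝐢 𝐣 → entry u 𝐢 𝐣 ≈ᶜ 0ᶜ) → ∀ d → coefficient u d ≈ᶜ 0ᶜ
  zero-entries⇒zero-coefficients u zero-entries d = below-rank (suc (rank (diagram d))) d ℕₚ.≤-refl
    where
    Finer : UniformDiagram k → UniformDiagram k → Set
    Finer e d = diagram e ⊑ diagram d × ¬ (diagram e ≗ᴰ diagram d)

    Finer-invariant : ∀ d → Invariant (λ e → χ (Finer e d))
    Finer-invariant d e f e≗f = ℂᴿ.reflexive (χ-cong (resp e f e≗f) (resp f e (≗-sym {diagram e} {diagram f} e≗f)))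
      where
      resp : ∀ e f → diagram e ≗ᴰ diagram f → Finer e d → Finer f d
      resp e f e≗f (e⊑d , e≇d) =
        ⊑-trans {d = diagram f} {diagram e} {diagram d} (≗⇒⊒ {d = diagram e} {diagram f} e≗f) e⊑d ,
        e≇d ∘ ≗-trans {diagram e} {diagram f} {diagram d} e≗f

    Finer⇒rank< : ∀ e d → Finer e d → rank (diagram e) ℕ.< rank (diagram d)
    Finer⇒rank< e d (e⊑d , e≇d) = ℕₚ.≰⇒> λ d≤e → e≇d (⊑-antisym {d = diagram e} {diagram d} e⊑d
      (rank-reflects {d = diagram e} {diagram d} e⊑d d≤e))

    below-rank : ∀ n d → rank (diagram d) ℕ.< n → coefficient u d ≈ᶜ 0ᶜ
    below-rank (suc n) d r<n = ℂᴿ.trans (coefficient-weigh u d)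
      (ℂᴿ.trans (ℂᴿ.sym (ℂᴿ.+-identityʳ _))
        (ℂᴿ.trans (ℂᴿ.+-congˡ (ℂᴿ.sym (weigh-vanishes (Finer-invariant d) u finer-vanish)))
          (ℂᴿ.trans (ℂᴿ.sym (weigh-+ (λ e → χ (diagram e ≗ᴰ diagram d)) (λ e → χ (Finer e d)) u))
            (ℂᴿ.trans (ℂᴿ.sym (weigh-cong split u)) (zero-entries top-d bottom-d)))))
      where
      top-d = canonical-top (diagram d)
      bottom-d = canonical-bottom (diagram d)
      Labels⇒⊑ : ∀ {e} → Labels e top-d bottom-d → e ⊑ diagram d
      Labels⇒⊑ {e} (labels t) = ⊑-trans {d = e} {kernel top-d bottom-d} {diagram d} t
        (≗⇒⊑ {d = kernel top-d bottom-d} {diagram d} (kernel-canonical (diagram d)))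
      ⊑⇒Labels : ∀ {e} → e ⊑ diagram d → Labels e top-d bottom-d
      ⊑⇒Labels {e} e⊑d = labels (⊑-trans {d = e} {diagram d} {kernel top-d bottom-d} e⊑d
        (≗⇒⊒ {d = kernel top-d bottom-d} {diagram d} (kernel-canonical (diagram d))))
      split : ∀ e → χ (Labels (diagram e) top-d bottom-d) ≈ᶜ χ (diagram e ≗ᴰ diagram d) +ᶜ χ (Finer e d)
      split e with em {diagram e ≗ᴰ diagram d}
      ... | yes e≗d = ℂᴿ.trans
        (ℂᴿ.reflexive (χ-true (⊑⇒Labels {diagram e} (≗⇒⊑ {d = diagram e} {diagram d} e≗d))))
        (ℂᴿ.sym (ℂᴿ.trans (ℂᴿ.+-congˡ (ℂᴿ.reflexive (χ-false λ (_ , e≇d) → e≇d e≗d))) (ℂᴿ.+-identityʳ 1ᶜ)))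
      ... | no e≇d = ℂᴿ.trans
        (ℂᴿ.reflexive (χ-cong (λ t → Labels⇒⊑ {diagram e} t , e≇d) (⊑⇒Labels {diagram e} ∘ proj₁)))
        (ℂᴿ.sym (ℂᴿ.+-identityˡ _))
      finer-vanish : ∀ e → χ (Finer e d) *ᶜ coefficient u e ≈ᶜ 0ᶜ
      finer-vanish e with em {Finer e d}
      ... | yes e⊏d = ℂᴿ.trans (ℂᴿ.*-identityˡ _)
        (below-rank n e (ℕₚ.<-≤-trans (Finer⇒rank< e d e⊏d) (ℕ.s≤s⁻¹ r<n)))
      ... | no _    = ℂᴿ.zeroˡ _

  entries-faithful : ∀ u v → (∀ 𝐢 𝐣 → entry u 𝐢 𝐣 ≈ᶜ entry v 𝐢 𝐣) → u ≈ᵁ v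
  entries-faithful u v h d = ℂᴿ.trans (coefficient-weigh u d) (ℂᴿ.trans
    (weigh-⊖⇒≈ (λ e → χ (diagram e ≗ᴰ diagram d)) u v
      (ℂᴿ.trans (ℂᴿ.sym (coefficient-weigh (u ⊖ v) d))
        (zero-entries⇒zero-coefficients (u ⊖ v) (λ 𝐢 𝐣 →
          ≈⇒weigh-⊖ (λ e → χ (Labels (diagram e) 𝐢 𝐣)) u v (h 𝐢 𝐣)) d)))
    (ℂᴿ.sym (coefficient-weigh v d)))

  -- Realising prescribed entries by combinations of diagrams.

  module _
    (a : Vec ℕ k → Vec ℕ k → ℂ)
    (a-kernel : ∀ {𝐢 𝐣 𝐱 𝐲} → kernel 𝐢 𝐣 ≗ᴰ kernel 𝐱 𝐲 → a 𝐢 𝐣 ≈ᶜ a 𝐱 𝐲)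
    (a-nonuniform : ∀ {𝐢 𝐣} → ¬ IsUniform (kernel 𝐢 𝐣) → a 𝐢 𝐣 ≈ᶜ 0ᶜ)
    where

    private
      rk : Vec ℕ k → Vec ℕ k → ℕ
      rk 𝐢 𝐣 = rank (kernel 𝐢 𝐣)

      Correct : U → Vec ℕ k → Vec ℕ k → Set
      Correct u 𝐢 𝐣 = entry u 𝐢 𝐣 ≈ᶜ a 𝐢 𝐣

      Correct-kernel : ∀ u {𝐢 𝐣 𝐱 𝐲} → kernel 𝐢 𝐣 ≗ᴰ kernel 𝐱 𝐲 → Correct u 𝐢 𝐣 → Correct u 𝐱 𝐲
      Correct-kernel u {𝐢} {𝐣} {𝐱} {𝐲} h c = ℂᴿ.trans (ℂᴿ.sym (entry-kernel u {𝐢} {𝐣} {𝐱} {𝐲} h))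
        (ℂᴿ.trans c (a-kernel {𝐢} {𝐣} {𝐱} {𝐲} h))

      correct : U → ∀ 𝐢 𝐣 → IsUniform (kernel 𝐢 𝐣) → U
      correct u 𝐢 𝐣 unif = (a 𝐢 𝐣 +ᶜ (-ᶜ entry u 𝐢 𝐣) , (kernel 𝐢 𝐣 , unif)) ∷ u

      correct-at : ∀ u 𝐢 𝐣 unif → Correct (correct u 𝐢 𝐣 unif) 𝐢 𝐣
      correct-at u 𝐢 𝐣 unif = ℂᴿ.trans
        (ℂᴿ.+-congʳ (ℂᴿ.trans (ℂᴿ.*-congˡ (ℂᴿ.reflexive (χ-true (labels λ x y → id)))) (ℂᴿ.*-identityʳ _)))
        (ℂᴿ.trans (ℂᴿ.+-assoc (a 𝐢 𝐣) (-ᶜ entry u 𝐢 𝐣) (entry u 𝐢 𝐣))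
          (ℂᴿ.trans (ℂᴿ.+-congˡ (ℂᴿ.-‿inverseˡ (entry u 𝐢 𝐣))) (ℂᴿ.+-identityʳ (a 𝐢 𝐣))))

      -- The added diagram affects only kernels coarser than `kernel 𝐢 𝐣`. Among those of no larger
      -- rank there is only that kernel itself, and if its entry was already right, the added
      -- coefficient is 0.
      correct-preserves : ∀ u 𝐢 𝐣 unif 𝐱 𝐲 → rk 𝐱 𝐲 ℕ.≤ rk 𝐢 𝐣 → Correct u 𝐱 𝐲 →
                          Correct (correct u 𝐢 𝐣 unif) 𝐱 𝐲
      correct-preserves u 𝐢 𝐣 unif 𝐱 𝐲 r≤ c = ℂᴿ.trans (ℂᴿ.+-congʳ zero-term)
        (ℂᴿ.trans (ℂᴿ.+-identityˡ (entry u 𝐱 𝐲)) c)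
        where
        zero-term : (a 𝐢 𝐣 +ᶜ (-ᶜ entry u 𝐢 𝐣)) *ᶜ χ (Labels (kernel 𝐢 𝐣) 𝐱 𝐲) ≈ᶜ 0ᶜ
        zero-term with em {Labels (kernel 𝐢 𝐣) 𝐱 𝐲}
        ... | no _         = ℂᴿ.zeroʳ _
        ... | yes (labels t) = ℂᴿ.trans (ℂᴿ.*-identityʳ _)
          (ℂᴿ.trans (ℂᴿ.+-congʳ (ℂᴿ.sym (Correct-kernel u {𝐱} {𝐲} {𝐢} {𝐣} same c)))
            (ℂᴿ.-‿inverseʳ (entry u 𝐢 𝐣)))
          where
          same : kernel 𝐱 𝐲 ≗ᴰ kernel 𝐢 𝐣
          same = ⊑-antisym {d = kernel 𝐱 𝐲} {kernel 𝐢 𝐣}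
            (rank-reflects {d = kernel 𝐢 𝐣} {kernel 𝐱 𝐲} t r≤) t

      CorrectBelow : ℕ → U → Set
      CorrectBelow n u = ∀ 𝐱 𝐲 → rk 𝐱 𝐲 ℕ.< n → Correct u 𝐱 𝐲

      correct-all : ∀ n u → CorrectBelow n u → ∀ (L : List (Vec ℕ k × Vec ℕ k)) → ∃ λ v → CorrectBelow n v ×
        (∀ 𝐱 𝐲 → (𝐱 , 𝐲) ∈ L → rk 𝐱 𝐲 ≡ n → Correct v 𝐱 𝐲)
      correct-all n u below-n [] = u , below-n , λ 𝐱 𝐲 ()
      correct-all n u below-n ((𝐢 , 𝐣) ∷ L) with correct-all n u below-n L | rk 𝐢 𝐣 ≟ n | em {IsUniform (kernel 𝐢 𝐣)}
      ... | v , below-n′ , at-n | no r≢n | _ = v , below-n′ , λ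
        { 𝐱 𝐲 (here ≡.refl) r≡n → ⊥-elim (r≢n r≡n)
        ; 𝐱 𝐲 (there ∈L) r≡n → at-n 𝐱 𝐲 ∈L r≡n }
      -- No uniform diagram is available here, but both the entry and its prescribed value are 0.
      ... | v , below-n′ , at-n | yes _ | no ¬unif = v , below-n′ , λ
        { 𝐱 𝐲 (here ≡.refl) r≡n → ℂᴿ.trans (entry-nonuniform v {𝐱} {𝐲} ¬unif)
            (ℂᴿ.sym (a-nonuniform {𝐱} {𝐲} ¬unif))
        ; 𝐱 𝐲 (there ∈L) r≡n → at-n 𝐱 𝐲 ∈L r≡n }
      ... | v , below-n′ , at-n | yes ≡.refl | yes unif = correct v 𝐢 𝐣 unif ,
        (λ 𝐱 𝐲 r<n → correct-preserves v 𝐢 𝐣 unif 𝐱 𝐲 (ℕₚ.<⇒≤ r<n) (below-n′ 𝐱 𝐲 r<n)) , λ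
        { 𝐱 𝐲 (here ≡.refl) r≡n → correct-at v 𝐱 𝐲 unif
        ; 𝐱 𝐲 (there ∈L) r≡n → correct-preserves v 𝐢 𝐣 unif 𝐱 𝐲 (ℕₚ.≤-reflexive r≡n) (at-n 𝐱 𝐲 ∈L r≡n) }

      -- Level n is settled on the canonical pairs of rank n; any other pair of that rank has the
      -- kernel of a canonical one, and correctness depends on the kernel alone.
      solution-below : ∀ n → ∃ (CorrectBelow n)
      solution-below zero    = [] , λ 𝐱 𝐲 ()
      solution-below (suc n) with solution-below n
      ... | u , below-n with correct-all n u below-n (canonicalPairs k)
      ...   | v , below-n′ , at-n = v , λ 𝐱 𝐲 r<1+n → [ below-n′ 𝐱 𝐲 , at 𝐱 𝐲 ]′ (ℕₚ.m≤n⇒m<n∨m≡n (ℕ.s≤s⁻¹ r<1+n))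
        where
        at : ∀ 𝐱 𝐲 → rk 𝐱 𝐲 ≡ n → Correct v 𝐱 𝐲
        at 𝐱 𝐲 r≡n = Correct-kernel v {top-d} {bottom-d} {𝐱} {𝐲} (kernel-canonical d)
          (at-n top-d bottom-d (canonical∈ d)
            (≡.trans (rank-≗ {kernel top-d bottom-d} {d} (kernel-canonical d)) r≡n))
          where
          d = kernel 𝐱 𝐲
          top-d = canonical-top d
          bottom-d = canonical-bottom d

    -- Ranks are at most `maxRank k`, so finitely many levels exhaust all pairs.
    entries-realised : ∃ λ u → ∀ 𝐢 𝐣 → entry u 𝐢 𝐣 ≈ᶜ a 𝐢 𝐣
    entries-realised with solution-below (suc (maxRank k))
    ... | u , correct-u = u , λ 𝐢 𝐣 → correct-u 𝐢 𝐣 (ℕ.s≤s (rank≤maxRank (kernel 𝐢 𝐣)))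

-- Sums, unit sequences and operators determined by their entries.

module CentralizerEntries (em : ExcludedMiddle 0ℓ) (ℝ : CompleteOrderedField)
  (p : CompleteOrderedField.Carrier ℝ)
  (1≤p : CompleteOrderedField._≤_ ℝ (CompleteOrderedField.1# ℝ) p)
  (μ : ℕ → CompleteOrderedField.Carrier ℝ)
  (0<μ : ∀ i → CompleteOrderedField._<_ ℝ (CompleteOrderedField.0# ℝ) (μ i))
  (k : ℕ)
  where

  open CompleteOrderedField ℝ
  open Classical em ℝ
  open IsTotalOrder isTotalOrder using (total)
    renaming (refl to ≤-refl; reflexive to ≤-reflexive; trans to ≤-trans)
  open NatPowers commutativeSemiring using (_^_; ^-homo-*)
  open RealPowers em ℝ
  open Combinatorics em ℝ
  open DiagramOperators em ℝ
  open LinearCombinations k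
  open Representation p 1≤p μ 0<μ k
  open LᵖSpace p 1≤p μ 0<μ k
  open UniformBlockPermutations k
  open DiagramAlgebra em ℝ k

  decide : (P : Set) → P ⊎ ¬ P
  decide P = toSum em

  ¬-stable : ∀ {P : Set} → ¬ ¬ P → P
  ¬-stable {P} h = [ id , (λ ¬p → ⊥-elim (h ¬p)) ]′ (decide P)

  x+y≤z⇒x≤z-y : ∀ {x y z} → x + y ≤ z → x ≤ z - y
  x+y≤z⇒x≤z-y {x} {y} {z} h = ≤-respˡ
    (trans (+-comm (- y) (x + y)) (trans (+-assoc x y (- y)) (trans (+-congˡ (-‿inverseʳ y)) (+-identityʳ x))))
    (≤-respʳ (+-comm (- y) z) (+-monoʳ-≤ (- y) h))

  x-y+y≈x : ∀ x y → (x - y) + y ≈ x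
  x-y+y≈x x y = trans (+-assoc x (- y) y) (trans (+-congˡ (-‿inverseˡ y)) (+-identityʳ x))

  -- A finite list G for g is merged with F into a list H for f: members of G inside F are dropped,
  -- at no loss since g ≤ 0 there, and the others keep their place since g ≤ f.
  Σ∞-complement : ∀ {I : Set} {f g : I → Carrier} {F} → Unique F → (∀ i → i ∈ F → g i ≤ 0#) → (∀ i → g i ≤ f i) →
                  Summable f → Σ∞ g + Σ[ F ] f ≤ Σ∞ f
  Σ∞-complement {I} {f} {g} {F} F! g≤0 g≤f f-sum = ≤-respʳ (x-y+y≈x (Σ∞ f) s)
    (+-mono-≤ (Σ∞-least outside) (≤-refl {s}))
    where
    s = Σ[ F ] f
    extend : ∀ G → Unique G → ∃ λ H → Unique H × (∀ i → i ∈ H → i ∈ F ⊎ i ∈ G) × Σ[ G ] g + s ≤ Σ[ H ] f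
    extend [] _ = F , F! , (λ i → inj₁) , ≤-reflexive (+-identityˡ s)
    extend (i ∷ G) (i∉G AllPairs.∷ G!) with extend G G! | decide (i ∈ F)
    ... | H , H! , H⊆ , bound | inj₁ i∈F = H , H! , (λ j → [ inj₁ , inj₂ ∘ there ]′ ∘ H⊆ j) ,
      ≤-respˡ (sym (+-assoc (g i) (Σ[ G ] g) s)) (≤-respʳ (+-identityˡ (Σ[ H ] f))
        (+-mono-≤ (g≤0 i i∈F) bound))
    ... | H , H! , H⊆ , bound | inj₂ i∉F = i ∷ H ,
      All.tabulate (λ j∈ → λ { ≡.refl → [ i∉F , (λ i∈G → All.lookup i∉G i∈G ≡.refl) ]′ (H⊆ i j∈) }) AllPairs.∷ H! ,
      (λ { j (here ≡.refl) → inj₂ (here ≡.refl) ; j (there j∈) → [ inj₁ , inj₂ ∘ there ]′ (H⊆ j j∈) }) ,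
      ≤-respˡ (sym (+-assoc (g i) (Σ[ G ] g) s)) (+-mono-≤ (g≤f i) bound)
    outside : ∀ G → Unique G → Σ[ G ] g ≤ Σ∞ f - s
    outside G G! with extend G G!
    ... | H , H! , _ , bound = x+y≤z⇒x≤z-y (≤-trans bound (Σ≤Σ∞ f-sum H H!))

  difference≈0⇒≈ : ∀ z w → z +ᶜ (-ᶜ 1ᶜ) *ᶜ w ≈ᶜ 0ᶜ → z ≈ᶜ w
  difference≈0⇒≈ z w h = RingProperties.x∙y⁻¹≈ε⇒x≈y ℂᴿ.ring z w
    (ℂᴿ.trans (ℂᴿ.+-congˡ (ℂᴿ.sym (RingProperties.-1*x≈-x ℂᴿ.ring w))) h)

  ≈⇒difference≈0 : ∀ z w → z ≈ᶜ w → z +ᶜ (-ᶜ 1ᶜ) *ᶜ w ≈ᶜ 0ᶜ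
  ≈⇒difference≈0 z w h = ℂᴿ.trans (ℂᴿ.+-cong h (RingProperties.-1*x≈-x ℂᴿ.ring w)) (ℂᴿ.-‿inverseʳ w)

  μ≉0 : ∀ i → ¬ (μ i ≈ 0#)
  μ≉0 i e = proj₂ (0<μ i) (sym e)

  μ̂≉0 : ∀ {n} (𝐢 : Vec ℕ n) → ¬ (μ̂ 𝐢 ≈ 0#)
  μ̂≉0 []      e = 0≉1 (sym e)
  μ̂≉0 (i ∷ 𝐢) = *-≉0 (μ≉0 i) (μ̂≉0 𝐢)

  weight≉0 : ∀ 𝐢 → ¬ (μ̂ {k} 𝐢 ** p ≈ 0#)
  weight≉0 𝐢 e = μ̂≉0 𝐢 (≤0⇒≈0 (μ̂-nonneg 𝐢) (**≤0⇒≤0 {p} {0} 0≤p p≥ (μ̂-nonneg 𝐢) (≤-reflexive e)))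

  term-reflects-0 : ∀ {a 𝐢} → term a 𝐢 ≤ 0# → a 𝐢 ≈ᶜ 0ᶜ
  term-reflects-0 {a} {𝐢} h = ∣z∣≤0⇒z≈0 (**≤0⇒≤0 {p} {0} 0≤p p≥ (∣-∣-nonneg (a 𝐢))
    (c*x≤0⇒x≤0 (weight-nonneg 𝐢) (weight≉0 𝐢) (≤-respˡ (*-comm (∣ a 𝐢 ∣ ** p) (μ̂ 𝐢 ** p)) h)))

  term-cong : ∀ {a b 𝐢} → a 𝐢 ≈ᶜ b 𝐢 → term a 𝐢 ≈ term b 𝐢
  term-cong e = *-congʳ (∣∣**p-cong e)

  Σ-nonpositive : ∀ F {f : Vec ℕ k → Carrier} → (∀ 𝐢 → 𝐢 ∈ F → f 𝐢 ≤ 0#) → Σ[ F ] f ≤ 0#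
  Σ-nonpositive []      h = ≤-refl
  Σ-nonpositive (𝐢 ∷ F) h = ≤-respʳ (+-identityˡ 0#)
    (+-mono-≤ (h 𝐢 (here ≡.refl)) (Σ-nonpositive F (λ 𝐣 → h 𝐣 ∘ there)))

  unitSequence : Vec ℕ k → Sequence
  unitSequence 𝐣 𝐢 = χ (𝐢 ≡ 𝐣)

  Σ-unit : ∀ 𝐣 F → Unique F → Σ[ F ] (term (unitSequence 𝐣)) ≤ term (unitSequence 𝐣) 𝐣
  Σ-unit 𝐣 []      _ = term-nonneg (unitSequence 𝐣) 𝐣
  Σ-unit 𝐣 (𝐢 ∷ F) (𝐢∉F AllPairs.∷ F!) with decide (𝐢 ≡ 𝐣)
  ... | inj₁ ≡.refl = ≤-respʳ (+-identityʳ _) (+-monoʳ-≤ _ (Σ-nonpositive F λ 𝐡 𝐡∈ →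
    term-0 {unitSequence 𝐣} {𝐡} (ℂᴿ.reflexive (χ-false λ { ≡.refl → All.lookup 𝐢∉F 𝐡∈ ≡.refl }))))
  ... | inj₂ 𝐢≢𝐣 = ≤-respʳ (+-identityˡ _)
    (+-mono-≤ (term-0 {unitSequence 𝐣} {𝐢} (ℂᴿ.reflexive (χ-false 𝐢≢𝐣))) (Σ-unit 𝐣 F F!))

  opaque
    unit-summable : ∀ 𝐣 → Summable (term (unitSequence 𝐣))
    unit-summable 𝐣 = _ , Σ-unit 𝐣

  unit : Vec ℕ k → Lᵖ
  unit 𝐣 = unitSequence 𝐣 ∈Lᵖ unit-summable 𝐣

  Σ∞-unit : ∀ 𝐣 → Σ∞ (term (unitSequence 𝐣)) ≤ ∣ 1ᶜ ∣ ** p * μ̂ 𝐣 ** p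
  Σ∞-unit 𝐣 = ≤-trans (Σ∞-least (Σ-unit 𝐣))
    (≤-reflexive (*-congʳ (∣∣**p-cong (ℂᴿ.reflexive (χ-true {𝐣 ≡ 𝐣} ≡.refl)))))

  -- The outer exponent 1/p of the norm is removed by `**-cancel-≤`, which turns boundedness into an
  -- estimate between sums of p-th powers.
  Σ∞-bound : ∀ A → ∃ λ K → 0# ≤ K × (∀ v → Σ∞ (term (seq (apply A v))) ≤ K * Σ∞ (term (seq v)))
  Σ∞-bound A = from-norm (bounded A)
    where
    N = proj₁ (archimedean p)
    1/p≥ : recip p ≥1/ N
    -- With an integer N ≥ p one has 1/p ≥ 1/(1 + N).
    1/p≥ = ≤-respˡ (trans (*-comm (recip p) p) (recip-inverse (1≤x⇒x≉0 1≤p)))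
      (*-monoˡ-≤ 0≤1/p (≤-trans (proj₂ (archimedean p)) (ι-mono (ℕₚ.n≤1+n N))))
    from-norm : IsBounded (apply A) → ∃ λ K → 0# ≤ K × (∀ v → Σ∞ (term (seq (apply A v))) ≤ K * Σ∞ (term (seq v)))
    from-norm (C , 0≤C , h) = from-cancel (**-cancel-≤ {recip p} {N} 0≤1/p 1/p≥ 0≤C)
      where
      from-cancel : (∃ λ K → 0# ≤ K × (∀ {x y} → 0# ≤ x → 0# ≤ y → x ** recip p ≤ C * y ** recip p → x ≤ K * y)) →
                    ∃ λ K → 0# ≤ K × (∀ v → Σ∞ (term (seq (apply A v))) ≤ K * Σ∞ (term (seq v)))
      from-cancel (K , 0≤K , cancel) = K , 0≤K , λ v →
        cancel (Σ∞-nonneg (summable (apply A v))) (Σ∞-nonneg (summable v)) (h v)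

  term≤Σ∞ : ∀ {a} → Summable (term a) → ∀ 𝐢 → term a 𝐢 ≤ Σ∞ (term a)
  term≤Σ∞ sa 𝐢 = ≤-respˡ (+-identityʳ _) (Σ≤Σ∞ sa (𝐢 ∷ []) (All.[] AllPairs.∷ AllPairs.[]))

  infix 10 _⟨_,_⟩
  _⟨_,_⟩ : BoundedOperator → Vec ℕ k → Vec ℕ k → ℂ
  A ⟨ 𝐢 , 𝐣 ⟩ = seq (apply A (unit 𝐣)) 𝐢

  delete : Vec ℕ k → Sequence → Sequence
  delete 𝐣 a 𝐢 = (1ᶜ +ᶜ (-ᶜ χ (𝐢 ≡ 𝐣))) *ᶜ a 𝐢

  delete-same : ∀ 𝐣 a → delete 𝐣 a 𝐣 ≈ᶜ 0ᶜ
  delete-same 𝐣 a = ℂᴿ.trans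
    (ℂᴿ.*-congʳ (ℂᴿ.trans (ℂᴿ.+-congˡ (ℂᴿ.-‿cong (ℂᴿ.reflexive (χ-true {𝐣 ≡ 𝐣} ≡.refl)))) (ℂᴿ.-‿inverseʳ 1ᶜ)))
    (ℂᴿ.zeroˡ (a 𝐣))

  delete-other : ∀ {𝐢 𝐣} a → 𝐢 ≢ 𝐣 → delete 𝐣 a 𝐢 ≈ᶜ a 𝐢
  delete-other {𝐢} {𝐣} a 𝐢≢𝐣 = ℂᴿ.trans
    (ℂᴿ.*-congʳ (ℂᴿ.trans (ℂᴿ.+-congˡ (ℂᴿ.trans (ℂᴿ.-‿cong (ℂᴿ.reflexive (χ-false 𝐢≢𝐣)))
      (RingProperties.-0#≈0# ℂᴿ.ring))) (ℂᴿ.+-identityʳ 1ᶜ)))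
    (ℂᴿ.*-identityˡ (a 𝐢))

  deleteAll : List (Vec ℕ k) → Sequence → Sequence
  deleteAll []      a = a
  deleteAll (𝐣 ∷ F) a = delete 𝐣 (deleteAll F a)

  term-delete : ∀ 𝐣 a 𝐢 → term (delete 𝐣 a) 𝐢 ≤ term a 𝐢
  term-delete 𝐣 a 𝐢 with decide (𝐢 ≡ 𝐣)
  ... | inj₁ ≡.refl = ≤-trans (term-0 {delete 𝐣 a} {𝐣} (delete-same 𝐣 a)) (term-nonneg a 𝐣)
  ... | inj₂ 𝐢≢𝐣    = ≤-reflexive (term-cong {delete 𝐣 a} {a} {𝐢} (delete-other a 𝐢≢𝐣))

  term-deleteAll : ∀ F a 𝐢 → term (deleteAll F a) 𝐢 ≤ term a 𝐢
  term-deleteAll []      a 𝐢 = ≤-refl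
  term-deleteAll (𝐣 ∷ F) a 𝐢 = ≤-trans (term-delete 𝐣 (deleteAll F a) 𝐢) (term-deleteAll F a 𝐢)

  term-deleteAll-∈ : ∀ {F 𝐢} a → 𝐢 ∈ F → term (deleteAll F a) 𝐢 ≤ 0#
  term-deleteAll-∈ {𝐣 ∷ F} {𝐢} a (here ≡.refl) =
    term-0 {deleteAll (𝐣 ∷ F) a} {𝐣} (delete-same 𝐣 (deleteAll F a))
  term-deleteAll-∈ {𝐣 ∷ F} {𝐢} a (there 𝐢∈)    =
    ≤-trans (term-delete 𝐣 (deleteAll F a) 𝐢) (term-deleteAll-∈ {F} {𝐢} a 𝐢∈)

  opaque
    deleteAll-summable : ∀ F {a} → Summable (term a) → Summable (term (deleteAll F a))
    deleteAll-summable F {a} (B , bound) = B , λ G G! → ≤-trans (Σ-mono-≤ G (term-deleteAll F a)) (bound G G!)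

  -- The part of v off F, that is, the tail. An operator with zero entries takes the same values on
  -- v and on each of its tails.
  truncate : List (Vec ℕ k) → Lᵖ → Lᵖ
  truncate F v = deleteAll F (seq v) ∈Lᵖ deleteAll-summable F (summable v)

  Σ∞-truncate : ∀ v F → Unique F → Σ∞ (term (seq (truncate F v))) + Σ[ F ] (term (seq v)) ≤ Σ∞ (term (seq v))
  Σ∞-truncate v F F! = Σ∞-complement {f = term (seq v)} {term (deleteAll F (seq v))} F!
    (λ 𝐢 → term-deleteAll-∈ {F} {𝐢} (seq v)) (term-deleteAll F (seq v)) (summable v)

  -- Finitely supported sequences, on which the operator vanishes, are dense.
  zero-entries⇒zero : ∀ A → (∀ 𝐢 𝐣 → A ⟨ 𝐢 , 𝐣 ⟩ ≈ᶜ 0ᶜ) → ∀ v 𝐢 → seq (apply A v) 𝐢 ≈ᶜ 0ᶜ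
  zero-entries⇒zero A zero-entries v 𝐢 = term-reflects-0 {seq (apply A v)} {𝐢} (vanishing (Σ∞-bound A))
    where
    a = seq v
    t = term (seq (apply A v)) 𝐢
    S = Σ∞ (term a)

    -- Deleting one more coordinate subtracts a multiple of `unit 𝐣`, whose image vanishes at 𝐢.
    remove : ∀ 𝐣 F → seq (apply A (truncate F v)) 𝐢 ≈ᶜ seq (apply A (truncate (𝐣 ∷ F) v)) 𝐢
    remove 𝐣 F = ℂᴿ.trans (cong A {truncate F v} {truncate (𝐣 ∷ F) v +ᴸ (c •ᴸ unit 𝐣)} pieces 𝐢)
      (ℂᴿ.trans (additive A (truncate (𝐣 ∷ F) v) (c •ᴸ unit 𝐣) 𝐢)
        (ℂᴿ.trans (ℂᴿ.+-congˡ (ℂᴿ.trans (homogeneous A c (unit 𝐣) 𝐢)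
          (ℂᴿ.trans (ℂᴿ.*-congˡ (zero-entries 𝐢 𝐣)) (ℂᴿ.zeroʳ c)))) (ℂᴿ.+-identityʳ _)))
      where
      b = deleteAll F a
      c = b 𝐣
      pieces : ∀ 𝐡 → b 𝐡 ≈ᶜ delete 𝐣 b 𝐡 +ᶜ c *ᶜ χ (𝐡 ≡ 𝐣)
      pieces 𝐡 with decide (𝐡 ≡ 𝐣)
      ... | inj₁ ≡.refl = ℂᴿ.sym (ℂᴿ.trans (ℂᴿ.+-cong (delete-same 𝐣 b)
          (ℂᴿ.trans (ℂᴿ.*-congˡ (ℂᴿ.reflexive (χ-true {𝐣 ≡ 𝐣} ≡.refl))) (ℂᴿ.*-identityʳ c))) (ℂᴿ.+-identityˡ c))
      ... | inj₂ 𝐡≢𝐣 = ℂᴿ.sym (ℂᴿ.trans (ℂᴿ.+-cong (delete-other b 𝐡≢𝐣)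
          (ℂᴿ.trans (ℂᴿ.*-congˡ (ℂᴿ.reflexive (χ-false 𝐡≢𝐣))) (ℂᴿ.zeroʳ c))) (ℂᴿ.+-identityʳ (b 𝐡)))

    removeAll : ∀ F → seq (apply A v) 𝐢 ≈ᶜ seq (apply A (truncate F v)) 𝐢
    removeAll []      = cong A (λ 𝐣 → ℂᴿ.refl) 𝐢
    removeAll (𝐣 ∷ F) = ℂᴿ.trans (removeAll F) (remove 𝐣 F)

    vanishing : (∃ λ K → 0# ≤ K × (∀ v → Σ∞ (term (seq (apply A v))) ≤ K * Σ∞ (term (seq v)))) → t ≤ 0#
    vanishing (K , 0≤K , bound) = ≤-respˡ (L*r*x≈x t) (x≤0⇒c*x≤0 0≤L r*t≤0)
      where
      -- K may be 0, so the bound is enlarged to an invertible constant.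
      L = 1# + K
      r = recip L
      0≤L = 0≤1+x 0≤K
      0≤r = recip-nonneg 0≤L
      L≉0 = 1≤x⇒x≉0 (x≤x+y 1# 0≤K)
      L*r*x≈x : ∀ x → L * (r * x) ≈ x
      L*r*x≈x x = trans (sym (*-assoc L r x)) (trans (*-congʳ (recip-inverse L≉0)) (*-identityˡ x))
      r*L*x≈x : ∀ x → r * (L * x) ≈ x
      r*L*x≈x x = trans (sym (*-assoc r L x))
        (trans (*-congʳ (trans (*-comm r L) (recip-inverse L≉0))) (*-identityˡ x))
      tail : ∀ F → r * t ≤ Σ∞ (term (seq (truncate F v)))
      tail F = ≤-respʳ (r*L*x≈x T) (*-monoˡ-≤ 0≤r
        (≤-trans (≤-reflexive (term-cong {seq (apply A v)} {seq (apply A (truncate F v))} {𝐢} (removeAll F)))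
          (≤-trans (term≤Σ∞ (summable (apply A (truncate F v))) 𝐢)
            (≤-trans (bound (truncate F v)) (*-monoʳ-≤ (Σ∞-nonneg (summable (truncate F v))) (y≤x+y K 0≤1))))))
        where T = Σ∞ (term (seq (truncate F v)))
      -- Each finite partial sum leaves a tail of at least r * t, so S - r * t still bounds all
      -- partial sums of which S is the supremum.
      S≤S-rt : S ≤ S - r * t
      S≤S-rt = Σ∞-least λ F F! → x+y≤z⇒x≤z-y (≤-respˡ (+-comm (r * t) (Σ[ F ] (term a)))
        (≤-trans (+-mono-≤ (tail F) ≤-refl) (Σ∞-truncate v F F!)))
      r*t≤0 : r * t ≤ 0#
      r*t≤0 = x+y≤x⇒y≤0 {S} (≤-respʳ (x-y+y≈x S (r * t))
        (+-mono-≤ S≤S-rt (≤-refl {r * t})))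

  transport-unit : ∀ d 𝐢 𝐣 → transport d (unitSequence 𝐣) 𝐢 ≡ χ (Labels (diagram d) 𝐢 𝐣)
  transport-unit d 𝐢 𝐣 with target d 𝐢
  ... | inj₁ (𝐡 , t) = ≡.trans (transport-hit d (unitSequence 𝐣) t)
    (χ-cong (λ { ≡.refl → t }) (bottom-unique (uniform d) t))
  ... | inj₂ ¬t      = ≡.trans (transport-miss d (unitSequence 𝐣) ¬t)
    (≡.sym (χ-false λ t → ¬t (𝐣 , t)))

  φ-entry : ∀ u 𝐢 𝐣 → operator (φ u) ⟨ 𝐢 , 𝐣 ⟩ ≈ᶜ entry u 𝐢 𝐣
  φ-entry u 𝐢 𝐣 = ℂᴿ.trans (φ-apply u (unit 𝐣) 𝐢)
    (weigh-cong (λ d → ℂᴿ.reflexive (transport-unit d 𝐢 𝐣)) u)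

  -- Entries of an operator that commutes with permutations.

  module _ (A : Centralizer) where

    private
      O = operator A

    -- σ carries `unit 𝐣` to the unit sequence at σ(𝐣), and commuting with σ moves the row index
    -- along.
    entry-orbit : ∀ σ 𝐢 𝐣 → O ⟨ 𝐢 , 𝐣 ⟩ ≈ᶜ O ⟨ Vec.map (S∞.to σ) 𝐢 , Vec.map (S∞.to σ) 𝐣 ⟩
    entry-orbit σ 𝐢 𝐣 = ℂᴿ.trans
      (ℂᴿ.reflexive (≡.cong (seq (apply O (unit 𝐣))) (≡.sym (map-inverse (S∞.from∘to σ) 𝐢))))
      (ℂᴿ.trans (commutes A σ (unit 𝐣) (Vec.map (S∞.to σ) 𝐢))
        (cong O {act σ (unit 𝐣)} {unit (Vec.map (S∞.to σ) 𝐣)} moved (Vec.map (S∞.to σ) 𝐢)))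
      where
      moved : ∀ 𝐡 → χ (Vec.map (S∞.from σ) 𝐡 ≡ 𝐣) ≈ᶜ χ (𝐡 ≡ Vec.map (S∞.to σ) 𝐣)
      moved 𝐡 = ℂᴿ.reflexive (χ-cong
        (λ e → ≡.trans (≡.sym (map-inverse (S∞.to∘from σ) 𝐡)) (≡.cong (Vec.map (S∞.to σ)) e))
        (λ e → ≡.trans (≡.cong (Vec.map (S∞.from σ)) e) (map-inverse (S∞.from∘to σ) 𝐣)))

    centralizer-entry-kernel : ∀ {𝐢 𝐣 𝐱 𝐲} → kernel 𝐢 𝐣 ≗ᴰ kernel 𝐱 𝐲 → O ⟨ 𝐢 , 𝐣 ⟩ ≈ᶜ O ⟨ 𝐱 , 𝐲 ⟩
    centralizer-entry-kernel {𝐢} {𝐣} {𝐱} {𝐲} h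
      with equal-kernels⇒conjugate (label 𝐢 𝐣) (label 𝐱 𝐲) h (vertices k)
    ... | σ , agrees = ℂᴿ.trans (entry-orbit σ 𝐢 𝐣)
      (ℂᴿ.reflexive (≡.cong₂ (O ⟨_,_⟩)
        (lookup-ext λ l → ≡.trans (Vecₚ.lookup-map l (S∞.to σ) 𝐢) (agrees (inj₁ l) (∈-vertices (inj₁ l))))
        (lookup-ext λ l → ≡.trans (Vecₚ.lookup-map l (S∞.to σ) 𝐣) (agrees (inj₂ l) (∈-vertices (inj₂ l))))))

    -- The entry keeps its value z along the orbit, and a single term of the image of a unit
    -- sequence is at most its whole sum. So α * μ̂ (σ𝐢) ** p ≤ K * β * μ̂ (σ𝐣) ** p with α, β the
    -- p-th powers of the absolute values of z and 1, and K independent of σ; dividing by α and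
    -- cancelling the exponent gives the bound.
    μ̂-orbit-bound : ∀ {𝐢 𝐣} → ¬ (O ⟨ 𝐢 , 𝐣 ⟩ ≈ᶜ 0ᶜ) →
      ∃ λ K → 0# ≤ K × (∀ σ → μ̂ (Vec.map (S∞.to σ) 𝐢) ≤ K * μ̂ (Vec.map (S∞.to σ) 𝐣))
    μ̂-orbit-bound {𝐢} {𝐣} z≉0 = from-Σ∞ (Σ∞-bound O)
      where
      z = O ⟨ 𝐢 , 𝐣 ⟩
      α = ∣ z ∣ ** p
      0≤α = ∣∣**p-nonneg z
      α≉0 : ¬ (α ≈ 0#)
      α≉0 e = z≉0 (∣z∣≤0⇒z≈0 (**≤0⇒≤0 {p} {0} 0≤p p≥ (∣-∣-nonneg z) (≤-reflexive e)))
      β = ∣ 1ᶜ ∣ ** p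
      from-Σ∞ : (∃ λ K → 0# ≤ K × (∀ v → Σ∞ (term (seq (apply O v))) ≤ K * Σ∞ (term (seq v)))) →
        ∃ λ K → 0# ≤ K × (∀ σ → μ̂ (Vec.map (S∞.to σ) 𝐢) ≤ K * μ̂ (Vec.map (S∞.to σ) 𝐣))
      from-Σ∞ (K , 0≤K , bound) = from-cancel (**-cancel-≤ {p} {0} 0≤p p≥ 0≤C)
        where
        C = recip α * (K * β)
        0≤C = *-nonneg (recip-nonneg 0≤α) (*-nonneg 0≤K (∣∣**p-nonneg 1ᶜ))
        weights : ∀ σ → μ̂ (Vec.map (S∞.to σ) 𝐢) ** p ≤ C * μ̂ (Vec.map (S∞.to σ) 𝐣) ** p
        weights σ = *-cancelˡ-≤ 0≤α α≉0 (≤-trans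
          (≤-reflexive (*-congʳ (∣∣**p-cong (entry-orbit σ 𝐢 𝐣))))
          (≤-trans (term≤Σ∞ (summable (apply O (unit σ𝐣))) σ𝐢)
            (≤-trans (bound (unit σ𝐣)) (≤-trans (*-monoˡ-≤ 0≤K (Σ∞-unit σ𝐣)) (≤-reflexive rearrange)))))
          where
          σ𝐢 = Vec.map (S∞.to σ) 𝐢
          σ𝐣 = Vec.map (S∞.to σ) 𝐣
          w = μ̂ σ𝐣 ** p
          rearrange : K * (β * w) ≈ α * (C * w)
          rearrange = sym (trans (sym (*-assoc α C w)) (trans (*-congʳ
            (trans (sym (*-assoc α (recip α) (K * β)))
              (trans (*-congʳ (recip-inverse α≉0)) (*-identityˡ (K * β))))) (*-assoc K β w)))
        from-cancel : (∃ λ K′ → 0# ≤ K′ × (∀ {x y} → 0# ≤ x → 0# ≤ y → x ** p ≤ C * y ** p → x ≤ K′ * y)) →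
          ∃ λ K → 0# ≤ K × (∀ σ → μ̂ (Vec.map (S∞.to σ) 𝐢) ≤ K * μ̂ (Vec.map (S∞.to σ) 𝐣))
        from-cancel (K′ , 0≤K′ , cancel) = K′ , 0≤K′ , λ σ →
          cancel (μ̂-nonneg (Vec.map (S∞.to σ) 𝐢)) (μ̂-nonneg (Vec.map (S∞.to σ) 𝐣)) (weights σ)

  -- Decay of the weights and vanishing of the entries at other kernels.

  module _ (μ-summable : Summable (λ i → μ i ** p)) where

    -- Otherwise all weights from m on exceed η, and M of them already have p-th powers adding up to
    -- M * δ ≥ B + 1, beyond the bound B on finite sums.
    μ-small : ∀ {η} → 0# ≤ η → ¬ (η ≈ 0#) → ∀ m → ∃ λ N → m ℕ.≤ N × μ N ≤ η
    μ-small {η} 0≤η η≉0 m = ¬-stable λ ¬small → ¬1≤0 (x+y≤x⇒y≤0 {B} (≤-trans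
      (≤-respˡ (δ*r*x≈x (B + 1#)) (≤-respʳ (*-comm δ (ι M)) (*-monoˡ-≤ 0≤δ (proj₂ (archimedean (recip δ * (B + 1#)))))))
      (≤-trans (many (m ℕ.+_) M (λ i → large ¬small (m ℕ.+ i) (ℕₚ.m≤m+n m i)))
        (proj₂ μ-summable (applyUpTo (m ℕ.+_) M)
          (Unique.applyUpTo⁺₁ (m ℕ.+_) M λ i<j _ e → ℕₚ.<⇒≢ i<j (ℕₚ.+-cancelˡ-≡ m _ _ e))))))
      where
      B = proj₁ μ-summable
      δ = η ** p
      0≤δ = **-nonneg 0≤η 0≤p
      δ≉0 : ¬ (δ ≈ 0#)
      δ≉0 e = η≉0 (≤0⇒≈0 0≤η (**≤0⇒≤0 {p} {0} 0≤p p≥ 0≤η (≤-reflexive e)))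
      δ*r*x≈x : ∀ x → δ * (recip δ * x) ≈ x
      δ*r*x≈x x = trans (sym (*-assoc δ (recip δ) x)) (trans (*-congʳ (recip-inverse δ≉0)) (*-identityˡ x))
      M = proj₁ (archimedean (recip δ * (B + 1#)))
      large : ¬ (∃ λ N → m ℕ.≤ N × μ N ≤ η) → ∀ N → m ℕ.≤ N → δ ≤ μ N ** p
      large ¬small N m≤N with total η (μ N)
      ... | inj₁ η≤μ = **-mono-≤ 0≤p 0≤η η≤μ
      ... | inj₂ μ≤η = ⊥-elim (¬small (N , m≤N , μ≤η))
      many : ∀ f n → (∀ i → δ ≤ μ (f i) ** p) → ι n * δ ≤ Σ[ applyUpTo f n ] (λ i → μ i ** p)
      many f zero    h = ≤-reflexive (zeroˡ δ)
      many f (suc n) h = ≤-respˡ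
        (sym (trans (distribʳ δ 1# (ι n)) (+-congʳ (*-identityˡ δ))))
        (+-mono-≤ (h 0) (many (f ∘ suc) n (h ∘ suc)))

    private
      factor : ℕ → ℕ → Carrier
      factor n i with i ≟ n
      ... | yes _ = 1#
      ... | no _  = μ i

      -- The part of `μ̂ 𝐢` that stays fixed when the value n is moved elsewhere.
      rest : ∀ {m} → ℕ → Vec ℕ m → Carrier
      rest n []      = 1#
      rest n (i ∷ 𝐢) = factor n i * rest n 𝐢

      factor-nonneg : ∀ n i → 0# ≤ factor n i
      factor-nonneg n i with i ≟ n
      ... | yes _ = 0≤1
      ... | no _  = proj₁ (0<μ i)

      factor≉0 : ∀ n i → ¬ (factor n i ≈ 0#)
      factor≉0 n i with i ≟ n
      ... | yes _ = 0≉1 ∘ sym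
      ... | no _  = μ≉0 i

      rest-nonneg : ∀ {m} n (𝐢 : Vec ℕ m) → 0# ≤ rest n 𝐢
      rest-nonneg n []      = 0≤1
      rest-nonneg n (i ∷ 𝐢) = *-nonneg (factor-nonneg n i) (rest-nonneg n 𝐢)

      rest≉0 : ∀ {m} n (𝐢 : Vec ℕ m) → ¬ (rest n 𝐢 ≈ 0#)
      rest≉0 n []      = 0≉1 ∘ sym
      rest≉0 n (i ∷ 𝐢) = *-≉0 (factor≉0 n i) (rest≉0 n 𝐢)

      factor-transpose : ∀ n N i → i ≢ N → μ (transpose n N i) ≈ μ N ^ occurrences n (i ∷ []) * factor n i
      factor-transpose n N i i≢N with i ≟ n
      ... | yes ≡.refl = trans (trans (sym (*-identityʳ (μ N))) (sym (*-identityʳ (μ N * 1#))))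
        (*-congʳ (reflexive (≡.cong (μ N ^_) (≡.sym (≡.cong List.length (Listₚ.filter-accept (_≟ n) {n} {[]} ≡.refl))))))
      ... | no i≢n with i ≟ N
      ...   | yes i≡N = ⊥-elim (i≢N i≡N)
      ...   | no _    = trans (sym (*-identityˡ (μ i)))
        (*-congʳ (reflexive (≡.cong (μ N ^_) (≡.sym (≡.cong List.length (Listₚ.filter-reject (_≟ n) {i} {[]} i≢n))))))

      -- Since N is absent from 𝐢, the transposition only renames n to N, and each occurrence of n
      -- turns into a factor μ N.
      μ̂-transpose : ∀ {m} n N (𝐢 : Vec ℕ m) → ¬ (N ∈ toList 𝐢) →
        μ̂ (Vec.map (transpose n N) 𝐢) ≈ μ N ^ occurrences n (toList 𝐢) * rest n 𝐢
      μ̂-transpose n N []      N∉ = sym (*-identityˡ 1#)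
      μ̂-transpose n N (i ∷ 𝐢) N∉ = trans
        (*-cong (factor-transpose n N i (λ { ≡.refl → N∉ (here ≡.refl) })) (μ̂-transpose n N 𝐢 (N∉ ∘ there)))
        (trans (solve 4 (λ a b c d → (a :* b) :* (c :* d) := (a :* c) :* (b :* d)) refl
            (μ N ^ s) (factor n i) (μ N ^ t) (rest n 𝐢))
          (*-congʳ (trans (sym (^-homo-* (μ N) s t))
            (reflexive (≡.cong (μ N ^_) (≡.sym (occurrences-∷ n i (toList 𝐢))))))))
        where
        open Solver
        s = occurrences n (i ∷ [])
        t = occurrences n (toList 𝐢)

    fresh-above : ∀ xs → ∃ λ m → ∀ x → x ∈ xs → x ℕ.< m
    fresh-above []       = 0 , λ x ()
    fresh-above (y ∷ xs) with fresh-above xs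
    ... | m , h = suc y ℕ.+ m , λ
      { x (here ≡.refl) → ℕₚ.m≤m+n (suc x) m
      ; x (there x∈) → ℕₚ.≤-trans (h x x∈) (ℕₚ.m≤n+m m (suc y)) }

    -- Moving the value n to N multiplies the two sides by powers of μ N,
    -- which tends to 0 as N grows.
    orbit-bound⇒occurrences-≤ : ∀ {𝐢 𝐣 : Vec ℕ k} {K} → 0# ≤ K →
      (∀ σ → μ̂ (Vec.map (S∞.to σ) 𝐢) ≤ K * μ̂ (Vec.map (S∞.to σ) 𝐣)) →
      ∀ n → occurrences n (toList 𝐣) ℕ.≤ occurrences n (toList 𝐢)
    orbit-bound⇒occurrences-≤ {𝐢} {𝐣} {K} 0≤K bound n = ℕₚ.≮⇒≥ impossible
      where
      s = occurrences n (toList 𝐢)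
      t = occurrences n (toList 𝐣)
      R = rest n 𝐢
      C = K * rest n 𝐣
      0≤R = rest-nonneg n 𝐢
      0≤C = *-nonneg 0≤K (rest-nonneg n 𝐣)
      -- η is chosen with Q * η = R. Then η ≤ 1, and R = C * η + (η + R * η) contradicts R ≤ C * η
      -- because η is positive.
      Q = (1# + C) + R
      Q≉0 : ¬ (Q ≈ 0#)
      Q≉0 = 1≤x⇒x≉0 (≤-trans (x≤x+y 1# 0≤C) (x≤x+y (1# + C) 0≤R))
      0≤Q = +-nonneg (0≤1+x 0≤C) 0≤R
      η = recip Q * R
      0≤η = *-nonneg (recip-nonneg 0≤Q) 0≤R
      Qη≈R : Q * η ≈ R
      Qη≈R = trans (sym (*-assoc Q (recip Q) R)) (trans (*-congʳ (recip-inverse Q≉0)) (*-identityˡ R))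
      η≉0 : ¬ (η ≈ 0#)
      η≉0 e = rest≉0 n 𝐢 (trans (sym Qη≈R) (trans (*-congˡ e) (zeroʳ Q)))
      η≤1 : η ≤ 1#
      η≤1 = *-cancelˡ-≤ 0≤Q Q≉0 (≤-respˡ (sym Qη≈R) (≤-respʳ (sym (*-identityʳ Q)) (y≤x+y R (0≤1+x 0≤C))))

      above-all = fresh-above (toList 𝐢 ++ toList 𝐣)
      m = proj₁ above-all
      small = μ-small 0≤η η≉0 m
      N = proj₁ small
      N∉ : ∀ xs → (∀ x → x ∈ xs → x ℕ.< m) → ¬ (N ∈ xs)
      N∉ xs h N∈ = ℕₚ.<-irrefl ≡.refl (ℕₚ.<-≤-trans (h N N∈) (proj₁ (proj₂ small)))
      N∉𝐢 = N∉ (toList 𝐢) (λ x → proj₂ above-all x ∘ ∈-++⁺ˡ)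
      N∉𝐣 = N∉ (toList 𝐣) (λ x → proj₂ above-all x ∘ ∈-++⁺ʳ (toList 𝐢))
      μN≤η = proj₂ (proj₂ small)
      0≤μN = proj₁ (0<μ N)

      impossible : ¬ (s ℕ.< t)
      impossible s<t = η≉0 (≤0⇒≈0 0≤η (≤-trans (x≤x+y η (*-nonneg 0≤R 0≤η)) (x+y≤x⇒y≤0 {C * η} (≤-respˡ expand R≤Cη))))
        where
        expand : R ≈ C * η + (η + R * η)
        expand = trans (sym Qη≈R) (solve 3 (λ c r e → ((con 1 :+ c) :+ r) :* e := c :* e :+ (e :+ r :* e)) refl C R η)
          where open Solver
        moved : μ N ^ s * R ≤ K * (μ N ^ t * rest n 𝐣)
        moved = ≤-respˡ (μ̂-transpose n N 𝐢 N∉𝐢) (≤-respʳ (*-congˡ (μ̂-transpose n N 𝐣 N∉𝐣))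
          (bound (transposition n N)))
        -- As s < t and μ N ≤ 1, at least one factor μ N ≤ η is left over beyond μ N ^ s.
        power : μ N ^ t ≤ μ N ^ s * η
        power = ≤-trans (^-antiʳ-≤ 0≤μN (≤-trans μN≤η η≤1) s<t)
          (≤-respˡ (*-comm (μ N ^ s) (μ N)) (*-monoˡ-≤ (^-nonneg s 0≤μN) μN≤η))
        R≤Cη : R ≤ C * η
        R≤Cη = *-cancelˡ-≤ (^-nonneg s 0≤μN) (^-≉0 s (μ≉0 N)) (≤-trans moved (≤-trans
          (*-monoˡ-≤ 0≤K (*-monoʳ-≤ (rest-nonneg n 𝐣) power))
          (≤-reflexive (solve 4 (λ k x e r → k :* ((x :* e) :* r) := x :* ((k :* r) :* e)) refl
            K (μ N ^ s) η (rest n 𝐣)))))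
          where open Solver

    -- A nonzero entry bounds the multiplicities in 𝐣 by those in 𝐢; both tuples have length k, so
    -- they are rearrangements of each other and their kernel is uniform.
    centralizer-entry-nonuniform : ∀ A {𝐢 𝐣} → ¬ IsUniform (kernel 𝐢 𝐣) → operator A ⟨ 𝐢 , 𝐣 ⟩ ≈ᶜ 0ᶜ
    centralizer-entry-nonuniform A {𝐢} {𝐣} ¬unif = ¬-stable λ z≉0 → ¬unif (kernel-uniform {𝐢 = 𝐢} {𝐣} (same z≉0))
      where
      same : ¬ (operator A ⟨ 𝐢 , 𝐣 ⟩ ≈ᶜ 0ᶜ) → toList 𝐢 ↭ toList 𝐣
      same z≉0 = occurrences-≤⇒↭ (toList 𝐢) (toList 𝐣)
        (≡.trans (Vecₚ.length-toList 𝐢) (≡.sym (Vecₚ.length-toList 𝐣)))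
        (orbit-bound⇒occurrences-≤ {𝐢} {𝐣} {proj₁ orbit} (proj₁ (proj₂ orbit)) (proj₂ (proj₂ orbit)))
        where
        orbit = μ̂-orbit-bound A {𝐢} {𝐣} z≉0

    -- The entries of A satisfy both hypotheses of `entries-realised`. Subtracting the resulting
    -- `φ u` leaves a bounded operator with zero entries, which vanishes.
    φ-surjective : ∀ A → ∃ λ u → φ u ≈ᶻ A
    φ-surjective A = u , λ v 𝐢 → ℂᴿ.sym (difference≈0⇒≈ (seq (apply (operator A) v) 𝐢) (seq (apply (operator (φ u)) v) 𝐢)
      (zero-entries⇒zero difference entries-vanish v 𝐢))
      where
      realised : ∃ λ u → ∀ 𝐢 𝐣 → entry u 𝐢 𝐣 ≈ᶜ operator A ⟨ 𝐢 , 𝐣 ⟩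
      realised = entries-realised (λ 𝐢 𝐣 → operator A ⟨ 𝐢 , 𝐣 ⟩)
        (λ {𝐢} {𝐣} {𝐱} {𝐲} → centralizer-entry-kernel A {𝐢} {𝐣} {𝐱} {𝐲})
        (λ {𝐢} {𝐣} → centralizer-entry-nonuniform A {𝐢} {𝐣})
      u = proj₁ realised
      difference : BoundedOperator
      difference = operator A +ᴮ ((-ᶜ 1ᶜ) •ᴮ operator (φ u))
      entries-vanish : ∀ 𝐢 𝐣 → difference ⟨ 𝐢 , 𝐣 ⟩ ≈ᶜ 0ᶜ
      entries-vanish 𝐢 𝐣 = ≈⇒difference≈0 (operator A ⟨ 𝐢 , 𝐣 ⟩) (operator (φ u) ⟨ 𝐢 , 𝐣 ⟩)
        (ℂᴿ.sym (ℂᴿ.trans (φ-entry u 𝐢 𝐣) (proj₂ realised 𝐢 𝐣)))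

  -- Compatibility with equality of combinations, and injectivity.

  φ-cong : ∀ u v → u ≈ᵁ v → φ u ≈ᶻ φ v
  φ-cong u v u≈v x 𝐢 = ℂᴿ.trans (φ-apply u x 𝐢) (ℂᴿ.trans
    (weigh-≈ᵁ (λ d e d≗e → ℂᴿ.reflexive (transport-≗ d e d≗e (seq x) 𝐢)) u v u≈v)
    (ℂᴿ.sym (φ-apply v x 𝐢)))

  -- Evaluation at unit sequences recovers the entries, which determine the coefficients by
  -- triangularity.
  φ-injective : ∀ u v → φ u ≈ᶻ φ v → u ≈ᵁ v
  φ-injective u v h = entries-faithful u v λ 𝐢 𝐣 →
    ℂᴿ.trans (ℂᴿ.sym (φ-entry u 𝐢 𝐣)) (ℂᴿ.trans (h (unit 𝐣) 𝐢) (φ-entry v 𝐢 𝐣))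

theorem3 : (em : ExcludedMiddle 0ℓ) (ℝ : CompleteOrderedField) →
    let open CompleteOrderedField ℝ
        open Classical em ℝ
    in
    (k : ℕ) → .{{_ : NonZero k}} →
    (p : Carrier) (1≤p : 1# ≤ p) →
    (μ : ℕ → Carrier) (0<μ : ∀ i → 0# < μ i) →
    Summable (λ i → μ i ** p) →
    let open LᵖSpace p 1≤p μ 0<μ k
        open UniformBlockPermutations k
    in
    ∃ λ (φ : U → Centralizer) →
      RingMorphisms.IsRingIsomorphism U-ring centralizer-ring φ ×
      LeftModuleMorphisms.IsLeftModuleIsomorphism U-module centralizer-module φ
theorem3 em ℝ k p 1≤p μ 0<μ μ-summable = φ , ring-isomorphism , module-isomorphism
  where
  open Classical em ℝ
  open DiagramOperators em ℝ
  open LᵖSpace p 1≤p μ 0<μ k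
  open UniformBlockPermutations k
  open Representation p 1≤p μ 0<μ k
  open CentralizerEntries em ℝ p 1≤p μ 0<μ k

  -- Surjectivity is up to `_≈ᵁ_`: every combination equal to the preimage has to map to A as well.
  surjective : ∀ A → ∃ λ u → ∀ {v} → v ≈ᵁ u → φ v ≈ᶻ A
  surjective A = proj₁ preimage , λ {v} v≈u x 𝐢 →
    ℂᴿ.trans (φ-cong v (proj₁ preimage) v≈u x 𝐢) (proj₂ preimage x 𝐢)
    where
    preimage = φ-surjective μ-summable A

  ring-isomorphism : RingMorphisms.IsRingIsomorphism U-ring centralizer-ring φ
  ring-isomorphism = record
    { isRingMonomorphism = record
      { isRingHomomorphism = record
        { isSemiringHomomorphism = record
          { isNearSemiringHomomorphism = record
            { +-isMonoidHomomorphism = record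
              { isMagmaHomomorphism = record
                { isRelHomomorphism = record { cong = λ {u} {v} → φ-cong u v }
                ; homo = φ-+
                }
              ; ε-homo = λ x 𝐢 → ℂᴿ.refl
              }
            ; *-homo = φ-*
            }
          ; 1#-homo = φ-1
          }
        -- Negation is scaling by minus one on both sides.
        ; -‿homo = φ-• (-ᶜ 1ᶜ)
        }
      ; injective = λ {u} {v} → φ-injective u v
      }
    ; surjective = surjective
    }

  module-isomorphism : LeftModuleMorphisms.IsLeftModuleIsomorphism U-module centralizer-module φ
  module-isomorphism = record
    { isLeftModuleMonomorphism = record
      { isLeftModuleHomomorphism = record
        { +ᴹ-isGroupHomomorphism = record
          { isMonoidHomomorphism = record
            { isMagmaHomomorphism = record
              { isRelHomomorphism = record { cong = λ {u} {v} → φ-cong u v }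
              ; homo = φ-+
              }
            ; ε-homo = λ x 𝐢 → ℂᴿ.refl
            }
          ; ⁻¹-homo = φ-• (-ᶜ 1ᶜ)
          }
        ; *ₗ-homo = φ-•
        }
      ; injective = λ {u} {v} → φ-injective u v
      }
    ; surjective = surjective
    }
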